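{- Let $\delta\in(0,1/4)$, $c=10^{ -10}\delta$, and let $r,t,k,n$ be positive integers with $r\le k$ and $n>(2t+1)(k+r)-t$. If $\mathcal{A}\subset\binom{[n]}{k}$ has no matching of size $t+1$ and $|\mathcal{A}|>\binom nk-(1+\frac{rc}{n})\binom{n-t}{k}$, then there is $T\in\binom{[n]}{t}$ such that $|\mathcal{A}\triangle\mathcal{S}_T|<3\delta\binom{n-t-1}{k-1}$.
   Context: A matching of size $s$ in $\mathcal{A}$ is a collection of $s$ pairwise disjoint members of $\mathcal{A}$. For $T\subset[n]$, $\mathcal{S}_T=\{A\in\binom{[n]}{k}: A\cap T\neq\emptyset\}$. -}

module Defs where

open import Data.Bool using (Bool; true; false; _∧_; _xor_; if_then_else_)
open import Data.Nat using (ℕ; zero; suc; _≡ᵇ_)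
open import Data.Integer using (+_)
open import Data.List using (List; []; _∷_; [_]; _++_; map; length)
open import Data.List.Relation.Unary.All using (All)
open import Data.List.Relation.Unary.AllPairs using (AllPairs)
open import Data.Vec using (_∷_; [])
open import Data.Fin.Subset using (Subset; inside; outside; _∩_; ∣_∣; Empty)
open import Data.Fin.Subset.Properties using (nonempty?)
open import Data.Product using (Σ; _×_)
open import Data.Rational using (ℚ; _/_; _*_)
open import Relation.Nullary using (does)
open import Relation.Binary.PropositionalEquality using (_≡_)

ℕtoℚ : ℕ → ℚ
ℕtoℚ m = (+ m) / 1

allSubsets : (n : ℕ) → List (Subset n)
allSubsets zero = [ [] ]
allSubsets (suc n) = map (inside ∷_) (allSubsets n) ++ map (outside ∷_) (allSubsets n)

countᵇ : {A : Set} → (A → Bool) → List A → ℕ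
countᵇ p [] = 0
countᵇ p (x ∷ xs) = if p x then suc (countᵇ p xs) else countᵇ p xs

Family : ℕ → Set
Family n = Subset n → Bool

card : {n : ℕ} → Family n → ℕ
card {n} 𝒜 = countᵇ 𝒜 (allSubsets n)

IsKUniform : {n : ℕ} → ℕ → Family n → Set
IsKUniform k 𝒜 = ∀ A → 𝒜 A ≡ true → ∣ A ∣ ≡ k

meets : {n : ℕ} → Subset n → Subset n → Bool
meets A T = does (nonempty? (A ∩ T))

S[_,_] : {n : ℕ} → ℕ → Subset n → Family n
S[ k , T ] A = (∣ A ∣ ≡ᵇ k) ∧ meets A T

symDiffCard : {n : ℕ} → Family n → Family n → ℕ
symDiffCard {n} 𝒜 ℬ = countᵇ (λ A → 𝒜 A xor ℬ A) (allSubsets n)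

HasMatching : {n : ℕ} → Family n → ℕ → Set
HasMatching {n} 𝒜 s =
  Σ (List (Subset n)) λ M →
    length M ≡ s × All (λ A → 𝒜 A ≡ true) M × AllPairs (λ A B → Empty (A ∩ B)) M

cOf : ℚ → ℚ
cOf δ = δ * ((+ 1) / 10000000000)

module Submission where

-- Let 𝒢 be the family of k-sets outside 𝒜.  By Frankl's theorem on the Erdős matching conjecture,
-- applied to the r-fold upper shadow of 𝒜, at least C(n-t,k+r) of the (k+r)-sets have all their
-- k-subsets in 𝒢, while 𝒢 has only slightly more than C(n-t,k) members: this is almost tight in the
-- Kruskal-Katona theorem.  If at most (3/5) C(n-t-1,k-1) members of 𝒢 meet a t-set T, then counting
-- these (k+r)-sets off T and across T with Keevash's form of the theorem (real x in C(x,k)) improves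
-- the bound to the required one.  Such a T is found by induction along adjacent shifts.  For shifted
-- 𝒜 it consists of the t most favoured points: the slack n > (2t+1)(k+r) - t allows Frankl's average
-- over tuples of disjoint sets to be taken at level k+r as well, where it can only hold if the upper
-- shadow of the trace on the next point hardly grows, that is, if the trace is small.  If T works for
-- the shift of 𝒜 by a transposition τ, then for T or for τ(T) only slightly more than half of
-- C(n-t-1,k-1) is lost, which is below the threshold 3/5.

open import Defs
open import Data.Bool using (Bool; true; false; _∧_; _∨_; not; if_then_else_; _xor_)
open import Data.Bool.Properties using (∧-conicalˡ; ∧-conicalʳ; ∨-idem; ∧-idem; ∧-identityʳ) renaming (_≟_ to _≟ᵇ_)
open import Data.Nat using (ℕ; zero; suc; _+_; _*_; _∸_; _^_; _≤_; _<_; _≡ᵇ_; z≤n; s≤s; _!; NonZero; >-nonZero)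
open import Data.Nat.Properties
open import Data.Nat.Combinatorics using (_C_; nCk+nC[k+1]≡[n+1]C[k+1]; nC1≡n; k>n⇒nCk≡0)
open import Data.Nat.Coprimality using (Coprime)
open import Data.Nat.Tactic.RingSolver using (solve-∀)
open import Data.Fin as F using (Fin; zero; suc; _↑ʳ_)
import Data.Fin.Properties as Fin
open import Data.Fin.Subset using (Subset; ∣_∣; ∁; ⊥; ⊤; _∩_; Nonempty)
open import Data.Fin.Subset.Properties using (anySubset?; ∣∁p∣≡n∸∣p∣; ∣⊥∣≡0; ∣⊤∣≡n; nonempty?; x∈p∩q⁻; ∣p∣≤n)
open import Data.Vec using ([]; _∷_; lookup; _[_]≔_; tabulate; here; there)
open import Data.Vec.Properties using ([]=⇒lookup; lookup∘tabulate)
open import Data.List as List using (List; []; _∷_)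
import Data.List.Properties as List
open import Data.List.Relation.Unary.All using (All; []; _∷_)
import Data.List.Relation.Unary.All.Properties as All
open import Data.List.Relation.Unary.AllPairs using (AllPairs; []; _∷_)
import Data.List.Relation.Unary.AllPairs.Properties as AllPairs
open import Data.Product using (Σ; _×_; _,_; proj₁; proj₂)
open import Data.Sum using (_⊎_; inj₁; inj₂)
open import Data.Empty using (⊥-elim)
open import Relation.Nullary using (¬_; yes; no)
open import Relation.Nullary.Decidable using (_×-dec_; dec-true; dec-false)
open import Relation.Binary.PropositionalEquality using (_≡_; _≢_; refl; sym; trans; cong; cong₂; subst; subst₂; _≗_; module ≡-Reasoning)

-- The number of shifts is not bounded in advance, so no loss may accumulate along them: from the
-- crude bound 3/5 the local argument recovers the same strong bound each time, at most 10 k x / r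
-- missing sets, where x is the shortfall of |𝒜|. The fraction has to exceed the 1/2 lost in undoing
-- a shift, and 3/5 is what absorbing the quadratic term of the local argument allows: with b
-- missing sets and a = C(n-t-1,k-1) - b it needs 2 (k-1) b ≤ (n-t) a, and 3 (k-1) ≤ n-t reduces
-- this to 2 b ≤ 3 a.
--
-- In the local argument the cliques lost off T and those gained across T balance to first order,
-- and the next term decides. Hence Kruskal-Katona must be sharp for arbitrarily small deficits,
-- which is why a real argument in the binomial coefficient is needed. It is written as a fraction,
-- and Bernoulli's inequality turns the result into an inequality between integers.
--
-- The identity k C(n-t,k) = (n-t) C(n-t-1,k-1) turns the hypothesis on |𝒜| into 1000 k x ≤ δ r
-- C(n-t-1,k-1), so that the symmetric difference, at most twice the number of missing sets, is at
-- most a fiftieth of δ C(n-t-1,k-1).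

∧-true : ∀ {a b} → a ∧ b ≡ true → a ≡ true × b ≡ true
∧-true {a} {b} p = ∧-conicalˡ a b p , ∧-conicalʳ a b p

∧-intro : ∀ {a b} → a ≡ true → b ≡ true → a ∧ b ≡ true
∧-intro refl refl = refl

true≢false : ∀ {b} → b ≡ true → b ≡ false → ∀ {ℓ} {P : Set ℓ} → P
true≢false refl ()

not-true : ∀ {b} → not b ≡ true → b ≡ false
not-true {false} _ = refl

bool-ext : ∀ {a b} → (a ≡ true → b ≡ true) → (b ≡ true → a ≡ true) → a ≡ b
bool-ext {true}  f g = sym (f refl)
bool-ext {false} {true}  f g = g refl
bool-ext {false} {false} f g = refl

⟦_⟧ : Bool → ℕ
⟦ true ⟧  = 1
⟦ false ⟧ = 0

⟦⟧-mono : ∀ {a b} → (a ≡ true → b ≡ true) → ⟦ a ⟧ ≤ ⟦ b ⟧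
⟦⟧-mono {false} f = z≤n
⟦⟧-mono {true}  f rewrite f refl = ≤-refl

⟦⟧≤1 : ∀ a → ⟦ a ⟧ ≤ 1
⟦⟧≤1 true  = ≤-refl
⟦⟧≤1 false = z≤n

⟦∧⟧ : ∀ a b → ⟦ a ∧ b ⟧ ≡ ⟦ a ⟧ * ⟦ b ⟧
⟦∧⟧ true  b = sym (+-identityʳ ⟦ b ⟧)
⟦∧⟧ false b = refl

⟦⟧+⟦not⟧ : ∀ a → ⟦ a ⟧ + ⟦ not a ⟧ ≡ 1
⟦⟧+⟦not⟧ true  = refl
⟦⟧+⟦not⟧ false = refl

+-interchange : ∀ a b c d → (a + b) + (c + d) ≡ (a + c) + (b + d)
+-interchange = solve-∀

-- Sums over all subsets of Fin n, and over Fin n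

∑ : ∀ {n} → (Subset n → ℕ) → ℕ
∑ {zero}  f = f []
∑ {suc n} f = ∑ (λ A → f (true ∷ A)) + ∑ (λ A → f (false ∷ A))

∑-cong : ∀ {n} {f g : Subset n → ℕ} → f ≗ g → ∑ f ≡ ∑ g
∑-cong {zero}  e = e []
∑-cong {suc n} e = cong₂ _+_ (∑-cong (λ A → e (true ∷ A))) (∑-cong (λ A → e (false ∷ A)))

∑-mono : ∀ {n} {f g : Subset n → ℕ} → (∀ A → f A ≤ g A) → ∑ f ≤ ∑ g
∑-mono {zero}  e = e []
∑-mono {suc n} e = +-mono-≤ (∑-mono (λ A → e (true ∷ A))) (∑-mono (λ A → e (false ∷ A)))

∑-mono-< : ∀ {n} {f g : Subset n → ℕ} → (∀ A → f A ≤ g A) → ∀ A → f A < g A → ∑ f < ∑ g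
∑-mono-< {zero}  e [] l = l
∑-mono-< {suc n} e (true ∷ A) l =
  +-mono-<-≤ (∑-mono-< (λ A → e (true ∷ A)) A l) (∑-mono (λ A → e (false ∷ A)))
∑-mono-< {suc n} e (false ∷ A) l =
  +-mono-≤-< (∑-mono (λ A → e (true ∷ A))) (∑-mono-< (λ A → e (false ∷ A)) A l)

∑-+ : ∀ {n} (f g : Subset n → ℕ) → ∑ (λ A → f A + g A) ≡ ∑ f + ∑ g
∑-+ {zero}  f g = refl
∑-+ {suc n} f g = trans
  (cong₂ _+_ (∑-+ (λ A → f (true ∷ A)) (λ A → g (true ∷ A)))
             (∑-+ (λ A → f (false ∷ A)) (λ A → g (false ∷ A))))
  (+-interchange (∑ (λ A → f (true ∷ A))) _ _ _)

∑-*ˡ : ∀ {n} c (f : Subset n → ℕ) → ∑ (λ A → c * f A) ≡ c * ∑ f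
∑-*ˡ {zero}  c f = refl
∑-*ˡ {suc n} c f = trans
  (cong₂ _+_ (∑-*ˡ c (λ A → f (true ∷ A))) (∑-*ˡ c (λ A → f (false ∷ A))))
  (sym (*-distribˡ-+ c (∑ (λ A → f (true ∷ A))) _))

∑-*ʳ : ∀ {n} c (f : Subset n → ℕ) → ∑ (λ A → f A * c) ≡ ∑ f * c
∑-*ʳ c f = trans (∑-cong (λ A → *-comm (f A) c)) (trans (∑-*ˡ c f) (*-comm c _))

∑-zero : ∀ {n} → ∑ {n} (λ _ → 0) ≡ 0
∑-zero {zero}  = refl
∑-zero {suc n} = cong₂ _+_ (∑-zero {n}) (∑-zero {n})

∑-swap : ∀ {m n} (f : Subset m → Subset n → ℕ) →
  ∑ (λ A → ∑ (λ B → f A B)) ≡ ∑ (λ B → ∑ (λ A → f A B))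
∑-swap {zero}  f = refl
∑-swap {suc m} f = trans
  (cong₂ _+_ (∑-swap (λ A B → f (true ∷ A) B)) (∑-swap (λ A B → f (false ∷ A) B)))
  (sym (∑-+ (λ B → ∑ (λ A → f (true ∷ A) B)) (λ B → ∑ (λ A → f (false ∷ A) B))))

⨁ : ∀ {n} → (Fin n → ℕ) → ℕ
⨁ {zero}  f = 0
⨁ {suc n} f = f zero + ⨁ (λ i → f (suc i))

⨁-cong : ∀ {n} {f g : Fin n → ℕ} → f ≗ g → ⨁ f ≡ ⨁ g
⨁-cong {zero}  e = refl
⨁-cong {suc n} e = cong₂ _+_ (e zero) (⨁-cong (λ i → e (suc i)))

⨁-mono : ∀ {n} {f g : Fin n → ℕ} → (∀ i → f i ≤ g i) → ⨁ f ≤ ⨁ g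
⨁-mono {zero}  e = z≤n
⨁-mono {suc n} e = +-mono-≤ (e zero) (⨁-mono (λ i → e (suc i)))

⨁-*ˡ : ∀ {n} c (f : Fin n → ℕ) → ⨁ (λ i → c * f i) ≡ c * ⨁ f
⨁-*ˡ {zero}  c f = sym (*-zeroʳ c)
⨁-*ˡ {suc n} c f = trans (cong (c * f zero +_) (⨁-*ˡ c (λ i → f (suc i))))
  (sym (*-distribˡ-+ c (f zero) _))

⨁-*ʳ : ∀ {n} c (f : Fin n → ℕ) → ⨁ (λ i → f i * c) ≡ ⨁ f * c
⨁-*ʳ c f = trans (⨁-cong (λ i → *-comm (f i) c)) (trans (⨁-*ˡ c f) (*-comm c _))

⨁-+ : ∀ {n} (f g : Fin n → ℕ) → ⨁ (λ i → f i + g i) ≡ ⨁ f + ⨁ g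
⨁-+ {zero}  f g = refl
⨁-+ {suc n} f g = trans (cong (f zero + g zero +_) (⨁-+ (λ i → f (suc i)) (λ i → g (suc i))))
  (+-interchange (f zero) _ _ _)

⨁-zero : ∀ {n} → ⨁ {n} (λ _ → 0) ≡ 0
⨁-zero {zero}  = refl
⨁-zero {suc n} = ⨁-zero {n}

⨁-const : ∀ {n} c → ⨁ {n} (λ _ → c) ≡ n * c
⨁-const {zero}  c = refl
⨁-const {suc n} c = cong (c +_) (⨁-const {n} c)

∑-⨁-swap : ∀ {m n} (f : Subset m → Fin n → ℕ) →
  ∑ (λ A → ⨁ (λ i → f A i)) ≡ ⨁ (λ i → ∑ (λ A → f A i))
∑-⨁-swap {m} {zero}  f = ∑-zero {m}
∑-⨁-swap {m} {suc n} f = trans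
  (∑-+ (λ A → f A zero) (λ A → ⨁ (λ i → f A (suc i))))
  (cong (∑ (λ A → f A zero) +_) (∑-⨁-swap (λ A i → f A (suc i))))

-- Cardinalities of families

cnt : ∀ {n} → Family n → ℕ
cnt F = ∑ (λ A → ⟦ F A ⟧)

cnt-mono : ∀ {n} {F G : Family n} → (∀ A → F A ≡ true → G A ≡ true) → cnt F ≤ cnt G
cnt-mono h = ∑-mono (λ A → ⟦⟧-mono (h A))

cnt-cong : ∀ {n} {F G : Family n} → F ≗ G → cnt F ≡ cnt G
cnt-cong h = ∑-cong (λ A → cong ⟦_⟧ (h A))

∈⇒1≤cnt : ∀ {n} (F : Family n) A → F A ≡ true → 1 ≤ cnt F
∈⇒1≤cnt {n} F A p = ≤-trans (s≤s (≤-reflexive (sym (∑-zero {n}))))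
  (∑-mono-< {f = λ _ → 0} {g = λ B → ⟦ F B ⟧} (λ _ → z≤n) A (≤-reflexive (cong ⟦_⟧ (sym p))))

cnt≡0⇒∉ : ∀ {n} (F : Family n) → cnt F ≡ 0 → ∀ A → F A ≡ false
cnt≡0⇒∉ F e A with F A in eq
... | false = refl
... | true  = ⊥-elim (1+n≰n (≤-trans (∈⇒1≤cnt F A eq) (≤-reflexive e)))

∉⇒cnt≡0 : ∀ {n} (F : Family n) → (∀ A → F A ≡ false) → cnt F ≡ 0
∉⇒cnt≡0 {n} F h = trans (∑-cong (λ A → cong ⟦_⟧ (h A))) (∑-zero {n})

⨁-∣∣ : ∀ {n} (A : Subset n) → ⨁ (λ i → ⟦ lookup A i ⟧) ≡ ∣ A ∣
⨁-∣∣ []          = refl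
⨁-∣∣ (true ∷ A)  = cong suc (⨁-∣∣ A)
⨁-∣∣ (false ∷ A) = ⨁-∣∣ A

∑-∣∣ : ∀ {n} (f : Subset n → ℕ) → ∑ (λ A → ∣ A ∣ * f A) ≡ ⨁ (λ i → ∑ (λ A → ⟦ lookup A i ⟧ * f A))
∑-∣∣ f = trans (∑-cong (λ A → trans (cong (_* f A) (sym (⨁-∣∣ A))) (sym (⨁-*ʳ (f A) (λ i → ⟦ lookup A i ⟧)))))
               (∑-⨁-swap (λ A i → ⟦ lookup A i ⟧ * f A))

-- Adding `i` is a bijection from the sets that miss `i` onto the sets that contain it.
∑-split : ∀ {n} (i : Fin n) (f : Subset n → ℕ) →
  ∑ (λ A → ⟦ lookup A i ⟧ * f A) ≡ ∑ (λ A → ⟦ not (lookup A i) ⟧ * f (A [ i ]≔ true))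
∑-split {suc n} zero f =
  trans (cong (∑ (λ A → f (true ∷ A) + 0) +_) (∑-zero {n}))
        (trans (+-comm _ 0) (cong (_+ ∑ (λ A → f (true ∷ A) + 0)) (sym (∑-zero {n}))))
∑-split {suc n} (suc i) f = cong₂ _+_ (∑-split i _) (∑-split i _)

-- Adding and deleting points

add∈ : ∀ {n} (A : Subset n) i → lookup (A [ i ]≔ true) i ≡ true
add∈ (a ∷ A) zero    = refl
add∈ (a ∷ A) (suc i) = add∈ A i

del∉ : ∀ {n} (A : Subset n) i → lookup (A [ i ]≔ false) i ≡ false
del∉ (a ∷ A) zero    = refl
del∉ (a ∷ A) (suc i) = del∉ A i

≔-other : ∀ {n} (A : Subset n) i j {b} → i ≢ j → lookup (A [ i ]≔ b) j ≡ lookup A j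
≔-other (a ∷ A) zero    zero    ne = ⊥-elim (ne refl)
≔-other (a ∷ A) zero    (suc j) ne = refl
≔-other (a ∷ A) (suc i) zero    ne = refl
≔-other (a ∷ A) (suc i) (suc j) ne = ≔-other A i j (λ e → ne (cong suc e))

≔-comm : ∀ {n} (A : Subset n) i j {b c} → i ≢ j → (A [ i ]≔ b) [ j ]≔ c ≡ (A [ j ]≔ c) [ i ]≔ b
≔-comm (a ∷ A) zero    zero    ne = ⊥-elim (ne refl)
≔-comm (a ∷ A) zero    (suc j) ne = refl
≔-comm (a ∷ A) (suc i) zero    ne = refl
≔-comm (a ∷ A) (suc i) (suc j) ne = cong (a ∷_) (≔-comm A i j (λ e → ne (cong suc e)))

del-add : ∀ {n} (A : Subset n) i → lookup A i ≡ false → (A [ i ]≔ true) [ i ]≔ false ≡ A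
del-add (a ∷ A) zero    refl = refl
del-add (a ∷ A) (suc i) e    = cong (a ∷_) (del-add A i e)

∣add∣ : ∀ {n} (A : Subset n) i → lookup A i ≡ false → ∣ A [ i ]≔ true ∣ ≡ suc ∣ A ∣
∣add∣ (false ∷ A) zero    e = refl
∣add∣ (true ∷ A)  (suc i) e = cong suc (∣add∣ A i e)
∣add∣ (false ∷ A) (suc i) e = ∣add∣ A i e

∣del∣ : ∀ {n} (A : Subset n) i → lookup A i ≡ true → suc ∣ A [ i ]≔ false ∣ ≡ ∣ A ∣
∣del∣ (true ∷ A)  zero    e = refl
∣del∣ (true ∷ A)  (suc i) e = cong suc (∣del∣ A i e)
∣del∣ (false ∷ A) (suc i) e = ∣del∣ A i e

-- Disjointness

disj : ∀ {n} → Subset n → Subset n → Bool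
disj []      []      = true
disj (a ∷ A) (b ∷ B) = not (a ∧ b) ∧ disj A B

disj-sym : ∀ {n} (A B : Subset n) → disj A B ≡ disj B A
disj-sym []          []          = refl
disj-sym (true ∷ A)  (true ∷ B)  = refl
disj-sym (true ∷ A)  (false ∷ B) = disj-sym A B
disj-sym (false ∷ A) (true ∷ B)  = disj-sym A B
disj-sym (false ∷ A) (false ∷ B) = disj-sym A B

disj-elim : ∀ {n} (A B : Subset n) → disj A B ≡ true → ∀ i → lookup A i ≡ true → lookup B i ≡ false
disj-elim (true ∷ A) (false ∷ B) d zero    e = refl
disj-elim (a ∷ A)    (b ∷ B)     d (suc i) e = disj-elim A B (proj₂ (∧-true {not (a ∧ b)} d)) i e

disj-intro : ∀ {n} (A B : Subset n) → (∀ i → lookup A i ≡ true → lookup B i ≡ false) → disj A B ≡ true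
disj-intro []          []          h = refl
disj-intro (true ∷ A)  (b ∷ B)     h rewrite h zero refl = disj-intro A B (λ i → h (suc i))
disj-intro (false ∷ A) (b ∷ B)     h = disj-intro A B (λ i → h (suc i))

disj-sub : ∀ {n} (A B X : Subset n) → (∀ i → lookup A i ≡ true → lookup B i ≡ true) →
  disj B X ≡ true → disj A X ≡ true
disj-sub A B X s d = disj-intro A X (λ i e → disj-elim B X d i (s i e))

del⊆ : ∀ {n} (A : Subset n) i j → lookup (A [ i ]≔ false) j ≡ true → lookup A j ≡ true
del⊆ A i j e with i Fin.≟ j
... | yes refl = true≢false e (del∉ A i)
... | no ne    = trans (sym (≔-other A i j ne)) e

⊆add : ∀ {n} (A : Subset n) i j → lookup A j ≡ true → lookup (A [ i ]≔ true) j ≡ true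
⊆add A i j e with i Fin.≟ j
... | yes refl = add∈ A i
... | no ne    = trans (≔-other A i j ne) e

disj-del : ∀ {n} (A X : Subset n) i → disj A X ≡ true → disj (A [ i ]≔ false) X ≡ true
disj-del A X i = disj-sub (A [ i ]≔ false) A X (del⊆ A i)

disj-⊥ : ∀ {n} (A : Subset n) → disj A ⊥ ≡ true
disj-⊥ []          = refl
disj-⊥ (true ∷ A)  = disj-⊥ A
disj-⊥ (false ∷ A) = disj-⊥ A

_∪̇_ : ∀ {n} → Subset n → Subset n → Subset n
[]      ∪̇ []      = []
(a ∷ A) ∪̇ (b ∷ B) = (a ∨ b) ∷ (A ∪̇ B)

disj-∪ : ∀ {n} (A B X : Subset n) → disj A (X ∪̇ B) ≡ disj A X ∧ disj A B
disj-∪ [] [] [] = refl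
disj-∪ (false ∷ A) (b ∷ B) (x ∷ X) = disj-∪ A B X
disj-∪ (true ∷ A) (b ∷ B) (true ∷ X) = refl
disj-∪ (true ∷ A) (true ∷ B) (false ∷ X) with disj A X
... | true = refl
... | false = refl
disj-∪ (true ∷ A) (false ∷ B) (false ∷ X) = disj-∪ A B X

∣∁∪∣ : ∀ {n} (X B : Subset n) → disj B X ≡ true → ∣ ∁ (X ∪̇ B) ∣ + ∣ B ∣ ≡ ∣ ∁ X ∣
∣∁∪∣ []          []          d = refl
∣∁∪∣ (true ∷ X)  (false ∷ B) d = ∣∁∪∣ X B d
∣∁∪∣ (false ∷ X) (true ∷ B)  d = trans (+-suc _ _) (cong suc (∣∁∪∣ X B d))
∣∁∪∣ (false ∷ X) (false ∷ B) d = cong suc (∣∁∪∣ X B d)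

-- Slices: sets of a given size off a given set

≡ᵇ-true : ∀ m n → (m ≡ᵇ n) ≡ true → m ≡ n
≡ᵇ-true zero    zero    e = refl
≡ᵇ-true (suc m) (suc n) e = cong suc (≡ᵇ-true m n e)

≡ᵇ-refl : ∀ {m n} → m ≡ n → (m ≡ᵇ n) ≡ true
≡ᵇ-refl {zero}  refl = refl
≡ᵇ-refl {suc m} refl = ≡ᵇ-refl {m} refl

-- Sets are kept off `X` instead of passing to a smaller ground set, so that families on different
-- complements share the type `Subset n`.
slice : ∀ {n} → ℕ → Subset n → Family n
slice k X A = (∣ A ∣ ≡ᵇ k) ∧ disj A X

slice-intro : ∀ {n k} {X A : Subset n} → ∣ A ∣ ≡ k → disj A X ≡ true → slice k X A ≡ true
slice-intro {X = X} {A} e d = ∧-intro (≡ᵇ-refl {∣ A ∣} e) d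

slice-elim : ∀ {n k} {X A : Subset n} → slice k X A ≡ true → ∣ A ∣ ≡ k × disj A X ≡ true
slice-elim {k = k} {X} {A} p = ≡ᵇ-true _ k (proj₁ (∧-true {∣ A ∣ ≡ᵇ k} p)) , proj₂ (∧-true {∣ A ∣ ≡ᵇ k} p)

cnt-slice : ∀ {n} k (X : Subset n) → cnt (slice k X) ≡ ∣ ∁ X ∣ C k
cnt-slice zero    []         = refl
cnt-slice (suc k) []         = refl
cnt-slice {suc n} k (true ∷ X) =
  cong₂ _+_ (∉⇒cnt≡0 {n} (λ A → slice k (true ∷ X) (true ∷ A)) λ A → ∧-zeroʳ' (suc ∣ A ∣ ≡ᵇ k)) (cnt-slice k X)
  where
  ∧-zeroʳ' : ∀ b → b ∧ false ≡ false
  ∧-zeroʳ' true  = refl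
  ∧-zeroʳ' false = refl
cnt-slice {suc n} zero (false ∷ X) = cong₂ _+_ (∑-zero {n}) (trans (cnt-slice 0 X) refl)
cnt-slice (suc k) (false ∷ X) =
  trans (cong₂ _+_ (cnt-slice k X) (cnt-slice (suc k) X)) (nCk+nC[k+1]≡[n+1]C[k+1] ∣ ∁ X ∣ k)

∀ᵇ : ∀ {n} → (Fin n → Bool) → Bool
∀ᵇ {zero}  p = true
∀ᵇ {suc n} p = p zero ∧ ∀ᵇ (λ i → p (suc i))

∀ᵇ-elim : ∀ {n} (p : Fin n → Bool) → ∀ᵇ p ≡ true → ∀ i → p i ≡ true
∀ᵇ-elim p e zero    = proj₁ (∧-true e)
∀ᵇ-elim p e (suc i) = ∀ᵇ-elim (λ i → p (suc i)) (proj₂ (∧-true {p zero} e)) i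

∀ᵇ-intro : ∀ {n} (p : Fin n → Bool) → (∀ i → p i ≡ true) → ∀ᵇ p ≡ true
∀ᵇ-intro {zero}  p h = refl
∀ᵇ-intro {suc n} p h = ∧-intro (h zero) (∀ᵇ-intro (λ i → p (suc i)) (λ i → h (suc i)))

imp-elim : ∀ {a b} → not a ∨ b ≡ true → a ≡ true → b ≡ true
imp-elim h refl = h

imp-intro : ∀ {a b} → (a ≡ true → b ≡ true) → not a ∨ b ≡ true
imp-intro {true}  h = h refl
imp-intro {false} h = refl

-- Cliques

up : ∀ {n} → ℕ → Subset n → Family n → Family n
up k X F A = slice (suc k) X A ∧ ∀ᵇ (λ i → not (lookup A i) ∨ F (A [ i ]≔ false))

module _ {n k : ℕ} {X : Subset n} {F : Family n} {A : Subset n} where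

  up-slice : up k X F A ≡ true → slice (suc k) X A ≡ true
  up-slice p = proj₁ (∧-true p)

  up-del : up k X F A ≡ true → ∀ i → lookup A i ≡ true → F (A [ i ]≔ false) ≡ true
  up-del p i = imp-elim {lookup A i} (∀ᵇ-elim (λ i → not (lookup A i) ∨ F (A [ i ]≔ false)) (proj₂ (∧-true {slice (suc k) X A} p)) i)

  up-intro : slice (suc k) X A ≡ true → (∀ i → lookup A i ≡ true → F (A [ i ]≔ false) ≡ true) →
    up k X F A ≡ true
  up-intro s h = ∧-intro s (∀ᵇ-intro _ (λ i → imp-intro (h i)))

up-uniform : ∀ {n} k (X : Subset n) F → IsKUniform (suc k) (up k X F)
up-uniform k X F A p = proj₁ (slice-elim {X = X} {A} (up-slice {X = X} {F} {A} p))

up-mono : ∀ {n} k (X : Subset n) {F G : Family n} → (∀ A → F A ≡ true → G A ≡ true) →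
  ∀ A → up k X F A ≡ true → up k X G A ≡ true
up-mono k X {F} {G} h A p = up-intro {X = X} {G} {A} (up-slice {X = X} {F} {A} p) (λ i e → h _ (up-del {X = X} {F} {A} p i e))

-- For a k-uniform `F`, read as a hypergraph, these are its cliques on `r + k` points: sets all of
-- whose k-subsets lie in `F`.
upI : ∀ {n} → ℕ → Subset n → ℕ → Family n → Family n
upI k X zero    F = F
upI k X (suc r) F = up (r + k) X (upI k X r F)

upI-uniform : ∀ {n} k (X : Subset n) r F → IsKUniform k F → IsKUniform (r + k) (upI k X r F)
upI-uniform k X zero    F u = u
upI-uniform k X (suc r) F u = up-uniform (r + k) X (upI k X r F)

member : ∀ {n k} (A : Subset n) → ∣ A ∣ ≡ suc k → Σ (Fin n) λ i → lookup A i ≡ true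
member (true ∷ A)  e = zero , refl
member (false ∷ A) e = let i , p = member A e in suc i , p

up-empty : ∀ {n} k (X : Subset n) F → cnt F ≡ 0 → cnt (up k X F) ≡ 0
up-empty k X F z = ∉⇒cnt≡0 (up k X F) λ A → none A (up k X F A) refl
  where
  none : ∀ A b → up k X F A ≡ b → b ≡ false
  none A false _ = refl
  none A true  e =
    let i , p = member A (up-uniform k X F A e)
    in true≢false (up-del {X = X} {F} {A} e i p) (cnt≡0⇒∉ F z (A [ i ]≔ false))

-- Links and degrees

link : ∀ {n} → Fin n → Family n → Family n
link v F B = not (lookup B v) ∧ F (B [ v ]≔ true)

deg : ∀ {n} → Fin n → Family n → ℕ
deg v F = ∑ (λ A → ⟦ lookup A v ⟧ * ⟦ F A ⟧)

cnt-link : ∀ {n} v (F : Family n) → deg v F ≡ cnt (link v F)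
cnt-link v F = trans (∑-split v (λ A → ⟦ F A ⟧)) (∑-cong (λ A → sym (⟦∧⟧ (not (lookup A v)) (F (A [ v ]≔ true)))))

link-uniform : ∀ {n k} v (F : Family n) → IsKUniform (suc k) F → IsKUniform k (link v F)
link-uniform v F u A p =
  let a , f = ∧-true {not (lookup A v)} p
  in suc-injective (trans (sym (∣add∣ A v (not-true a))) (u _ f))

-- Removing `v` from a clique through `v` leaves a clique of the link. The condition `Z`, stable
-- under deleting points other than `v`, is carried along so that links can later be restricted to
-- sets whose first point in T is `v`.
link-up : ∀ {n} k (X : Subset n) v (Z F : Family n) →
  (∀ A i → lookup (A [ i ]≔ false) v ≡ true → Z A ≡ true → Z (A [ i ]≔ false) ≡ true) →
  ∀ A → link v (λ B → Z B ∧ up (suc k) X F B) A ≡ true → up k X (link v (λ B → Z B ∧ F B)) A ≡ true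
link-up k X v Z F cl A p = up-intro {X = X} {link v (λ B → Z B ∧ F B)} {A} sl dl
  where
  v∉ : lookup A v ≡ false
  v∉ = not-true (proj₁ (∧-true {not (lookup A v)} p))
  A⁺ = A [ v ]≔ true
  zA : Z A⁺ ≡ true
  zA = proj₁ (∧-true (proj₂ (∧-true {not (lookup A v)} p)))
  uA : up (suc k) X F A⁺ ≡ true
  uA = proj₂ (∧-true {Z A⁺} (proj₂ (∧-true {not (lookup A v)} p)))
  szd = slice-elim {X = X} {A⁺} (up-slice {X = X} {F} {A⁺} uA)
  sl : slice (suc k) X A ≡ true
  sl = slice-intro {X = X} {A} (suc-injective (trans (sym (∣add∣ A v v∉)) (proj₁ szd)))
         (disj-sub A A⁺ X (⊆add A v) (proj₂ szd))
  dl : ∀ i → lookup A i ≡ true → link v (λ B → Z B ∧ F B) (A [ i ]≔ false) ≡ true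
  dl i e = ∧-intro (cong not (trans (≔-other A i v i≢v) v∉))
             (subst (λ B → Z B ∧ F B ≡ true) (sym (≔-comm A i v i≢v))
               (∧-intro (cl A⁺ i (trans (≔-other A⁺ i v i≢v) (add∈ A v)) zA)
                        (up-del {X = X} {F} {A⁺} uA i (⊆add A v i e))))
    where
    i≢v : i ≢ v
    i≢v refl = true≢false e v∉

⨁-deg : ∀ {n} k (F : Family n) → IsKUniform k F → ⨁ (λ v → deg v F) ≡ k * cnt F
⨁-deg k F u = trans (sym (∑-∣∣ (λ A → ⟦ F A ⟧))) (trans (∑-cong sz) (∑-*ˡ k (λ A → ⟦ F A ⟧)))
  where
  sz : ∀ A → ∣ A ∣ * ⟦ F A ⟧ ≡ k * ⟦ F A ⟧
  sz A with F A in eq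
  ... | true  = cong (_* 1) (u A eq)
  ... | false = trans (*-zeroʳ ∣ A ∣) (sym (*-zeroʳ k))

-- Deleting `v` sends the cliques through `v` injectively to members of `F` that miss `v`, and the
-- second term counts the members that contain it.
deg-up : ∀ {n} k (X : Subset n) F v → deg v (up k X F) + deg v F ≤ cnt F
deg-up k X F v = begin
  deg v (up k X F) + deg v F
    ≡⟨ cong (_+ deg v F) (∑-split v (λ A → ⟦ up k X F A ⟧)) ⟩
  ∑ (λ A → ⟦ not (lookup A v) ⟧ * ⟦ up k X F (A [ v ]≔ true) ⟧) + deg v F
    ≡⟨ sym (∑-+ _ (λ A → ⟦ lookup A v ⟧ * ⟦ F A ⟧)) ⟩
  ∑ (λ A → ⟦ not (lookup A v) ⟧ * ⟦ up k X F (A [ v ]≔ true) ⟧ + ⟦ lookup A v ⟧ * ⟦ F A ⟧)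
    ≤⟨ ∑-mono pointwise ⟩
  cnt F ∎
  where
  open ≤-Reasoning
  pointwise : ∀ A → ⟦ not (lookup A v) ⟧ * ⟦ up k X F (A [ v ]≔ true) ⟧ + ⟦ lookup A v ⟧ * ⟦ F A ⟧ ≤ ⟦ F A ⟧
  pointwise A with lookup A v in eq
  ... | true  = ≤-reflexive (+-identityʳ _)
  ... | false = ≤-trans (≤-reflexive (trans (+-identityʳ _) (+-identityʳ _)))
    (⟦⟧-mono (λ u → subst (λ B → F B ≡ true) (del-add A v eq) (up-del {X = X} {F} {A [ v ]≔ true} u v (add∈ A v))))

-- A rational form of Lovász's version of the Kruskal-Katona theorem.  With x = p / q,
-- ff p q k = q ^ k * x (x - 1) ... (x - k + 1).

ff : ℕ → ℕ → ℕ → ℕ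
ff p q zero    = 1
ff p q (suc k) = p * ff (p ∸ q) q k

-- The definition peels off the first factor, as the passage from x to x - 1 in a link requires;
-- going up one level needs the last factor.
ff-snoc : ∀ p q k → ff p q (suc k) ≡ ff p q k * (p ∸ k * q)
ff-snoc p q zero    = trans (*-identityʳ p) (sym (*-identityˡ p))
ff-snoc p q (suc k) = trans (cong (p *_) (ff-snoc (p ∸ q) q k))
  (trans (sym (*-assoc p (ff (p ∸ q) q k) _)) (cong (p * ff (p ∸ q) q k *_) (∸-+-assoc p q (k * q))))

-- Keevash's inductive proof: compare each vertex degree with the one of a clique on x points.
kk : ∀ k p q {n} (X : Subset n) (H : Family n) → 1 ≤ k → 1 ≤ q → IsKUniform k H →
  cnt H * (q ^ k * k !) ≤ ff p q k →
  q * suc k * cnt (up k X H) + k * q * cnt H ≤ p * cnt H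
kk (suc k) p q@(suc _) {n} X H _ 1≤q u small = *-cancelˡ-≤ (suc k) (begin
  suc k * (q * suc (suc k) * cnt U + suc k * q * cnt H)
    ≡⟨ lhs (suc k) q (suc (suc k)) (cnt U) (cnt H) ⟩
  q * suc k * (suc (suc k) * cnt U) + suc k * q * (suc k * cnt H)
    ≡⟨ sym (cong₂ (λ x y → q * suc k * x + suc k * q * y) (⨁-deg (suc (suc k)) U (up-uniform (suc k) X H)) (⨁-deg (suc k) H u)) ⟩
  q * suc k * ⨁ (λ v → deg v U) + suc k * q * ⨁ (λ v → deg v H)
    ≡⟨ sym (cong₂ _+_ (⨁-*ˡ (q * suc k) (λ v → deg v U)) (⨁-*ˡ (suc k * q) (λ v → deg v H))) ⟩
  ⨁ (λ v → q * suc k * deg v U) + ⨁ (λ v → suc k * q * deg v H)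
    ≡⟨ sym (⨁-+ (λ v → q * suc k * deg v U) (λ v → suc k * q * deg v H)) ⟩
  ⨁ (λ v → q * suc k * deg v U + suc k * q * deg v H)
    ≤⟨ ⨁-mono vertex ⟩
  ⨁ (λ v → p * deg v H)
    ≡⟨ ⨁-*ˡ p (λ v → deg v H) ⟩
  p * ⨁ (λ v → deg v H)
    ≡⟨ cong (p *_) (⨁-deg (suc k) H u) ⟩
  p * (suc k * cnt H)
    ≡⟨ rhs p (suc k) (cnt H) ⟩
  suc k * (p * cnt H) ∎)
  where
  open ≤-Reasoning
  U = up (suc k) X H
  lhs : ∀ k q l a b → k * (q * l * a + k * q * b) ≡ q * k * (l * a) + k * q * (k * b)
  lhs = solve-∀
  rhs : ∀ p k b → p * (k * b) ≡ k * (p * b)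
  rhs = solve-∀

  deg-U : ∀ v → deg v U ≤ cnt (up k X (link v H))
  deg-U v = ≤-trans (≤-reflexive (cnt-link v U)) (cnt-mono (link-up k X v (λ _ → true) H (λ _ _ _ e → e)))

  vertex : ∀ v → q * suc k * deg v U + suc k * q * deg v H ≤ p * deg v H
  vertex v with deg v H in eq
  ... | zero = ≤-trans (≤-reflexive (trans (cong₂ (λ x y → q * suc k * x + y) deg0 (*-zeroʳ (suc k * q)))
                 (trans (+-identityʳ _) (*-zeroʳ (q * suc k))))) z≤n
    where
    deg0 : deg v U ≡ 0
    deg0 = n≤0⇒n≡0 (≤-trans (deg-U v) (≤-reflexive (up-empty k X (link v H) (trans (sym (cnt-link v H)) eq))))
  ... | d@(suc d′) with ff (p ∸ q) q k ≤? d * (q ^ k * k !)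
  -- Large degree: it is at least C(x-1,k), while |H| is at most C(x,k+1). So |H| is at most x / (k
  -- + 1) times the degree, and `deg-up` suffices.
  ...   | yes big = begin
    q * suc k * deg v U + suc k * q * d  ≡⟨ a₁ q (suc k) (deg v U) d ⟩
    q * suc k * (deg v U + d)            ≤⟨ *-monoʳ-≤ (q * suc k) (subst (λ e → deg v U + e ≤ cnt H) eq (deg-up (suc k) X H v)) ⟩
    q * suc k * cnt H                    ≤⟨ *-cancelʳ-≤ (q * suc k * cnt H) (p * d) (q ^ k * k !) {{w≢0}} (begin
      q * suc k * cnt H * (q ^ k * k !)      ≡⟨ a₂ q (suc k) (cnt H) (q ^ k) (k !) ⟩
      cnt H * (q ^ suc k * suc k !)          ≤⟨ small ⟩
      p * ff (p ∸ q) q k                     ≤⟨ *-monoʳ-≤ p big ⟩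
      p * (d * (q ^ k * k !))                ≡⟨ sym (*-assoc p d _) ⟩
      p * d * (q ^ k * k !)                  ∎) ⟩
    p * d ∎
    where
    a₁ : ∀ q k a d → q * k * a + k * q * d ≡ q * k * (a + d)
    a₁ = solve-∀
    a₂ : ∀ q k N a b → q * k * N * (a * b) ≡ N * (q * a * (k * b))
    a₂ = solve-∀
    w≢0 : NonZero (q ^ k * k !)
    w≢0 = m*n≢0 (q ^ k) (k !) {{m^n≢0 q k}} {{k !≢0}}
  -- Small degree: the link has at most C(x-1,k) members and induction applies with x - 1. For k = 0
  -- this cannot happen, since a positive degree is not below C(x-1,0) = 1.
  ...   | no ¬big = rest k eq (≰⇒> ¬big) (deg-U v) (λ 1≤k small′ → kk k (p ∸ q) q X (link v H) 1≤k 1≤q (link-uniform v H u) small′)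
    where
    L = cnt (link v H)
    rest : ∀ k → deg v H ≡ d → d * (q ^ k * k !) < ff (p ∸ q) q k → deg v U ≤ cnt (up k X (link v H)) →
      (1 ≤ k → L * (q ^ k * k !) ≤ ff (p ∸ q) q k →
         q * suc k * cnt (up k X (link v H)) + k * q * L ≤ (p ∸ q) * L) →
      q * suc k * deg v U + suc k * q * d ≤ p * d
    rest zero eq (s≤s ()) _ _
    rest k@(suc k′) eq lt dU ih = begin
      q * suc k * deg v U + suc k * q * d        ≤⟨ +-monoˡ-≤ _ (*-monoʳ-≤ (q * suc k) dU) ⟩
      q * suc k * W + suc k * q * d              ≡⟨ b₁ (q * suc k * W) k q d ⟩
      (q * suc k * W + k * q * d) + q * d        ≤⟨ +-monoˡ-≤ (q * d) ih′ ⟩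
      (p ∸ q) * d + q * d                        ≡⟨ sym (*-distribʳ-+ d (p ∸ q) q) ⟩
      (p ∸ q + q) * d                            ≡⟨ cong (_* d) (m∸n+n≡m q≤p) ⟩
      p * d                                      ∎
      where
      W = cnt (up k X (link v H))
      L≡d : L ≡ d
      L≡d = trans (sym (cnt-link v H)) eq
      ih′ : q * suc k * W + k * q * d ≤ (p ∸ q) * d
      ih′ = subst (λ e → q * suc k * W + k * q * e ≤ (p ∸ q) * e) L≡d
        (ih (s≤s z≤n) (subst (λ e → e * (q ^ k * k !) ≤ ff (p ∸ q) q k) (sym L≡d) (<⇒≤ lt)))
      b₁ : ∀ x k q d → x + (q + k * q) * d ≡ (x + k * q * d) + q * d
      b₁ = solve-∀
      kq≤ : k * q ≤ p ∸ q
      kq≤ = *-cancelʳ-≤ (k * q) (p ∸ q) d (≤-trans (m≤n+m (k * q * d) (q * suc k * W)) ih′)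
      -- The subtraction `p ∸ q` is truncated, but it is positive because the induction hypothesis
      -- bounds `k * q` by it.
      q≤p : q ≤ p
      q≤p with q ≤? p
      ... | yes h = h
      ... | no h  = ⊥-elim (1+n≰n {0} (≤-trans (≤-trans (*-mono-≤ (s≤s {0} {k′} z≤n) 1≤q) kq≤) (≤-reflexive (m≤n⇒m∸n≡0 (<⇒≤ (≰⇒> h))))))

-- Iterated cliques and binomial coefficients

absorb : ∀ n k → suc k * (suc n C suc k) ≡ suc n * (n C k)
absorb n       zero    = trans (+-identityʳ (suc n C 1)) (trans (nC1≡n (suc n)) (sym (*-identityʳ (suc n))))
absorb zero    (suc k) = *-zeroʳ k
absorb (suc n) (suc k) = begin
  suc (suc k) * (suc (suc n) C suc (suc k))
    ≡⟨ cong (suc (suc k) *_) (sym (nCk+nC[k+1]≡[n+1]C[k+1] (suc n) (suc k))) ⟩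
  suc (suc k) * ((suc n C suc k) + (suc n C suc (suc k)))
    ≡⟨ e₁ k (suc n C suc k) (suc n C suc (suc k)) ⟩
  (suc n C suc k) + suc k * (suc n C suc k) + suc (suc k) * (suc n C suc (suc k))
    ≡⟨ cong₂ (λ x y → (suc n C suc k) + x + y) (absorb n k) (absorb n (suc k)) ⟩
  (suc n C suc k) + suc n * (n C k) + suc n * (n C suc k)
    ≡⟨ e₂ (suc n) (suc n C suc k) (n C k) (n C suc k) ⟩
  (suc n C suc k) + suc n * ((n C k) + (n C suc k))
    ≡⟨ cong (λ x → (suc n C suc k) + suc n * x) (nCk+nC[k+1]≡[n+1]C[k+1] n k) ⟩
  suc (suc n) * (suc n C suc k) ∎
  where
  open ≡-Reasoning
  e₁ : ∀ k a b → (2 + k) * (a + b) ≡ a + (1 + k) * a + (2 + k) * b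
  e₁ = solve-∀
  e₂ : ∀ n c a b → c + n * a + n * b ≡ c + n * (a + b)
  e₂ = solve-∀

C-step : ∀ n k → suc k * (n C suc k) ≡ (n ∸ k) * (n C k)
C-step zero    k = trans (*-zeroʳ k) (sym (cong (_* (0 C k)) (0∸n≡0 k)))
C-step (suc n) k with k ≤? suc n
... | no k≰ = trans (cong (suc k *_) (k>n⇒nCk≡0 (<-trans (≰⇒> k≰) (n<1+n k))))
                (trans (*-zeroʳ (suc k)) (sym (trans (cong ((suc n ∸ k) *_) (k>n⇒nCk≡0 (≰⇒> k≰))) (*-zeroʳ (suc n ∸ k)))))
... | yes k≤ = +-cancelˡ-≡ (k * (suc n C k)) _ _ (begin
  k * (suc n C k) + suc k * (suc n C suc k)
    ≡⟨ cong (k * (suc n C k) +_) (absorb n k) ⟩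
  k * (suc n C k) + suc n * (n C k)
    ≡⟨ shift k k≤ ⟩
  suc n * (suc n C k)
    ≡⟨ cong (_* (suc n C k)) (sym (m+[n∸m]≡n k≤)) ⟩
  (k + (suc n ∸ k)) * (suc n C k)
    ≡⟨ *-distribʳ-+ (suc n C k) k _ ⟩
  k * (suc n C k) + (suc n ∸ k) * (suc n C k) ∎)
  where
  open ≡-Reasoning
  shift : ∀ k → k ≤ suc n → k * (suc n C k) + suc n * (n C k) ≡ suc n * (suc n C k)
  shift zero    _ = refl
  shift (suc k) _ = trans (cong (_+ suc n * (n C suc k)) (absorb n k))
    (trans (sym (*-distribˡ-+ (suc n) (n C k) (n C suc k))) (cong (suc n *_) (nCk+nC[k+1]≡[n+1]C[k+1] n k)))

ff-C : ∀ n k → ff n 1 k ≡ k ! * (n C k)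
ff-C n zero    = refl
ff-C n (suc k) = begin
  ff n 1 (suc k)                    ≡⟨ ff-snoc n 1 k ⟩
  ff n 1 k * (n ∸ k * 1)            ≡⟨ cong₂ _*_ (ff-C n k) (cong (n ∸_) (*-identityʳ k)) ⟩
  k ! * (n C k) * (n ∸ k)           ≡⟨ e (k !) (n C k) (n ∸ k) ⟩
  k ! * ((n ∸ k) * (n C k))         ≡⟨ cong (k ! *_) (sym (C-step n k)) ⟩
  k ! * (suc k * (n C suc k))       ≡⟨ e′ (k !) (suc k) (n C suc k) ⟩
  suc k * k ! * (n C suc k) ∎
  where
  open ≡-Reasoning
  e : ∀ a b c → a * b * c ≡ a * (c * b)
  e = solve-∀
  e′ : ∀ a b c → a * (b * c) ≡ b * a * c
  e′ = solve-∀

-- Bernoulli: q ^ k * μ (μ - 1) ... (μ - k + 1) (1 - (a / q) * k / (μ - k + 1)) is at most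
-- ff (μ q - a) q k.
ff-bernoulli : ∀ μ q a k →
  q ^ suc k * ff μ 1 (suc k) ≤ ff (μ * q ∸ a) q (suc k) + a * suc k * q ^ k * ff μ 1 k
ff-bernoulli μ q a zero = begin
  q * 1 * (μ * 1)                          ≡⟨ e₁ q μ ⟩
  μ * q                                    ≤⟨ m≤n+m∸n (μ * q) a ⟩
  a + (μ * q ∸ a)                          ≡⟨ e₂ a (μ * q ∸ a) ⟩
  (μ * q ∸ a) * 1 + a * 1 * 1 * 1 ∎
  where
  open ≤-Reasoning
  e₁ : ∀ q μ → q * 1 * (μ * 1) ≡ μ * q
  e₁ = solve-∀
  e₂ : ∀ a b → a + b ≡ b * 1 + a * 1 * 1 * 1
  e₂ = solve-∀
ff-bernoulli μ q a (suc k) = begin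
  q * Q₁ * ff μ 1 (2 + k)                      ≡⟨ cong (q * Q₁ *_) (trans (ff-snoc μ 1 (suc k)) (cong (λ x → f₁ * (μ ∸ x)) (*-identityʳ (suc k)))) ⟩
  q * Q₁ * (f₁ * s)                            ≡⟨ e₁ q Q₁ f₁ s ⟩
  Q₁ * f₁ * (s * q)                            ≤⟨ *-monoʳ-≤ (Q₁ * f₁) (m≤n+m∸n (s * q) a) ⟩
  Q₁ * f₁ * (a + w)                            ≡⟨ e₂ (Q₁ * f₁) a w ⟩
  a * (Q₁ * f₁) + Q₁ * f₁ * w                  ≤⟨ +-monoʳ-≤ (a * (Q₁ * f₁)) (*-monoˡ-≤ w (ff-bernoulli μ q a k)) ⟩
  a * (Q₁ * f₁) + (P₁ + a * suc k * q ^ k * f₀) * w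
    ≡⟨ e₃ (a * (Q₁ * f₁)) P₁ (a * suc k) (q ^ k) f₀ w ⟩
  a * (Q₁ * f₁) + (P₁ * w + a * suc k * q ^ k * (f₀ * w))
    ≤⟨ +-monoʳ-≤ (a * (Q₁ * f₁)) (+-monoʳ-≤ (P₁ * w) (*-monoʳ-≤ (a * suc k * q ^ k) fw)) ⟩
  a * (Q₁ * f₁) + (P₁ * w + a * suc k * q ^ k * (f₁ * q))
    ≡⟨ e₄ a (q ^ k) q f₁ (P₁ * w) (suc k) ⟩
  P₁ * w + a * suc (suc k) * Q₁ * f₁
    ≡⟨ cong (_+ a * suc (suc k) * Q₁ * f₁) (sym (trans (ff-snoc (μ * q ∸ a) q (suc k)) (cong (P₁ *_) w≡))) ⟩
  ff (μ * q ∸ a) q (2 + k) + a * suc (suc k) * Q₁ * f₁ ∎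
  where
  open ≤-Reasoning
  Q₁ = q ^ suc k
  f₁ = ff μ 1 (suc k)
  f₀ = ff μ 1 k
  P₁ = ff (μ * q ∸ a) q (suc k)
  s = μ ∸ suc k
  w = s * q ∸ a
  w≡ : μ * q ∸ a ∸ suc k * q ≡ w
  w≡ = trans (∸-+-assoc (μ * q) a (suc k * q)) (trans (cong (μ * q ∸_) (+-comm a (suc k * q)))
         (trans (sym (∸-+-assoc (μ * q) (suc k * q) a)) (cong (_∸ a) (sym (*-distribʳ-∸ q μ (suc k))))))
  fw : f₀ * w ≤ f₁ * q
  fw = ≤-trans (*-monoʳ-≤ f₀ (≤-trans (m∸n≤m (s * q) a) (*-monoˡ-≤ q (∸-monoʳ-≤ μ (n≤1+n k)))))
         (≤-reflexive (trans (sym (*-assoc f₀ (μ ∸ k) q)) (cong (_* q) (sym (trans (ff-snoc μ 1 k) (cong (λ x → f₀ * (μ ∸ x)) (*-identityʳ k)))))))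
  e₁ : ∀ q Q f s → q * Q * (f * s) ≡ Q * f * (s * q)
  e₁ = solve-∀
  e₂ : ∀ x a w → x * (a + w) ≡ a * x + x * w
  e₂ = solve-∀
  e₃ : ∀ x P b Q f w → x + (P + b * Q * f) * w ≡ x + (P * w + b * Q * (f * w))
  e₃ = solve-∀
  e₄ : ∀ a Q q f Pw k → a * (q * Q * f) + (Pw + a * k * Q * (f * q)) ≡ Pw + a * (1 + k) * (q * Q) * f
  e₄ = solve-∀

-- If H has at most (1 - g / C(μ,k)) C(μ,k) members then, relative to the clique on μ points, it
-- spans at most a (1 + r g / (k C(μ,k)))⁻¹ fraction of the expected number of (k+r)-cliques:
-- apply kk with x = μ - g (μ - k + 1) / (k C(μ,k)).
cliques : ∀ k μ g r {n} (X : Subset n) (H : Family n) → 1 ≤ k → IsKUniform k H →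
  cnt H + g ≤ μ C k →
  cnt (upI k X r H) * (k * (μ C k) + r * g) ≤ (μ C (r + k)) * (cnt H * k)
cliques k@(suc k′) μ g r {n} X H 1≤k u small with μ C k in eqT
-- If C(μ,k) = 0 then also g = 0, so the factor on the left vanishes.
... | zero = ≤-trans (≤-reflexive (trans (cong (λ x → cnt (upI k X r H) * x) z) (*-zeroʳ (cnt (upI k X r H))))) z≤n
  where
  z : k * 0 + r * g ≡ 0
  z = cong₂ _+_ (*-zeroʳ k) (trans (cong (r *_) (n≤0⇒n≡0 (≤-trans (m≤n+m g (cnt H)) small))) (*-zeroʳ r))
... | T@(suc T′) = main r
  where
  open ≤-Reasoning
  -- With these values p / q is μ - g (μ - k + 1) / (k C(μ,k)), the point at which Bernoulli's
  -- inequality loses exactly `g` from C(μ,k).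
  q = k * T
  a = g * (μ ∸ k′)
  p = μ * q ∸ a
  N = cnt H
  K : ℕ → ℕ
  K i = cnt (upI k X i H)

  base : N * (q ^ k * k !) ≤ ff p q k
  base = +-cancelʳ-≤ (q ^ k * k ! * g) _ _ (begin
    N * (q ^ k * k !) + q ^ k * k ! * g   ≡⟨ e₁ N (q ^ k * k !) g ⟩
    q ^ k * k ! * (N + g)                 ≤⟨ *-monoʳ-≤ (q ^ k * k !) small ⟩
    q ^ k * k ! * T                       ≡⟨ *-assoc (q ^ k) (k !) T ⟩
    q ^ k * (k ! * T)                     ≡⟨ cong (q ^ k *_) (sym ffT) ⟩
    q ^ k * ff μ 1 k                      ≤⟨ ff-bernoulli μ q a k′ ⟩
    ff p q k + a * k * q ^ k′ * ff μ 1 k′ ≡⟨ cong (ff p q k +_) e₂ ⟩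
    ff p q k + q ^ k * k ! * g            ∎)
    where
    ffT : ff μ 1 k ≡ k ! * T
    ffT = trans (ff-C μ k) (cong (k ! *_) eqT)
    e₁ : ∀ N w g → N * w + w * g ≡ w * (N + g)
    e₁ = solve-∀
    e₃ : ∀ g s k Q f → g * s * k * Q * f ≡ g * k * Q * (f * s)
    e₃ = solve-∀
    e₄ : ∀ g k Q F T → g * k * Q * (F * T) ≡ k * T * Q * F * g
    e₄ = solve-∀
    e₂ : a * k * q ^ k′ * ff μ 1 k′ ≡ q ^ k * k ! * g
    e₂ = begin-equality
      g * (μ ∸ k′) * k * q ^ k′ * ff μ 1 k′    ≡⟨ e₃ g (μ ∸ k′) k (q ^ k′) (ff μ 1 k′) ⟩
      g * k * q ^ k′ * (ff μ 1 k′ * (μ ∸ k′))  ≡⟨ cong (λ x → g * k * q ^ k′ * (ff μ 1 k′ * (μ ∸ x))) (sym (*-identityʳ k′)) ⟩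
      g * k * q ^ k′ * (ff μ 1 k′ * (μ ∸ k′ * 1)) ≡⟨ cong (g * k * q ^ k′ *_) (trans (sym (ff-snoc μ 1 k′)) ffT) ⟩
      g * k * q ^ k′ * (k ! * T)               ≡⟨ e₄ g k (q ^ k′) (k !) T ⟩
      q ^ k * k ! * g                          ∎

  step : ∀ i → K i * (q ^ (i + k) * (i + k) !) ≤ ff p q (i + k) →
    q * suc (i + k) * K (suc i) ≤ (p ∸ (i + k) * q) * K i
  step i h = ≤-trans
    (m+n≤o⇒m≤o∸n (q * suc (i + k) * K (suc i))
      (kk (i + k) p q X (upI k X i H) (≤-trans 1≤k (m≤n+m k i)) (s≤s z≤n) (upI-uniform k X i H u) h))
    (≤-reflexive (sym (*-distribʳ-∸ (K i) p ((i + k) * q))))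

  level : ∀ i → K i * (q ^ (i + k) * (i + k) !) ≤ ff p q (i + k)
  level zero    = base
  level (suc i) = begin
    K (suc i) * (q * q ^ κ * (suc κ * κ !))   ≡⟨ e₁ (K (suc i)) q (q ^ κ) (suc κ) (κ !) ⟩
    q * suc κ * K (suc i) * (q ^ κ * κ !)     ≤⟨ *-monoˡ-≤ (q ^ κ * κ !) (step i (level i)) ⟩
    (p ∸ κ * q) * K i * (q ^ κ * κ !)         ≡⟨ *-assoc (p ∸ κ * q) (K i) _ ⟩
    (p ∸ κ * q) * (K i * (q ^ κ * κ !))       ≤⟨ *-monoʳ-≤ (p ∸ κ * q) (level i) ⟩
    (p ∸ κ * q) * ff p q κ                    ≡⟨ *-comm (p ∸ κ * q) _ ⟩
    ff p q κ * (p ∸ κ * q)                    ≡⟨ sym (ff-snoc p q κ) ⟩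
    ff p q (suc κ)                            ∎
    where
    κ = i + k
    e₁ : ∀ K q Q s F → K * (q * Q * (s * F)) ≡ q * s * K * (Q * F)
    e₁ = solve-∀

  g≤q : g ≤ q
  g≤q = ≤-trans (m≤n+m g N) (≤-trans small (m≤m+n T (k′ * T)))

  -- Since μ - κ ≤ μ - k + 1, the factor x - κ is at most (μ - κ)(1 - g/q).
  factor : ∀ i → p ∸ (i + k) * q ≤ (μ ∸ (i + k)) * (q ∸ g)
  factor i = begin
    μ * q ∸ a ∸ κ * q          ≡⟨ ∸-+-assoc (μ * q) a (κ * q) ⟩
    μ * q ∸ (a + κ * q)        ≡⟨ cong (μ * q ∸_) (+-comm a (κ * q)) ⟩
    μ * q ∸ (κ * q + a)        ≡⟨ sym (∸-+-assoc (μ * q) (κ * q) a) ⟩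
    μ * q ∸ κ * q ∸ a          ≡⟨ cong (_∸ a) (sym (*-distribʳ-∸ q μ κ)) ⟩
    (μ ∸ κ) * q ∸ g * (μ ∸ k′) ≤⟨ ∸-monoʳ-≤ ((μ ∸ κ) * q) (≤-trans (≤-reflexive (*-comm (μ ∸ κ) g)) (*-monoʳ-≤ g (∸-monoʳ-≤ μ (≤-trans (n≤1+n k′) (m≤n+m k i))))) ⟩
    (μ ∸ κ) * q ∸ (μ ∸ κ) * g  ≡⟨ sym (*-distribˡ-∸ (μ ∸ κ) q g) ⟩
    (μ ∸ κ) * (q ∸ g)          ∎
    where
    κ = i + k

  -- This is (1 - y)(1 + (i+1) y) ≤ 1 + i y with y = g / q; over the levels the quotients telescope
  -- to 1 / (1 + r y).
  bern : ∀ i → (q ∸ g) * (q + (g + i * g)) ≤ q * (q + i * g)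
  bern i = subst (λ z → e * (z + (g + i * g)) ≤ z * (z + i * g)) (m+[n∸m]≡n g≤q)
    (≤-trans (m≤m+n _ (g * g + i * g * g)) (≤-reflexive (poly e g i)))
    where
    e = q ∸ g
    poly : ∀ e g i → e * (g + e + (g + i * g)) + (g * g + i * g * g) ≡ (g + e) * (g + e + i * g)
    poly = solve-∀

  main : ∀ i → K i * (q + i * g) ≤ (μ C (i + k)) * (N * k)
  main zero = ≤-reflexive (trans (cong (N *_) (+-identityʳ q)) (trans (e N k T) (cong (_* (N * k)) (sym eqT))))
    where
    e : ∀ N k T → N * (k * T) ≡ T * (N * k)
    e = solve-∀
  main (suc i) = *-cancelˡ-≤ (q * suc κ) (begin
    q * suc κ * (K (suc i) * (q + (g + i * g)))          ≡⟨ sym (*-assoc (q * suc κ) (K (suc i)) _) ⟩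
    q * suc κ * K (suc i) * (q + (g + i * g))            ≤⟨ *-monoˡ-≤ (q + (g + i * g)) (≤-trans (step i (level i)) (*-monoˡ-≤ (K i) (factor i))) ⟩
    (μ ∸ κ) * (q ∸ g) * K i * (q + (g + i * g))          ≡⟨ e₁ (μ ∸ κ) (q ∸ g) (K i) (q + (g + i * g)) ⟩
    (μ ∸ κ) * K i * ((q ∸ g) * (q + (g + i * g)))        ≤⟨ *-monoʳ-≤ ((μ ∸ κ) * K i) (bern i) ⟩
    (μ ∸ κ) * K i * (q * (q + i * g))                    ≡⟨ e₂ (μ ∸ κ) (K i) q (q + i * g) ⟩
    (μ ∸ κ) * q * (K i * (q + i * g))                    ≤⟨ *-monoʳ-≤ ((μ ∸ κ) * q) (main i) ⟩
    (μ ∸ κ) * q * ((μ C κ) * (N * k))                    ≡⟨ e₃ (μ ∸ κ) q (μ C κ) (N * k) ⟩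
    q * ((μ ∸ κ) * (μ C κ)) * (N * k)                    ≡⟨ cong (λ x → q * x * (N * k)) (sym (C-step μ κ)) ⟩
    q * (suc κ * (μ C suc κ)) * (N * k)                  ≡⟨ e₄ q (suc κ) (μ C suc κ) (N * k) ⟩
    q * suc κ * ((μ C suc κ) * (N * k))                  ∎)
    where
    κ = i + k
    e₁ : ∀ m e K w → m * e * K * w ≡ m * K * (e * w)
    e₁ = solve-∀
    e₂ : ∀ m K q w → m * K * (q * w) ≡ m * q * (K * w)
    e₂ = solve-∀
    e₃ : ∀ m q c w → m * q * (c * w) ≡ q * (m * c) * w
    e₃ = solve-∀
    e₄ : ∀ q s c w → q * (s * c) * w ≡ q * s * (c * w)
    e₄ = solve-∀

-- Shifting, by transpositions of adjacent points only.  Points move towards larger indices, so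
-- that the vector recursion removes the least favoured point first.

τ : ∀ {n} → ℕ → Subset n → Subset n
τ i       []          = []
τ zero    (a ∷ [])    = a ∷ []
τ zero    (a ∷ b ∷ A) = b ∷ a ∷ A
τ (suc i) (a ∷ A)     = a ∷ τ i A

-- At a position without a successor `τ` is the identity and `src` is false, so that `i` may range
-- over all natural numbers.
src : ∀ {n} → ℕ → Subset n → Bool
src i       []          = false
src zero    (a ∷ [])    = false
src zero    (a ∷ b ∷ A) = a ∧ not b
src (suc i) (a ∷ A)     = src i A

shift : ∀ {n} → ℕ → Family n → Family n
shift i F A = if src i A then F A ∧ F (τ i A) else F A ∨ F (τ i A)

τ-invol : ∀ {n} i (A : Subset n) → τ i (τ i A) ≡ A
τ-invol i       []          = refl
τ-invol zero    (a ∷ [])    = refl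
τ-invol zero    (a ∷ b ∷ A) = refl
τ-invol (suc i) (a ∷ A)     = cong (a ∷_) (τ-invol i A)

∑-τ : ∀ {n} i (f : Subset n → ℕ) → ∑ (λ A → f (τ i A)) ≡ ∑ f
∑-τ {zero}        i       f = refl
∑-τ {suc zero}    zero    f = refl
∑-τ {suc (suc n)} zero    f = +-interchange (∑ (λ A → f (true ∷ true ∷ A))) _ _ _
∑-τ {suc n}       (suc i) f = cong₂ _+_ (∑-τ i (λ A → f (true ∷ A))) (∑-τ i (λ A → f (false ∷ A)))

∣τ∣ : ∀ {n} i (A : Subset n) → ∣ τ i A ∣ ≡ ∣ A ∣
∣τ∣ i       []                  = refl
∣τ∣ zero    (a ∷ [])            = refl
∣τ∣ zero    (true ∷ true ∷ A)   = refl
∣τ∣ zero    (true ∷ false ∷ A)  = refl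
∣τ∣ zero    (false ∷ true ∷ A)  = refl
∣τ∣ zero    (false ∷ false ∷ A) = refl
∣τ∣ (suc i) (true ∷ A)          = cong suc (∣τ∣ i A)
∣τ∣ (suc i) (false ∷ A)         = ∣τ∣ i A

disj-τ : ∀ {n} i (A B : Subset n) → disj (τ i A) (τ i B) ≡ disj A B
disj-τ i       []          []          = refl
disj-τ zero    (a ∷ [])    (b ∷ [])    = refl
disj-τ zero    (a ∷ c ∷ A) (b ∷ d ∷ B) with a ∧ b | c ∧ d
... | true  | true  = refl
... | true  | false = refl
... | false | true  = refl
... | false | false = refl
disj-τ (suc i) (a ∷ A)     (b ∷ B)     = cong (not (a ∧ b) ∧_) (disj-τ i A B)

src-τ : ∀ {n} i (A : Subset n) → src i A ≡ true → src i (τ i A) ≡ false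
src-τ zero    (true ∷ false ∷ A) e = refl
src-τ (suc i) (a ∷ A)            e = src-τ i A e

¬src : ∀ {n} i (A : Subset n) → src i A ≡ false → src i (τ i A) ≡ true ⊎ τ i A ≡ A
¬src i       []                  e = inj₂ refl
¬src zero    (a ∷ [])            e = inj₂ refl
¬src zero    (true ∷ true ∷ A)   e = inj₂ refl
¬src zero    (false ∷ true ∷ A)  e = inj₁ refl
¬src zero    (false ∷ false ∷ A) e = inj₂ refl
¬src (suc i) (a ∷ A)             e with ¬src i A e
... | inj₁ p = inj₁ p
... | inj₂ p = inj₂ (cong (a ∷_) p)

-- `A` contains the point i + 1, so a set disjoint from it does not: either it contains `i` and
-- moves, or it contains neither point.
src-disj : ∀ {n} i (A B : Subset n) → src i (τ i A) ≡ true → disj A B ≡ true → src i B ≡ true ⊎ τ i B ≡ B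
src-disj zero    (false ∷ true ∷ A) (true ∷ false ∷ B)  s d = inj₁ refl
src-disj zero    (false ∷ true ∷ A) (false ∷ false ∷ B) s d = inj₂ refl
src-disj (suc i) (a ∷ A)            (b ∷ B)             s d with src-disj i A B s (proj₂ (∧-true {not (a ∧ b)} d))
... | inj₁ p = inj₁ p
... | inj₂ p = inj₂ (cong (b ∷_) p)

shift-src : ∀ {n} i (F : Family n) A → src i A ≡ true → shift i F A ≡ F A ∧ F (τ i A)
shift-src i F A e rewrite e = refl

shift-tgt : ∀ {n} i (F : Family n) A → src i A ≡ false → shift i F A ≡ F A ∨ F (τ i A)
shift-tgt i F A e rewrite e = refl

shift-fix : ∀ {n} i (F : Family n) A → τ i A ≡ A → shift i F A ≡ F A
shift-fix i F A e rewrite e with src i A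
... | true  = ∧-idem (F A)
... | false = ∨-idem (F A)

-- A shift only redistributes membership within the pairs {A , τ A}. Sums over all sets are
-- therefore compared pair by pair, each pair counted twice.
shift-pair : ∀ {n} i (F : Family n) A → ⟦ shift i F A ⟧ + ⟦ shift i F (τ i A) ⟧ ≡ ⟦ F A ⟧ + ⟦ F (τ i A) ⟧
shift-pair i F A with src i A in e
... | true rewrite src-τ i A e | τ-invol i A with F A | F (τ i A)
...   | true  | true  = refl
...   | true  | false = refl
...   | false | true  = refl
...   | false | false = refl
shift-pair i F A | false with ¬src i A e
... | inj₁ s rewrite s | τ-invol i A with F A | F (τ i A)
...   | true  | true  = refl
...   | true  | false = refl
...   | false | true  = refl
...   | false | false = refl
shift-pair i F A | false | inj₂ s rewrite s | e | s with F A
... | true  = refl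
... | false = refl

∑-pair : ∀ {n} i (f : Subset n → ℕ) → ∑ (λ A → f A + f (τ i A)) ≡ 2 * ∑ f
∑-pair i f = trans (∑-+ f (λ A → f (τ i A))) (cong (∑ f +_) (trans (∑-τ i f) (sym (+-identityʳ (∑ f)))))

cnt-shift : ∀ {n} i (F : Family n) → cnt (shift i F) ≡ cnt F
cnt-shift i F = *-cancelˡ-≡ _ _ 2 (trans (sym (∑-pair i (λ A → ⟦ shift i F A ⟧)))
  (trans (∑-cong (shift-pair i F)) (∑-pair i (λ A → ⟦ F A ⟧))))

shift-origin : ∀ {n} i (F : Family n) A → shift i F A ≡ true → F A ≡ true ⊎ F (τ i A) ≡ true
shift-origin i F A p with src i A
... | true  = inj₁ (proj₁ (∧-true p))
... | false with F A
...   | true  = inj₁ refl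
...   | false = inj₂ p

shift-uniform : ∀ {n} k i (F : Family n) → IsKUniform k F → IsKUniform k (shift i F)
shift-uniform k i F u A p with shift-origin i F A p
... | inj₁ q = u A q
... | inj₂ q = trans (sym (∣τ∣ i A)) (u (τ i A) q)

-- Systems of disjoint representatives

record SDR {n s} (F : Fin s → Family n) : Set where
  constructor sdr
  field
    rep      : Fin s → Subset n
    rep∈     : ∀ j → F j (rep j) ≡ true
    disjoint : ∀ i j → i ≢ j → disj (rep i) (rep j) ≡ true

Matching : ∀ {n} → ℕ → Family n → Set
Matching s F = SDR {s = s} (λ _ → F)

-- If some member M of the matching is new then τ maps all of its members into F: those disjoint
-- from M avoid the point i + 1, so they are either fixed by τ or stable under the shift.
shift-matching : ∀ {n} s i (F : Family n) → Matching s (shift i F) → Matching s F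
shift-matching s i F (sdr B b∈ dis) with Fin.any? (λ j → F (B j) ≟ᵇ false)
... | no ¬new = sdr B (λ j → old j (F (B j)) refl) dis
  where
  old : ∀ j b → F (B j) ≡ b → F (B j) ≡ true
  old j true  e = e
  old j false e = ⊥-elim (¬new (j , e))
... | yes (j₀ , new) = sdr (λ j → τ i (B j)) moved (λ j j′ ne → trans (disj-τ i (B j) (B j′)) (dis j j′ ne))
  where
  s₀ : src i (B j₀) ≡ false
  s₀ with src i (B j₀) in e
  ... | false = refl
  ... | true  = true≢false (proj₁ (∧-true (trans (sym (shift-src i F (B j₀) e)) (b∈ j₀)))) new
  τ₀ : F (τ i (B j₀)) ≡ true
  τ₀ = subst (λ b → b ∨ F (τ i (B j₀)) ≡ true) new (trans (sym (shift-tgt i F (B j₀) s₀)) (b∈ j₀))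
  t₀ : src i (τ i (B j₀)) ≡ true
  t₀ with ¬src i (B j₀) s₀
  ... | inj₁ p = p
  ... | inj₂ p = true≢false (subst (λ A → F A ≡ true) p τ₀) new
  moved : ∀ j → F (τ i (B j)) ≡ true
  moved j with j₀ Fin.≟ j
  ... | yes refl = τ₀
  ... | no ne with src-disj i (B j₀) (B j) t₀ (dis j₀ j ne)
  ...   | inj₁ p = proj₂ (∧-true {F (B j)} (trans (sym (shift-src i F (B j) p)) (b∈ j)))
  ...   | inj₂ p = trans (cong F p) (trans (sym (shift-fix i F (B j) p)) (b∈ j))

-- Shifted families and induction along shifts

Shifted : ∀ {n} → Family n → Set
Shifted F = ∀ i A → src i A ≡ true → F A ≡ true → F (τ i A) ≡ true

Violation : ∀ {n} → Family n → Set
Violation {n} F = Σ ℕ λ i → Σ (Subset n) λ A → src i A ≡ true × F A ≡ true × F (τ i A) ≡ false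

shifted? : ∀ {n} (F : Family n) → Violation F ⊎ Shifted F
shifted? {zero}     F = inj₂ λ { zero [] () ; (suc i) [] () }
shifted? {suc zero} F = inj₂ λ { zero (a ∷ []) () ; (suc zero) (a ∷ []) () ; (suc (suc i)) (a ∷ []) () }
shifted? {suc (suc n)} F with shifted? (λ A → F (true ∷ A)) | shifted? (λ A → F (false ∷ A))
... | inj₁ (i , A , v) | _ = inj₁ (suc i , true ∷ A , v)
... | inj₂ _ | inj₁ (i , A , v) = inj₁ (suc i , false ∷ A , v)
... | inj₂ s | inj₂ s′ with anySubset? (λ (A : Subset n) → (F (true ∷ false ∷ A) ≟ᵇ true) ×-dec (F (false ∷ true ∷ A) ≟ᵇ false))
...   | yes (A , p , q) = inj₁ (0 , true ∷ false ∷ A , refl , p , q)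
...   | no ¬v = inj₂ all
  where
  all : Shifted F
  all zero (true ∷ false ∷ A) _ p with F (false ∷ true ∷ A) in e
  ... | true  = refl
  ... | false = ⊥-elim (¬v (A , p , e))
  all (suc i) (true ∷ A)  e p = s i A e p
  all (suc i) (false ∷ A) e p = s′ i A e p

-- The sum of the positions of the points of `A`, so that moving a point one step up adds one.
weight : ∀ {n} → Subset n → ℕ
weight []      = 0
weight (a ∷ A) = weight A + ∣ A ∣

weight-τ : ∀ {n} i (A : Subset n) → src i A ≡ true → weight (τ i A) ≡ suc (weight A)
weight-τ zero (true ∷ false ∷ A) e = +-suc (weight A + ∣ A ∣) ∣ A ∣
weight-τ (suc i) (a ∷ A) e = cong₂ _+_ (weight-τ i A e) (∣τ∣ i A)

potential : ∀ {n} → Family n → ℕ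
potential F = ∑ (λ A → ⟦ F A ⟧ * weight A)

potential≤ : ∀ {n} (F : Family n) → potential F ≤ ∑ {n} weight
potential≤ F = ∑-mono (λ A → ≤-trans (*-monoˡ-≤ (weight A) (⟦⟧≤1 (F A))) (≤-reflexive (*-identityˡ (weight A))))

potential-shift : ∀ {n} (F : Family n) ((i , A , v) : Violation F) → potential F < potential (shift i F)
potential-shift F (i , A , e , p , q) = *-cancelˡ-< 2 _ _ (begin-strict
  2 * potential F                          ≡⟨ sym (∑-pair i (λ B → ⟦ F B ⟧ * weight B)) ⟩
  ∑ (λ B → ⟦ F B ⟧ * weight B + ⟦ F (τ i B) ⟧ * weight (τ i B))
    <⟨ ∑-mono-< weak A gain ⟩
  ∑ (λ B → ⟦ shift i F B ⟧ * weight B + ⟦ shift i F (τ i B) ⟧ * weight (τ i B))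
    ≡⟨ ∑-pair i (λ B → ⟦ shift i F B ⟧ * weight B) ⟩
  2 * potential (shift i F) ∎)
  where
  open ≤-Reasoning
  Φ Ψ : Subset _ → ℕ
  Φ B = ⟦ F B ⟧ * weight B + ⟦ F (τ i B) ⟧ * weight (τ i B)
  Ψ B = ⟦ shift i F B ⟧ * weight B + ⟦ shift i F (τ i B) ⟧ * weight (τ i B)

  weak-src : ∀ B → src i B ≡ true → Φ B ≤ Ψ B
  weak-src B s rewrite shift-src i F B s | shift-tgt i F (τ i B) (src-τ i B s) | τ-invol i B | weight-τ i B s
    with F B | F (τ i B)
  ... | true  | true  = ≤-refl
  ... | true  | false = ≤-trans (≤-reflexive (+-identityʳ _)) (+-monoˡ-≤ 0 (n≤1+n (weight B)))
  ... | false | true  = ≤-refl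
  ... | false | false = ≤-refl

  weak′ : ∀ B b → src i B ≡ b → Φ B ≤ Ψ B
  weak′ B true  s = weak-src B s
  weak′ B false s with ¬src i B s
  ... | inj₂ f = ≤-reflexive (cong₂ (λ x y → ⟦ x ⟧ * weight B + ⟦ y ⟧ * weight (τ i B))
                   (sym (shift-fix i F B f)) (trans (cong F f) (trans (sym (shift-fix i F B f)) (sym (cong (shift i F) f)))))
  ... | inj₁ t = subst₂ _≤_ (+-comm (⟦ F (τ i B) ⟧ * weight (τ i B)) _) (+-comm (⟦ shift i F (τ i B) ⟧ * weight (τ i B)) _)
            (subst (λ C → ⟦ F (τ i B) ⟧ * weight (τ i B) + ⟦ F C ⟧ * weight C ≤ ⟦ shift i F (τ i B) ⟧ * weight (τ i B) + ⟦ shift i F C ⟧ * weight C)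
              (τ-invol i B) (weak-src (τ i B) t))

  weak : ∀ B → Φ B ≤ Ψ B
  weak B = weak′ B (src i B) refl

  gain : Φ A < Ψ A
  gain rewrite shift-src i F A e | shift-tgt i F (τ i A) (src-τ i A e) | τ-invol i A | weight-τ i A e | p | q =
    s≤s (≤-reflexive (+-identityʳ (weight A + 0)))

-- Shifting terminates because the potential grows whenever a violation is shifted and never exceeds
-- the total weight of all sets; the difference serves as fuel.
shift-induction : ∀ {n} (P : Family n → Set) → (∀ F → Shifted F → P F) → (∀ F i → P (shift i F) → P F) →
  ∀ F → P F
shift-induction {n} P base step F = go (∑ {n} weight) F (m≤n+m (∑ {n} weight) (potential F))
  where
  go : ∀ fuel F → ∑ {n} weight ≤ potential F + fuel → P F
  go fuel F bound with shifted? F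
  ... | inj₂ s = base F s
  go zero F bound | inj₁ v = ⊥-elim (<⇒≱ (potential-shift F v)
    (≤-trans (potential≤ (shift (proj₁ v) F)) (≤-trans bound (≤-reflexive (+-identityʳ _)))))
  go (suc fuel) F bound | inj₁ v = step F (proj₁ v) (go fuel (shift (proj₁ v) F)
    (≤-trans bound (≤-trans (≤-reflexive (+-suc (potential F) fuel)) (+-monoˡ-≤ fuel (potential-shift F v)))))

shifted-tail : ∀ {n} {F : Family (suc n)} a → Shifted F → Shifted (λ A → F (a ∷ A))
shifted-tail a s i A = s (suc i) (a ∷ A)

-- Adjacent moves generate all moves upwards. An occupied point on the way is itself moved to `j`,
-- and the travelling point takes its place.
shifted-head : ∀ {n} {F : Family (suc n)} → Shifted F → ∀ A j → lookup A j ≡ false →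
  F (true ∷ A) ≡ true → F (false ∷ (A [ j ]≔ true)) ≡ true
shifted-head s (false ∷ A) zero    e p = s 0 (true ∷ false ∷ A) refl p
shifted-head s (false ∷ A) (suc j) e p =
  shifted-head (shifted-tail false s) A j e (s 0 (true ∷ false ∷ A) refl p)
shifted-head s (true ∷ A)  (suc j) e p =
  s 0 (true ∷ false ∷ (A [ j ]≔ true)) refl (shifted-head (shifted-tail true s) A j e p)

shifted-move : ∀ {n} {F : Family n} → Shifted F → ∀ A i j → i F.< j → lookup A i ≡ true → lookup A j ≡ false →
  F A ≡ true → F ((A [ i ]≔ false) [ j ]≔ true) ≡ true
shifted-move s (true ∷ A) zero    (suc j) _       _ e p = shifted-head s A j e p
shifted-move s (a ∷ A)    (suc i) (suc j) (s≤s l) d e p = shifted-move (shifted-tail a s) A i j l d e p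

-- Shadows of shifted families

∣∣≡0⇒∉ : ∀ {n} (A : Subset n) → ∣ A ∣ ≡ 0 → ∀ i → lookup A i ≡ false
∣∣≡0⇒∉ (false ∷ A) e zero    = refl
∣∣≡0⇒∉ (false ∷ A) e (suc i) = ∣∣≡0⇒∉ A e i

lookup-∪ : ∀ {n} (X B : Subset n) i → lookup (X ∪̇ B) i ≡ lookup X i ∨ lookup B i
lookup-∪ (x ∷ X) (b ∷ B) zero    = refl
lookup-∪ (x ∷ X) (b ∷ B) (suc i) = lookup-∪ X B i

∣∁∪∣≥ : ∀ {n} (X B : Subset n) → ∣ ∁ X ∣ ≤ ∣ ∁ (X ∪̇ B) ∣ + ∣ B ∣
∣∁∪∣≥ []          []          = z≤n
∣∁∪∣≥ (true ∷ X)  (true ∷ B)  = ≤-trans (∣∁∪∣≥ X B) (+-monoʳ-≤ ∣ ∁ (X ∪̇ B) ∣ (n≤1+n ∣ B ∣))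
∣∁∪∣≥ (true ∷ X)  (false ∷ B) = ∣∁∪∣≥ X B
∣∁∪∣≥ (false ∷ X) (true ∷ B)  = ≤-trans (s≤s (∣∁∪∣≥ X B)) (≤-reflexive (sym (+-suc ∣ ∁ (X ∪̇ B) ∣ ∣ B ∣)))
∣∁∪∣≥ (false ∷ X) (false ∷ B) = s≤s (∣∁∪∣≥ X B)

⋃ : ∀ {n s} → Subset n → (Fin s → Subset n) → Subset n
⋃ {s = zero}  X B = X
⋃ {s = suc s} X B = ⋃ X (λ j → B (suc j)) ∪̇ B zero

∣∁⋃∣ : ∀ {n s k} (X : Subset n) (B : Fin s → Subset n) → (∀ j → ∣ B j ∣ ≡ k) → ∣ ∁ X ∣ ≤ ∣ ∁ (⋃ X B) ∣ + s * k
∣∁⋃∣ {s = zero}  X B h = ≤-reflexive (sym (+-identityʳ _))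
∣∁⋃∣ {s = suc s} {k} X B h = begin
  ∣ ∁ X ∣                              ≤⟨ ∣∁⋃∣ X (λ j → B (suc j)) (λ j → h (suc j)) ⟩
  ∣ ∁ V ∣ + s * k                      ≤⟨ +-monoˡ-≤ (s * k) (∣∁∪∣≥ V (B zero)) ⟩
  ∣ ∁ (V ∪̇ B zero) ∣ + ∣ B zero ∣ + s * k ≡⟨ cong (λ x → ∣ ∁ (V ∪̇ B zero) ∣ + x + s * k) (h zero) ⟩
  ∣ ∁ (V ∪̇ B zero) ∣ + k + s * k       ≡⟨ +-assoc ∣ ∁ (V ∪̇ B zero) ∣ k (s * k) ⟩
  ∣ ∁ (V ∪̇ B zero) ∣ + suc s * k       ∎
  where
  open ≤-Reasoning
  V = ⋃ X (λ j → B (suc j))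

∉∪ : ∀ {n} (X B : Subset n) i → lookup (X ∪̇ B) i ≡ false → lookup X i ≡ false × lookup B i ≡ false
∉∪ X B i e with lookup X i | lookup B i | trans (sym (lookup-∪ X B i)) e
... | false | false | _ = refl , refl

∉⋃ : ∀ {n s} (X : Subset n) (B : Fin s → Subset n) i → lookup (⋃ X B) i ≡ false →
  lookup X i ≡ false × (∀ j → lookup (B j) i ≡ false)
∉⋃ {s = zero}  X B i e = e , λ ()
∉⋃ {s = suc s} X B i e =
  let a , b = ∉∪ (⋃ X (λ j → B (suc j))) (B zero) i e
      c , d = ∉⋃ X (λ j → B (suc j)) i a
  in c , λ { zero → b ; (suc j) → d j }

points : ∀ {n} s (U : Subset n) → s ≤ ∣ ∁ U ∣ →
  Σ (Fin s → Fin n) λ e → (∀ j → lookup U (e j) ≡ false) × (∀ i j → i ≢ j → e i ≢ e j)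
points zero    U           l = (λ ()) , (λ ()) , λ ()
points (suc s) (true ∷ U)  l =
  let e , p , inj = points (suc s) U l
  in (λ j → suc (e j)) , p , λ i j ne q → inj i j ne (Fin.suc-injective q)
points (suc s) (false ∷ U) (s≤s l) = e′ , p′ , inj′
  where
  r = points s U l
  e = proj₁ r
  e′ : Fin (suc s) → Fin _
  e′ zero    = zero
  e′ (suc j) = suc (e j)
  p′ : ∀ j → lookup (false ∷ U) (e′ j) ≡ false
  p′ zero    = refl
  p′ (suc j) = proj₁ (proj₂ r) j
  inj′ : ∀ i j → i ≢ j → e′ i ≢ e′ j
  inj′ zero    zero    ne q = ne refl
  inj′ (suc i) (suc j) ne q = proj₂ (proj₂ r) i j (λ z → ne (cong suc z)) (Fin.suc-injective q)

disj-add : ∀ {n} (A B : Subset n) i → disj A B ≡ true → lookup A i ≡ false → disj A (B [ i ]≔ true) ≡ true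
disj-add A B i d a = disj-intro A (B [ i ]≔ true) h
  where
  h : ∀ j → lookup A j ≡ true → lookup (B [ i ]≔ true) j ≡ false
  h j e with i Fin.≟ j
  ... | yes refl = true≢false e a
  ... | no ne    = trans (≔-other B i j ne) (disj-elim A B d j e)

-- A family of sets off `X` is closed only under moves to points off `X`, so this is the form of
-- shiftedness it retains.
MovableOff : ∀ {n} → Subset n → Family n → Set
MovableOff X F = ∀ A i j → i F.< j → lookup A i ≡ true → lookup A j ≡ false → lookup X j ≡ false →
  F A ≡ true → F ((A [ i ]≔ false) [ j ]≔ true) ≡ true

movable-tail : ∀ {n x} {X : Subset n} {F : Family (suc n)} a → MovableOff (x ∷ X) F → MovableOff X (λ A → F (a ∷ A))
movable-tail a m A i j l = m (a ∷ A) (suc i) (suc j) (s≤s l)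

-- When there is room, s of the sets of a matching of the link of the first point can be completed
-- by fresh points instead.
matching-lift : ∀ {n k} s (X : Subset n) (F : Family (suc n)) → MovableOff (false ∷ X) F →
  IsKUniform (suc k) F → suc k * suc s ≤ suc ∣ ∁ X ∣ →
  Matching (suc s) (λ A → F (true ∷ A)) → Matching (suc s) F
matching-lift {n} {k} s X F mv u room (sdr B b∈ dis) = sdr B′ b∈′ dis′
  where
  U = ⋃ X B
  -- The matching of the link covers at most (s + 1) k points off `X`, and `room` leaves `s` more.
  enough : s ≤ ∣ ∁ U ∣
  enough = +-cancelʳ-≤ (suc s * k) s ∣ ∁ U ∣ (≤-trans
    (≤-pred (≤-trans (≤-reflexive (e s k)) room)) (∣∁⋃∣ X B (λ j → suc-injective (u (true ∷ B j) (b∈ j)))))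
    where
    e : ∀ s k → suc (s + suc s * k) ≡ suc k * suc s
    e = solve-∀
  pts = points s U enough
  e   = proj₁ pts
  e∉X : ∀ j → lookup X (e j) ≡ false
  e∉X j = proj₁ (∉⋃ X B (e j) (proj₁ (proj₂ pts) j))
  e∉B : ∀ j i → lookup (B i) (e j) ≡ false
  e∉B j = proj₂ (∉⋃ X B (e j) (proj₁ (proj₂ pts) j))
  B′ : Fin (suc s) → Subset (suc n)
  B′ zero    = true ∷ B zero
  B′ (suc j) = false ∷ (B (suc j) [ e j ]≔ true)
  b∈′ : ∀ j → F (B′ j) ≡ true
  b∈′ zero    = b∈ zero
  b∈′ (suc j) = mv (true ∷ B (suc j)) zero (suc (e j)) (s≤s z≤n) refl (e∉B j (suc j)) (e∉X j) (b∈ (suc j))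
  dis′ : ∀ i j → i ≢ j → disj (B′ i) (B′ j) ≡ true
  dis′ zero    zero    ne = ⊥-elim (ne refl)
  dis′ zero    (suc j) ne = disj-add (B zero) (B (suc j)) (e j) (dis zero (suc j) ne) (e∉B j zero)
  dis′ (suc i) zero    ne = trans (disj-sym (B (suc i) [ e i ]≔ true) (B zero))
    (disj-add (B zero) (B (suc i)) (e i) (dis zero (suc i) λ ()) (e∉B i zero))
  dis′ (suc i) (suc j) ne = disj-add (B (suc i) [ e i ]≔ true) (B (suc j)) (e j)
    (trans (disj-sym (B (suc i) [ e i ]≔ true) (B (suc j)))
      (disj-add (B (suc j)) (B (suc i)) (e i) (trans (disj-sym (B (suc j)) (B (suc i))) (dis (suc i) (suc j) ne)) (e∉B i (suc j))))
    (trans (≔-other (B (suc i)) (e i) (e j) (proj₂ (proj₂ pts) i j (λ z → ne (cong suc z)))) (e∉B j (suc i)))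

⨁-∉ : ∀ {n} (U : Subset n) → ⨁ (λ i → ⟦ not (lookup U i) ⟧) ≡ ∣ ∁ U ∣
⨁-∉ []          = refl
⨁-∉ (true ∷ U)  = ⨁-∉ U
⨁-∉ (false ∷ U) = cong suc (⨁-∉ U)

-- Double counting of members and their k-subsets: each member has k + 1 of these, and a set of `G`
-- has at most |∁ X| - k ≤ (k + 1) s extensions off `X`.
shadow-small : ∀ {n} k s (X : Subset n) (F G : Family n) →
  IsKUniform (suc k) F → (∀ A → F A ≡ true → disj A X ≡ true) →
  (∀ A i → lookup A i ≡ true → F A ≡ true → G (A [ i ]≔ false) ≡ true) →
  ∣ ∁ X ∣ < suc k * suc s → cnt F ≤ s * cnt G
shadow-small {n} k s X F G u off sh small = *-cancelˡ-≤ (suc k) (begin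
  suc k * cnt F                                   ≡⟨ sym (⨁-deg (suc k) F u) ⟩
  ⨁ (λ i → deg i F)                               ≡⟨ ⨁-cong (λ i → cnt-link i F) ⟩
  ⨁ (λ i → ∑ (λ B → ⟦ link i F B ⟧))              ≡⟨ sym (∑-⨁-swap (λ B i → ⟦ link i F B ⟧)) ⟩
  ∑ (λ B → ⨁ (λ i → ⟦ link i F B ⟧))              ≤⟨ ∑-mono degree ⟩
  ∑ (λ B → ⟦ G B ⟧ * (suc k * s))                 ≡⟨ ∑-*ʳ (suc k * s) (λ B → ⟦ G B ⟧) ⟩
  cnt G * (suc k * s)                             ≡⟨ e (cnt G) (suc k) s ⟩
  suc k * (s * cnt G)                             ∎)
  where
  open ≤-Reasoning
  e : ∀ g k s → g * (k * s) ≡ k * (s * g)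
  e = solve-∀
  link-elim : ∀ i B → link i F B ≡ true → lookup B i ≡ false × F (B [ i ]≔ true) ≡ true
  link-elim i B p = let a , b = ∧-true {not (lookup B i)} p in not-true a , b
  degree : ∀ B → ⨁ (λ i → ⟦ link i F B ⟧) ≤ ⟦ G B ⟧ * (suc k * s)
  degree B with Fin.any? (λ i → link i F B ≟ᵇ true)
  ... | no none = ≤-trans (≤-reflexive (trans (⨁-cong (λ i → zero-link i (link i F B) refl)) (⨁-zero {n}))) z≤n
    where
    zero-link : ∀ i b → link i F B ≡ b → ⟦ link i F B ⟧ ≡ 0
    zero-link i false p = cong ⟦_⟧ p
    zero-link i true  p = ⊥-elim (none (i , p))
  ... | yes (i₀ , p₀) = begin
    ⨁ (λ i → ⟦ link i F B ⟧)              ≤⟨ ⨁-mono (λ i → ⟦⟧-mono (free i)) ⟩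
    ⨁ (λ i → ⟦ not (lookup (X ∪̇ B) i) ⟧)  ≡⟨ ⨁-∉ (X ∪̇ B) ⟩
    ∣ ∁ (X ∪̇ B) ∣                         ≤⟨ +-cancelʳ-≤ k _ _ room ⟩
    suc k * s                             ≡⟨ sym (*-identityˡ _) ⟩
    1 * (suc k * s)                       ≡⟨ cong (λ b → ⟦ b ⟧ * (suc k * s)) (sym GB) ⟩
    ⟦ G B ⟧ * (suc k * s)                 ∎
    where
    i₀∉ = proj₁ (link-elim i₀ B p₀)
    GB : G B ≡ true
    GB = trans (cong G (sym (del-add B i₀ i₀∉))) (sh (B [ i₀ ]≔ true) i₀ (add∈ B i₀) (proj₂ (link-elim i₀ B p₀)))
    ∣B∣ : ∣ B ∣ ≡ k
    ∣B∣ = suc-injective (trans (sym (∣add∣ B i₀ i₀∉)) (u _ (proj₂ (link-elim i₀ B p₀))))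
    B-off : disj B X ≡ true
    B-off = disj-sub B (B [ i₀ ]≔ true) X (⊆add B i₀) (off _ (proj₂ (link-elim i₀ B p₀)))
    room : ∣ ∁ (X ∪̇ B) ∣ + k ≤ suc k * s + k
    room = ≤-trans (≤-reflexive (trans (cong (∣ ∁ (X ∪̇ B) ∣ +_) (sym ∣B∣)) (∣∁∪∣ X B B-off)))
             (≤-pred (≤-trans small (≤-reflexive (e′ k s))))
      where
      e′ : ∀ k s → suc k * suc s ≡ suc (suc k * s + k)
      e′ = solve-∀
    free : ∀ i → link i F B ≡ true → not (lookup (X ∪̇ B) i) ≡ true
    free i p = cong not (trans (lookup-∪ X B i) (cong₂ _∨_
      (disj-elim (B [ i ]≔ true) X (off _ (proj₂ (link-elim i B p))) i (add∈ B i)) (proj₁ (link-elim i B p))))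

-- Due to Frankl; induction on the ground set, with double counting once it is small.
shadow-bound : ∀ {n} k s (X : Subset n) (F G : Family n) →
  IsKUniform k F → (∀ A → F A ≡ true → disj A X ≡ true) → MovableOff X F →
  (∀ A i → lookup A i ≡ true → F A ≡ true → G (A [ i ]≔ false) ≡ true) →
  ¬ Matching (suc s) F → cnt F ≤ s * cnt G
shadow-bound zero s X F G u off mv sh nm = ≤-trans (≤-reflexive (∉⇒cnt≡0 F λ A → none A (F A) refl)) z≤n
  where
  -- The empty set is disjoint from itself, so repeating it would give a matching.
  none : ∀ A b → F A ≡ b → b ≡ false
  none A false e = refl
  none A true  e = ⊥-elim (nm (sdr (λ _ → A) (λ _ → e) (λ _ _ _ → disj-intro A A (λ i _ → ∣∣≡0⇒∉ A (u A e) i))))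
shadow-bound {zero} (suc k) s [] F G u off mv sh nm with F [] in eq
... | false = z≤n
... | true  = ⊥-elim (1+n≢0 (sym (u [] eq)))
shadow-bound {suc n} (suc k) s X F G u off mv sh nm with ∣ ∁ X ∣ <? suc k * suc s
... | yes small = shadow-small k s X F G u off sh small
shadow-bound {suc n} (suc k) s (true ∷ X) F G u off mv sh nm | no _ =
  ≤-trans (≤-reflexive (cong (_+ cnt (λ A → F (false ∷ A))) (∉⇒cnt≡0 (λ A → F (true ∷ A)) (λ A → none A (F (true ∷ A)) refl))))
    (≤-trans (shadow-bound (suc k) s X (λ A → F (false ∷ A)) (λ A → G (false ∷ A)) (λ A → u (false ∷ A)) (λ A → off (false ∷ A))
        (movable-tail {x = true} {F = F} false mv) (λ A i → sh (false ∷ A) (suc i)) nm₀)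
      (*-monoʳ-≤ s (m≤n+m _ (cnt (λ A → G (true ∷ A))))))
  where
  none : ∀ A b → F (true ∷ A) ≡ b → b ≡ false
  none A false e = refl
  none A true  e with off (true ∷ A) e
  ... | ()
  nm₀ : ¬ Matching (suc s) (λ A → F (false ∷ A))
  nm₀ (sdr B b∈ d) = nm (sdr (λ j → false ∷ B j) b∈ d)
shadow-bound {suc n} (suc k) s (false ∷ X) F G u off mv sh nm | no room =
  ≤-trans (+-mono-≤
    (shadow-bound k s X (λ A → F (true ∷ A)) (λ A → G (true ∷ A)) (λ A e → suc-injective (u (true ∷ A) e)) (λ A → off (true ∷ A))
      (movable-tail {x = false} {F = F} true mv) (λ A i → sh (true ∷ A) (suc i)) (λ m → nm (matching-lift s X F mv u (≮⇒≥ room) m)))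
    (shadow-bound (suc k) s X (λ A → F (false ∷ A)) (λ A → G (false ∷ A)) (λ A → u (false ∷ A)) (λ A → off (false ∷ A))
      (movable-tail {x = false} {F = F} false mv) (λ A i → sh (false ∷ A) (suc i)) nm₀))
    (≤-reflexive (sym (*-distribˡ-+ s (cnt (λ A → G (true ∷ A))) _)))
  where
  nm₀ : ¬ Matching (suc s) (λ A → F (false ∷ A))
  nm₀ (sdr B b∈ d) = nm (sdr (λ j → false ∷ B j) b∈ d)

-- Averaging over random tuples of disjoint l-sets

hits : ∀ {n} → Family n → List (Subset n) → ℕ
hits F []       = 0
hits F (B ∷ Bs) = ⟦ F B ⟧ + hits F Bs

-- An unnormalised expectation: `h` summed over the ordered tuples of `u` pairwise disjoint l-sets
-- off `X`.
tuples : ∀ {n} → ℕ → ℕ → Subset n → (List (Subset n) → ℕ) → ℕ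
tuples l zero    X h = h []
tuples l (suc u) X h = ∑ (λ B → ⟦ slice l X B ⟧ * tuples l u (X ∪̇ B) (λ Bs → h (B ∷ Bs)))

data Tuple {n} (l : ℕ) : ℕ → Subset n → List (Subset n) → Set where
  []  : ∀ {X} → Tuple l 0 X []
  _∷_ : ∀ {u X B Bs} → slice l X B ≡ true → Tuple l u (X ∪̇ B) Bs → Tuple l (suc u) X (B ∷ Bs)

⟦⟧*-mono : ∀ b {x y} → (b ≡ true → x ≤ y) → ⟦ b ⟧ * x ≤ ⟦ b ⟧ * y
⟦⟧*-mono true  h = *-monoʳ-≤ 1 (h refl)
⟦⟧*-mono false h = z≤n

⟦⟧*-cong : ∀ b {x y} → (b ≡ true → x ≡ y) → ⟦ b ⟧ * x ≡ ⟦ b ⟧ * y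
⟦⟧*-cong true  h = cong (1 *_) (h refl)
⟦⟧*-cong false h = refl

tuples-mono : ∀ {n} l u (X : Subset n) {h h′} → (∀ Bs → Tuple l u X Bs → h Bs ≤ h′ Bs) →
  tuples l u X h ≤ tuples l u X h′
tuples-mono l zero    X H = H [] []
tuples-mono l (suc u) X H = ∑-mono (λ B → ⟦⟧*-mono (slice l X B)
  (λ s → tuples-mono l u (X ∪̇ B) (λ Bs T → H (B ∷ Bs) (s ∷ T))))

tuples-+ : ∀ {n} l u (X : Subset n) h h′ →
  tuples l u X (λ Bs → h Bs + h′ Bs) ≡ tuples l u X h + tuples l u X h′
tuples-+ l zero    X h h′ = refl
tuples-+ l (suc u) X h h′ = trans
  (∑-cong (λ B → trans (cong (⟦ slice l X B ⟧ *_) (tuples-+ l u (X ∪̇ B) (λ Bs → h (B ∷ Bs)) (λ Bs → h′ (B ∷ Bs))))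
    (*-distribˡ-+ ⟦ slice l X B ⟧ (tuples l u (X ∪̇ B) (λ Bs → h (B ∷ Bs))) _)))
  (∑-+ (λ B → ⟦ slice l X B ⟧ * tuples l u (X ∪̇ B) (λ Bs → h (B ∷ Bs))) _)

tuples-* : ∀ {n} l u (X : Subset n) c h → tuples l u X (λ Bs → c * h Bs) ≡ c * tuples l u X h
tuples-* l zero    X c h = refl
tuples-* l (suc u) X c h = trans
  (∑-cong (λ B → trans (cong (⟦ slice l X B ⟧ *_) (tuples-* l u (X ∪̇ B) c (λ Bs → h (B ∷ Bs))))
    (e ⟦ slice l X B ⟧ c (tuples l u (X ∪̇ B) (λ Bs → h (B ∷ Bs))))))
  (∑-*ˡ c (λ B → ⟦ slice l X B ⟧ * tuples l u (X ∪̇ B) (λ Bs → h (B ∷ Bs))))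
  where
  e : ∀ b c x → b * (c * x) ≡ c * (b * x)
  e = solve-∀

tuples-⨁ : ∀ {n s} l u (X : Subset n) (h : Fin s → List (Subset n) → ℕ) →
  tuples l u X (λ Bs → ⨁ (λ j → h j Bs)) ≡ ⨁ (λ j → tuples l u X (h j))
tuples-⨁ {s = zero}  l u X h = trans (tuples-* l u X 0 (λ _ → 0)) refl
tuples-⨁ {s = suc s} l u X h = trans (tuples-+ l u X (h zero) (λ Bs → ⨁ (λ j → h (suc j) Bs)))
  (cong (tuples l u X (h zero) +_) (tuples-⨁ l u X (λ j → h (suc j))))

-- The number of u-tuples of disjoint l-subsets of a y-set, and of those with one given entry.
#tuples #through : ℕ → ℕ → ℕ → ℕ
#tuples l zero    y = 1
#tuples l (suc u) y = (y C l) * #tuples l u (y ∸ l)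
#through l zero    y = 0
#through l (suc u) y = #tuples l u (y ∸ l) + #through l u (y ∸ l) * ((y ∸ l) C l)

-- Pairs of a tuple and one of its `u` entries, counted from both sides.
#through-C : ∀ l u y → #through l u y * (y C l) ≡ u * #tuples l u y
#through-C l zero    y = refl
#through-C l (suc u) y = trans (cong (λ x → (#tuples l u (y ∸ l) + x) * (y C l)) (#through-C l u (y ∸ l)))
  (e (#tuples l u (y ∸ l)) u (y C l))
  where
  e : ∀ N u c → (N + u * N) * c ≡ (1 + u) * (c * N)
  e = solve-∀

C-pos : ∀ n k → k ≤ n → 1 ≤ n C k
C-pos n       zero    _       = ≤-refl
C-pos (suc n) (suc k) (s≤s l) = ≤-trans (C-pos n k l)
  (≤-trans (m≤m+n (n C k) (n C suc k)) (≤-reflexive (nCk+nC[k+1]≡[n+1]C[k+1] n k)))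

#tuples-pos : ∀ l u y → u * l ≤ y → 1 ≤ #tuples l u y
#tuples-pos l zero    y _ = ≤-refl
#tuples-pos l (suc u) y h = *-mono-≤ (C-pos y l (≤-trans (m≤m+n l (u * l)) h))
  (#tuples-pos l u (y ∸ l) (m+n≤o⇒m≤o∸n (u * l) (≤-trans (≤-reflexive (+-comm (u * l) l)) h)))

∣∁∪∣-slice : ∀ {n l} (X B : Subset n) → slice l X B ≡ true → ∣ ∁ (X ∪̇ B) ∣ ≡ ∣ ∁ X ∣ ∸ l
∣∁∪∣-slice {l = l} X B s = let e , d = slice-elim {X = X} {B} s in
  trans (sym (m+n∸n≡m ∣ ∁ (X ∪̇ B) ∣ l)) (cong (_∸ l) (trans (cong (∣ ∁ (X ∪̇ B) ∣ +_) (sym e)) (∣∁∪∣ X B d)))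

tuples-1 : ∀ {n} l u (X : Subset n) → tuples l u X (λ _ → 1) ≡ #tuples l u ∣ ∁ X ∣
tuples-1 l zero    X = refl
tuples-1 l (suc u) X = begin
  ∑ (λ B → ⟦ slice l X B ⟧ * tuples l u (X ∪̇ B) (λ _ → 1))
    ≡⟨ ∑-cong (λ B → ⟦⟧*-cong (slice l X B) (λ s → trans (tuples-1 l u (X ∪̇ B)) (cong (#tuples l u) (∣∁∪∣-slice X B s)))) ⟩
  ∑ (λ B → ⟦ slice l X B ⟧ * #tuples l u (∣ ∁ X ∣ ∸ l))
    ≡⟨ ∑-*ʳ _ (λ B → ⟦ slice l X B ⟧) ⟩
  cnt (slice l X) * #tuples l u (∣ ∁ X ∣ ∸ l)
    ≡⟨ cong (_* #tuples l u (∣ ∁ X ∣ ∸ l)) (cnt-slice l X) ⟩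
  (∣ ∁ X ∣ C l) * #tuples l u (∣ ∁ X ∣ ∸ l) ∎
  where open ≡-Reasoning

slice-swap : ∀ {n} l (X B B′ : Subset n) →
  ⟦ slice l X B ⟧ * ⟦ slice l (X ∪̇ B) B′ ⟧ ≡ ⟦ slice l X B′ ⟧ * ⟦ slice l (X ∪̇ B′) B ⟧
slice-swap l X B B′ = trans (expand B B′) (trans
  (trans (e ⟦ ∣ B ∣ ≡ᵇ l ⟧ ⟦ disj B X ⟧ ⟦ ∣ B′ ∣ ≡ᵇ l ⟧ ⟦ disj B′ X ⟧ ⟦ disj B′ B ⟧)
    (cong (λ b → ⟦ ∣ B′ ∣ ≡ᵇ l ⟧ * ⟦ disj B′ X ⟧ * (⟦ ∣ B ∣ ≡ᵇ l ⟧ * (⟦ disj B X ⟧ * ⟦ b ⟧))) (disj-sym B′ B)))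
  (sym (expand B′ B)))
  where
  expand : ∀ B B′ → ⟦ slice l X B ⟧ * ⟦ slice l (X ∪̇ B) B′ ⟧ ≡
    ⟦ ∣ B ∣ ≡ᵇ l ⟧ * ⟦ disj B X ⟧ * (⟦ ∣ B′ ∣ ≡ᵇ l ⟧ * (⟦ disj B′ X ⟧ * ⟦ disj B′ B ⟧))
  expand B B′ = cong₂ _*_ (⟦∧⟧ (∣ B ∣ ≡ᵇ l) (disj B X)) (trans (⟦∧⟧ (∣ B′ ∣ ≡ᵇ l) (disj B′ (X ∪̇ B)))
    (cong (⟦ ∣ B′ ∣ ≡ᵇ l ⟧ *_) (trans (cong ⟦_⟧ (disj-∪ B′ B X)) (⟦∧⟧ (disj B′ X) (disj B′ B)))))
  e : ∀ a b c d f → a * b * (c * (d * f)) ≡ c * d * (a * (b * f))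
  e = solve-∀

-- Linearity of expectation: by symmetry every l-set off `X` is an entry of the same number of
-- tuples.
tuples-hits : ∀ {n} l u (X : Subset n) (F : Family n) →
  tuples l u X (hits F) ≡ #through l u ∣ ∁ X ∣ * ∑ (λ B → ⟦ slice l X B ⟧ * ⟦ F B ⟧)
tuples-hits l zero    X F = refl
tuples-hits l (suc u) X F = begin
  ∑ (λ B → σ B * tuples l u (X ∪̇ B) (λ Bs → ⟦ F B ⟧ + hits F Bs))
    ≡⟨ ∑-cong (λ B → trans (⟦⟧*-cong (slice l X B) (inner B)) (spread (σ B) ⟦ F B ⟧ N c (W B))) ⟩
  ∑ (λ B → N * (σ B * ⟦ F B ⟧) + c * (σ B * W B))
    ≡⟨ ∑-+ (λ B → N * (σ B * ⟦ F B ⟧)) (λ B → c * (σ B * W B)) ⟩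
  ∑ (λ B → N * (σ B * ⟦ F B ⟧)) + ∑ (λ B → c * (σ B * W B))
    ≡⟨ cong₂ _+_ (∑-*ˡ N (λ B → σ B * ⟦ F B ⟧)) (∑-*ˡ c (λ B → σ B * W B)) ⟩
  N * V + c * ∑ (λ B → σ B * W B)
    ≡⟨ cong (λ x → N * V + c * x) double ⟩
  N * V + c * ((y C l) * V)
    ≡⟨ collect N V c (y C l) ⟩
  (N + c * (y C l)) * V ∎
  where
  open ≡-Reasoning
  y = ∣ ∁ X ∣ ∸ l
  N = #tuples l u y
  c = #through l u y
  σ : Subset _ → ℕ
  σ B = ⟦ slice l X B ⟧
  W : Subset _ → ℕ
  W B = ∑ (λ B′ → ⟦ slice l (X ∪̇ B) B′ ⟧ * ⟦ F B′ ⟧)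
  V = ∑ (λ B → σ B * ⟦ F B ⟧)
  spread : ∀ s f N c w → s * (f * N + c * w) ≡ N * (s * f) + c * (s * w)
  spread = solve-∀
  collect : ∀ N V c k → N * V + c * (k * V) ≡ (N + c * k) * V
  collect = solve-∀
  inner : ∀ B → slice l X B ≡ true → tuples l u (X ∪̇ B) (λ Bs → ⟦ F B ⟧ + hits F Bs) ≡ ⟦ F B ⟧ * N + c * W B
  inner B s = begin
    tuples l u (X ∪̇ B) (λ Bs → ⟦ F B ⟧ + hits F Bs)
      ≡⟨ tuples-+ l u (X ∪̇ B) (λ _ → ⟦ F B ⟧) (hits F) ⟩
    tuples l u (X ∪̇ B) (λ _ → ⟦ F B ⟧) + tuples l u (X ∪̇ B) (hits F)
      ≡⟨ cong₂ _+_ const (trans (tuples-hits l u (X ∪̇ B) F) (cong (λ z → #through l u z * W B) (∣∁∪∣-slice X B s))) ⟩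
    ⟦ F B ⟧ * N + c * W B ∎
    where
    const : tuples l u (X ∪̇ B) (λ _ → ⟦ F B ⟧) ≡ ⟦ F B ⟧ * N
    const = begin
      tuples l u (X ∪̇ B) (λ _ → ⟦ F B ⟧)       ≡⟨ cong (λ z → tuples l u (X ∪̇ B) (λ _ → z)) (sym (*-identityʳ ⟦ F B ⟧)) ⟩
      tuples l u (X ∪̇ B) (λ _ → ⟦ F B ⟧ * 1)   ≡⟨ tuples-* l u (X ∪̇ B) ⟦ F B ⟧ (λ _ → 1) ⟩
      ⟦ F B ⟧ * tuples l u (X ∪̇ B) (λ _ → 1)   ≡⟨ cong (⟦ F B ⟧ *_) (trans (tuples-1 l u (X ∪̇ B)) (cong (#tuples l u) (∣∁∪∣-slice X B s))) ⟩
      ⟦ F B ⟧ * N ∎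
  -- Exchanging the order of choice leaves the set of disjoint pairs unchanged, and each `B′` has
  -- C(y,l) partners.
  double : ∑ (λ B → σ B * W B) ≡ (y C l) * V
  double = begin
    ∑ (λ B → σ B * W B)
      ≡⟨ ∑-cong (λ B → sym (∑-*ˡ (σ B) (λ B′ → ⟦ slice l (X ∪̇ B) B′ ⟧ * ⟦ F B′ ⟧))) ⟩
    ∑ (λ B → ∑ (λ B′ → σ B * (⟦ slice l (X ∪̇ B) B′ ⟧ * ⟦ F B′ ⟧)))
      ≡⟨ ∑-swap (λ B B′ → σ B * (⟦ slice l (X ∪̇ B) B′ ⟧ * ⟦ F B′ ⟧)) ⟩
    ∑ (λ B′ → ∑ (λ B → σ B * (⟦ slice l (X ∪̇ B) B′ ⟧ * ⟦ F B′ ⟧)))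
      ≡⟨ ∑-cong (λ B′ → trans (∑-cong (λ B → swap B B′)) (trans (∑-*ˡ (σ B′ * ⟦ F B′ ⟧) (λ B → ⟦ slice l (X ∪̇ B′) B ⟧))
           (trans (e (σ B′) ⟦ F B′ ⟧ (cnt (slice l (X ∪̇ B′))))
             (trans (⟦⟧*-cong (slice l X B′) (λ s → cong (⟦ F B′ ⟧ *_) (trans (cnt-slice l (X ∪̇ B′)) (cong (_C l) (∣∁∪∣-slice X B′ s)))))
               (e′ (σ B′) ⟦ F B′ ⟧ (y C l)))))) ⟩
    ∑ (λ B′ → (y C l) * (σ B′ * ⟦ F B′ ⟧))
      ≡⟨ ∑-*ˡ (y C l) (λ B′ → σ B′ * ⟦ F B′ ⟧) ⟩
    (y C l) * V ∎
    where
    e : ∀ s f c → s * f * c ≡ s * (f * c)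
    e = solve-∀
    e′ : ∀ s f c → s * (f * c) ≡ c * (s * f)
    e′ = solve-∀
    e″ : ∀ a b f → a * b * f ≡ a * f * b
    e″ = solve-∀
    swap : ∀ B B′ → σ B * (⟦ slice l (X ∪̇ B) B′ ⟧ * ⟦ F B′ ⟧) ≡ σ B′ * ⟦ F B′ ⟧ * ⟦ slice l (X ∪̇ B′) B ⟧
    swap B B′ = trans (sym (*-assoc (σ B) ⟦ slice l (X ∪̇ B) B′ ⟧ ⟦ F B′ ⟧))
      (trans (cong (_* ⟦ F B′ ⟧) (slice-swap l X B B′)) (e″ (σ B′) ⟦ slice l (X ∪̇ B′) B ⟧ ⟦ F B′ ⟧))

-- Greedy choice of representatives

Dj : ∀ {n} → Subset n → Subset n → Set
Dj A B = disj A B ≡ true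

-- `few` says that the choice costs every family at most one hit. `inherit` records disjointness in
-- a form that survives repeated choices.
record Pick {n} (F : Family n) (Bs : List (Subset n)) : Set where
  field
    chosen  : Subset n
    others  : List (Subset n)
    chosen∈ : F chosen ≡ true
    apart   : All (Dj chosen) others
    pairs   : AllPairs Dj others
    few     : ∀ G → hits G Bs ≤ suc (hits G others)
    inherit : ∀ Z → All (Dj Z) Bs → Dj Z chosen × All (Dj Z) others

pick : ∀ {n} (F : Family n) Bs → AllPairs Dj Bs → 1 ≤ hits F Bs → Pick F Bs
pick F (B ∷ Bs) (a ∷ ps) h with F B in eq
... | true = record
  { chosen = B ; others = Bs ; chosen∈ = eq ; apart = a ; pairs = ps
  ; few = λ G → +-monoˡ-≤ (hits G Bs) (⟦⟧≤1 (G B)) ; inherit = λ { Z (d ∷ ds) → d , ds } }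
... | false = record
  { chosen = chosen ; others = B ∷ others ; chosen∈ = chosen∈
  ; apart = trans (disj-sym chosen B) (proj₁ (inherit B a)) ∷ apart
  ; pairs = proj₂ (inherit B a) ∷ pairs
  ; few = λ G → ≤-trans (+-monoʳ-≤ ⟦ G B ⟧ (few G)) (≤-reflexive (+-suc ⟦ G B ⟧ (hits G others)))
  ; inherit = λ { Z (d ∷ ds) → proj₁ (inherit Z ds) , d ∷ proj₂ (inherit Z ds) } }
  where open Pick (pick F Bs ps h)

-- Family `j` chooses after `j` others have each removed one entry, and so it still has a hit left.
greedy : ∀ {n} s (F : Fin s → Family n) Bs → AllPairs Dj Bs → (∀ j → suc (F.toℕ j) ≤ hits (F j) Bs) →
  Σ (SDR F) λ R → ∀ Z → All (Dj Z) Bs → ∀ j → Dj Z (SDR.rep R j)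
greedy zero    F Bs ps h = sdr (λ ()) (λ ()) (λ ()) , λ _ _ ()
greedy {n} (suc s) F Bs ps h = sdr rep′ rep∈′ dis′ , inh
  where
  open Pick (pick (F zero) Bs ps (h zero))
  R = greedy s (λ j → F (suc j)) others pairs (λ j → ≤-pred (≤-trans (h (suc j)) (few (F (suc j)))))
  open SDR (proj₁ R)
  rep′ : Fin (suc s) → Subset n
  rep′ zero    = chosen
  rep′ (suc j) = rep j
  rep∈′ : ∀ j → F j (rep′ j) ≡ true
  rep∈′ zero    = chosen∈
  rep∈′ (suc j) = rep∈ j
  dis′ : ∀ i j → i ≢ j → Dj (rep′ i) (rep′ j)
  dis′ zero    zero    ne = ⊥-elim (ne refl)
  dis′ zero    (suc j) ne = proj₂ R chosen apart j
  dis′ (suc i) zero    ne = trans (disj-sym (rep i) chosen) (proj₂ R chosen apart i)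
  dis′ (suc i) (suc j) ne = disjoint i j (λ e → ne (cong suc e))
  inh : ∀ Z → All (Dj Z) Bs → ∀ j → Dj Z (rep′ j)
  inh Z a zero    = proj₁ (inherit Z a)
  inh Z a (suc j) = proj₂ R Z (proj₂ (inherit Z a)) j

tuple-off : ∀ {n l u} {X : Subset n} {Bs} → Tuple l u X Bs → All (Dj X) Bs
tuple-off [] = []
tuple-off {X = X} (_∷_ {B = B} s T) = trans (disj-sym X B) (proj₂ (slice-elim {X = X} {B} s)) ∷ weaken (tuple-off T)
  where
  weaken : ∀ {Bs} → All (Dj (X ∪̇ B)) Bs → All (Dj X) Bs
  weaken []       = []
  weaken {Z ∷ _} (d ∷ ds) = trans (disj-sym X Z) (proj₁ (∧-true (trans (sym (disj-∪ Z B X)) (trans (disj-sym Z (X ∪̇ B)) d)))) ∷ weaken ds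

tuple-pairs : ∀ {n l u} {X : Subset n} {Bs} → Tuple l u X Bs → AllPairs Dj Bs
tuple-pairs [] = []
tuple-pairs {X = X} (_∷_ {B = B} s T) = weaken (tuple-off T) ∷ tuple-pairs T
  where
  weaken : ∀ {Bs} → All (Dj (X ∪̇ B)) Bs → All (Dj B) Bs
  weaken []       = []
  weaken {Z ∷ _} (d ∷ ds) = trans (disj-sym B Z) (proj₂ (∧-true {disj Z X} (trans (sym (disj-∪ Z B X)) (trans (disj-sym Z (X ∪̇ B)) d)))) ∷ weaken ds

hits≤ : ∀ {n l u} {X : Subset n} {Bs} (F : Family n) → Tuple l u X Bs → hits F Bs ≤ u
hits≤ F []      = z≤n
hits≤ F (_∷_ {B = B} s T) = +-mono-≤ (⟦⟧≤1 (F B)) (hits≤ F T)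

hits-mono : ∀ {n} {F G : Family n} → (∀ A → F A ≡ true → G A ≡ true) → ∀ Bs → hits F Bs ≤ hits G Bs
hits-mono h []       = z≤n
hits-mono h (B ∷ Bs) = +-mono-≤ (⟦⟧-mono (h B)) (hits-mono h Bs)

⨁-two-bounds : ∀ t (f : Fin (suc t) → ℕ) c u (j : Fin (suc t)) →
  (∀ i → F.toℕ i ≤ F.toℕ j → f i ≤ c) → (∀ i → f i ≤ u) →
  ⨁ f ≤ suc (F.toℕ j) * c + (t ∸ F.toℕ j) * u
⨁-two-bounds t f c u zero lo hi = +-mono-≤ (≤-trans (lo zero z≤n) (≤-reflexive (sym (+-identityʳ c))))
  (≤-trans (⨁-mono (λ i → hi (suc i))) (≤-reflexive (⨁-const {t} u)))
⨁-two-bounds (suc t) f c u (suc j) lo hi = ≤-trans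
  (+-mono-≤ (lo zero z≤n) (⨁-two-bounds t (λ i → f (suc i)) c u j (λ i l → lo (suc i) (s≤s l)) (λ i → hi (suc i))))
  (≤-reflexive (sym (+-assoc c (suc (F.toℕ j) * c) _)))

Nested : ∀ {n s} → (Fin s → Family n) → Set
Nested F = ∀ i j → F.toℕ i ≤ F.toℕ j → ∀ A → F i A ≡ true → F j A ≡ true

-- By `greedy` some family j has at most j hits, and by nestedness so have all before it; the later
-- ones have at most 2 t + 1. The resulting sum falls short of t (2 t + 1) by j (t - j). The tuple
-- length 2 t + 1 is the one for which both j = 0 and j = t are tight.
tuple-bound : ∀ {n} t l (X : Subset n) (F : Fin (suc t) → Family n) → Nested F → ¬ SDR F →
  ∀ Bs → Tuple l (2 * t + 1) X Bs → ⨁ (λ j → hits (F j) Bs) + t * hits (F zero) Bs ≤ t * (2 * t + 1)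
tuple-bound t l X F nest none Bs T with Fin.any? (λ j → hits (F j) Bs ≤? F.toℕ j)
... | no all = ⊥-elim (none (proj₁ (greedy (suc t) F Bs (tuple-pairs T) (λ j → ≰⇒> (λ le → all (j , le))))))
... | yes (j , le) = begin
  ⨁ (λ j → hits (F j) Bs) + t * hits (F zero) Bs
    ≤⟨ +-mono-≤ (⨁-two-bounds t (λ j → hits (F j) Bs) J u j low (λ i → hits≤ (F i) T)) (*-monoʳ-≤ t (low zero z≤n)) ⟩
  suc J * J + (t ∸ J) * u + t * J
    ≡⟨ cong (λ z → suc J * J + e * (2 * z + 1) + z * J) (sym t≡) ⟩
  suc J * J + e * (2 * (J + e) + 1) + (J + e) * J
    ≤⟨ m≤m+n _ (J * e) ⟩
  suc J * J + e * (2 * (J + e) + 1) + (J + e) * J + J * e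
    ≡⟨ poly J e ⟩
  (J + e) * (2 * (J + e) + 1)
    ≡⟨ cong (λ z → z * (2 * z + 1)) t≡ ⟩
  t * u ∎
  where
  open ≤-Reasoning
  u = 2 * t + 1
  J = F.toℕ j
  e = t ∸ J
  t≡ : J + e ≡ t
  t≡ = m+[n∸m]≡n (≤-pred (Fin.toℕ<n j))
  low : ∀ i → F.toℕ i ≤ J → hits (F i) Bs ≤ J
  low i l = ≤-trans (hits-mono (nest i j l) Bs) le
  poly : ∀ J e → (1 + J) * J + e * (2 * (J + e) + 1) + (J + e) * J + J * e ≡ (J + e) * (2 * (J + e) + 1)
  poly = solve-∀

-- The average of `tuple-bound` over all tuples. Room for 2 t + 1 disjoint sets ensures that tuples
-- exist, so that the common factor `c` is positive and can be cancelled.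
cross-dependent : ∀ {n} t l (X : Subset n) (F : Fin (suc t) → Family n) →
  (∀ j A → F j A ≡ true → slice l X A ≡ true) → Nested F → ¬ SDR F → (2 * t + 1) * l ≤ ∣ ∁ X ∣ →
  ⨁ (λ j → cnt (F j)) + t * cnt (F zero) ≤ t * (∣ ∁ X ∣ C l)
cross-dependent t l X F sl nest none room = *-cancelˡ-≤ c {{>-nonZero c>0}} (begin
  c * (⨁ (λ j → cnt (F j)) + t * cnt (F zero))
    ≡⟨ trans (*-distribˡ-+ c (⨁ (λ j → cnt (F j))) _) (cong₂ _+_ (sym (⨁-*ˡ c (λ j → cnt (F j)))) (e c t (cnt (F zero)))) ⟩
  ⨁ (λ j → c * cnt (F j)) + t * (c * cnt (F zero))
    ≡⟨ sym (cong₂ _+_ (⨁-cong (λ j → total (F j) (sl j))) (cong (t *_) (total (F zero) (sl zero)))) ⟩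
  ⨁ (λ j → tuples l u X (hits (F j))) + t * tuples l u X (hits (F zero))
    ≡⟨ sym (cong₂ _+_ (tuples-⨁ l u X (λ j → hits (F j))) (tuples-* l u X t (hits (F zero)))) ⟩
  tuples l u X (λ Bs → ⨁ (λ j → hits (F j) Bs)) + tuples l u X (λ Bs → t * hits (F zero) Bs)
    ≡⟨ sym (tuples-+ l u X (λ Bs → ⨁ (λ j → hits (F j) Bs)) (λ Bs → t * hits (F zero) Bs)) ⟩
  tuples l u X (λ Bs → ⨁ (λ j → hits (F j) Bs) + t * hits (F zero) Bs)
    ≤⟨ tuples-mono l u X (λ Bs T → ≤-trans (tuple-bound t l X F nest none Bs T) (≤-reflexive (sym (*-identityʳ (t * u))))) ⟩
  tuples l u X (λ _ → t * u * 1)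
    ≡⟨ trans (tuples-* l u X (t * u) (λ _ → 1)) (cong (t * u *_) (tuples-1 l u X)) ⟩
  t * u * #tuples l u y
    ≡⟨ trans (*-assoc t u _) (cong (t *_) (sym (#through-C l u y))) ⟩
  t * (c * (y C l))
    ≡⟨ sym (e c t (y C l)) ⟩
  c * (t * (y C l)) ∎)
  where
  open ≤-Reasoning
  u = 2 * t + 1
  y = ∣ ∁ X ∣
  c = #through l u y
  e : ∀ c t x → c * (t * x) ≡ t * (c * x)
  e = solve-∀
  total : ∀ G → (∀ A → G A ≡ true → slice l X A ≡ true) → tuples l u X (hits G) ≡ c * cnt G
  total G s = trans (tuples-hits l u X G) (cong (c *_) (∑-cong (λ A → inside A (G A) refl)))
    where
    inside : ∀ A b → G A ≡ b → ⟦ slice l X A ⟧ * ⟦ G A ⟧ ≡ ⟦ G A ⟧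
    inside A true  g rewrite s A g = +-identityʳ ⟦ G A ⟧
    inside A false g rewrite g = *-zeroʳ ⟦ slice l X A ⟧
  c>0 : 1 ≤ c
  c>0 = pos c (≤-trans (*-mono-≤ (m≤n+m 1 (2 * t)) (#tuples-pos l u y room)) (≤-reflexive (sym (#through-C l u y))))
    where
    pos : ∀ c → 1 ≤ c * (y C l) → 1 ≤ c
    pos (suc c) _ = s≤s z≤n

-- Upper shadows and complements

co : ∀ {n} → ℕ → Subset n → Family n → Family n
co k X F A = slice k X A ∧ not (F A)

ush : ∀ {n} → ℕ → Subset n → Family n → Family n
ush k X F A = slice (suc k) X A ∧ not (∀ᵇ (λ i → not (lookup A i) ∨ not (F (A [ i ]≔ false))))

ushI : ∀ {n} → ℕ → Subset n → ℕ → Family n → Family n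
ushI k X zero    F = F
ushI k X (suc r) F = ush (r + k) X (ushI k X r F)

_⊑_ : ∀ {n} → Family n → Family n → Set
F ⊑ G = ∀ A → F A ≡ true → G A ≡ true

∀ᵇ-counter : ∀ {n} (p : Fin n → Bool) → ∀ᵇ p ≡ false → Σ (Fin n) λ i → p i ≡ false
∀ᵇ-counter {suc n} p e with p zero in eq
... | false = zero , eq
... | true  = let i , q = ∀ᵇ-counter (λ i → p (suc i)) e in suc i , q

ush-elim : ∀ {n} k (X : Subset n) F A → ush k X F A ≡ true →
  Σ (Fin n) λ i → lookup A i ≡ true × F (A [ i ]≔ false) ≡ true
ush-elim k X F A p
  with ∀ᵇ-counter (λ i → not (lookup A i) ∨ not (F (A [ i ]≔ false))) (not-true (proj₂ (∧-true {slice (suc k) X A} p)))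
... | i , q with lookup A i in a | F (A [ i ]≔ false) in f
...   | true | true = i , a , f

ush-intro : ∀ {n} k (X : Subset n) F A i → slice (suc k) X A ≡ true → lookup A i ≡ true →
  F (A [ i ]≔ false) ≡ true → ush k X F A ≡ true
ush-intro k X F A i s a f = ∧-intro s (refute (∀ᵇ p) refl)
  where
  p = λ i → not (lookup A i) ∨ not (F (A [ i ]≔ false))
  refute : ∀ b → ∀ᵇ p ≡ b → not b ≡ true
  refute false e = refl
  refute true  e = true≢false (imp-elim {lookup A i} (∀ᵇ-elim p e i) a) (cong not f)

ush-slice : ∀ {n} k (X : Subset n) F → ush k X F ⊑ slice (suc k) X
ush-slice k X F A p = proj₁ (∧-true p)

ushI-slice : ∀ {n} k (X : Subset n) r F → F ⊑ slice k X → ushI k X r F ⊑ slice (r + k) X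
ushI-slice k X zero    F h = h
ushI-slice k X (suc r) F h = ush-slice (r + k) X (ushI k X r F)

slice-uniform : ∀ {n k} {X : Subset n} {F} → F ⊑ slice k X → IsKUniform k F
slice-uniform {X = X} h A p = proj₁ (slice-elim {X = X} {A} (h A p))

ush-mono : ∀ {n} k (X : Subset n) {F G : Family n} → F ⊑ G → ush k X F ⊑ ush k X G
ush-mono k X {F} {G} h A p =
  let i , a , f = ush-elim k X F A p in ush-intro k X G A i (ush-slice k X F A p) a (h _ f)

ushI-mono : ∀ {n} k (X : Subset n) r {F G : Family n} → F ⊑ G → ushI k X r F ⊑ ushI k X r G
ushI-mono k X zero    h = h
ushI-mono k X (suc r) h = ush-mono (r + k) X (ushI-mono k X r h)

ush-sdr : ∀ {n s} k (X : Subset n) (F : Fin s → Family n) → SDR (λ j → ush k X (F j)) → SDR F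
ush-sdr k X F (sdr B b∈ dis) = sdr (λ j → B j [ i j ]≔ false) (λ j → proj₂ (proj₂ (e j))) dis′
  where
  e = λ j → ush-elim k X (F j) (B j) (b∈ j)
  i = λ j → proj₁ (e j)
  dis′ : ∀ j j′ → j ≢ j′ → disj (B j [ i j ]≔ false) (B j′ [ i j′ ]≔ false) ≡ true
  dis′ j j′ ne = disj-del (B j) (B j′ [ i j′ ]≔ false) (i j) (trans (disj-sym (B j) (B j′ [ i j′ ]≔ false))
    (disj-del (B j′) (B j) (i j′) (trans (disj-sym (B j′) (B j)) (dis j j′ ne))))

ushI-sdr : ∀ {n s} k (X : Subset n) r (F : Fin s → Family n) → SDR (λ j → ushI k X r (F j)) → SDR F
ushI-sdr k X zero    F R = R
ushI-sdr k X (suc r) F R = ushI-sdr k X r F (ush-sdr (r + k) X (λ j → ushI k X r (F j)) R)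

cnt-co : ∀ {n} k (X : Subset n) F → F ⊑ slice k X → cnt F + cnt (co k X F) ≡ ∣ ∁ X ∣ C k
cnt-co k X F h = trans (sym (∑-+ (λ A → ⟦ F A ⟧) (λ A → ⟦ co k X F A ⟧))) (trans (∑-cong (λ A → pw A (F A) refl)) (cnt-slice k X))
  where
  pw : ∀ A b → F A ≡ b → ⟦ F A ⟧ + ⟦ slice k X A ∧ not (F A) ⟧ ≡ ⟦ slice k X A ⟧
  pw A true  e rewrite h A e | e = refl
  pw A false e rewrite e with slice k X A
  ... | true  = refl
  ... | false = refl

co-ush : ∀ {n} k (X : Subset n) F → co (suc k) X (ush k X F) ⊑ up k X (co k X F)
co-ush k X F A p = up-intro {X = X} {co k X F} {A} s h
  where
  s = proj₁ (∧-true {slice (suc k) X A} p)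
  h : ∀ i → lookup A i ≡ true → co k X F (A [ i ]≔ false) ≡ true
  h i a = ∧-intro (slice-intro {X = X} {A [ i ]≔ false} (suc-injective (trans (∣del∣ A i a) (proj₁ sl))) (disj-del A X i (proj₂ sl)))
            (out (F (A [ i ]≔ false)) refl)
    where
    sl = slice-elim {X = X} {A} s
    out : ∀ b → F (A [ i ]≔ false) ≡ b → not b ≡ true
    out false f = refl
    out true  f = true≢false (ush-intro k X F A i s a f) (not-true (proj₂ (∧-true {slice (suc k) X A} p)))

-- A set off `X` that contains no member of `F` has all its k-subsets in the complement.
co-ushI : ∀ {n} k (X : Subset n) r F → co (r + k) X (ushI k X r F) ⊑ upI k X r (co k X F)
co-ushI k X zero    F A p = p
co-ushI k X (suc r) F A p = up-mono (r + k) X (co-ushI k X r F) A (co-ush (r + k) X (ushI k X r F) A p)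

ushI-upI : ∀ {n} k (X : Subset n) r F → F ⊑ slice k X →
  ∣ ∁ X ∣ C (r + k) ≤ cnt (ushI k X r F) + cnt (upI k X r (co k X F))
ushI-upI k X r F h = ≤-trans (≤-reflexive (sym (cnt-co (r + k) X (ushI k X r F) (ushI-slice k X r F h))))
  (+-monoʳ-≤ (cnt (ushI k X r F)) (cnt-mono (co-ushI k X r F)))

co-slice : ∀ {n} k (X : Subset n) F → co k X F ⊑ slice k X
co-slice k X F A p = proj₁ (∧-true p)

-- The complement of `F` lacks exactly |F| of the k-sets, and `cliques` bounds what it spans. In
-- terms of densities, d grows to at least d (r + k) / (k + r d), which for small d is nearly a
-- factor (r + k) / k.
shadow-expansion : ∀ {n} k (X : Subset n) r F → 1 ≤ k → F ⊑ slice k X →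
  (∣ ∁ X ∣ C (r + k)) * ((r + k) * cnt F) ≤ cnt (ushI k X r F) * (k * (∣ ∁ X ∣ C k) + r * cnt F)
shadow-expansion k X r F 1≤k h = +-cancelʳ-≤ (T⁺ * (N * k)) _ _ (begin
  T⁺ * ((r + k) * φ) + T⁺ * (N * k)   ≡⟨ e T⁺ r k φ N ⟩
  T⁺ * (k * (φ + N) + r * φ)          ≡⟨ cong (λ z → T⁺ * (k * z + r * φ)) φ+N ⟩
  T⁺ * V                              ≤⟨ *-monoˡ-≤ V (ushI-upI k X r F h) ⟩
  (φ⁺ + K) * V                        ≡⟨ *-distribʳ-+ V φ⁺ K ⟩
  φ⁺ * V + K * V                      ≤⟨ +-monoʳ-≤ (φ⁺ * V) (cliques k ∣ ∁ X ∣ φ r X (co k X F) 1≤k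
                                           (slice-uniform {X = X} (co-slice k X F)) (≤-reflexive (trans (+-comm N φ) φ+N))) ⟩
  φ⁺ * V + T⁺ * (N * k)               ∎)
  where
  open ≤-Reasoning
  T⁺ = ∣ ∁ X ∣ C (r + k)
  φ = cnt F
  N = cnt (co k X F)
  φ⁺ = cnt (ushI k X r F)
  K = cnt (upI k X r (co k X F))
  φ+N : φ + N ≡ ∣ ∁ X ∣ C k
  φ+N = cnt-co k X F h
  V = k * (∣ ∁ X ∣ C k) + r * φ
  e : ∀ T r k φ N → T * ((r + k) * φ) + T * (N * k) ≡ T * (k * (φ + N) + r * φ)
  e = solve-∀

-- The expansion bound with |F| replaced by its maximum in the denominator: the density of an upper
-- shadow does not decrease.
local-lym : ∀ {n} k (X : Subset n) r F → 1 ≤ k → F ⊑ slice k X →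
  (∣ ∁ X ∣ C (r + k)) * cnt F ≤ (∣ ∁ X ∣ C k) * cnt (ushI k X r F)
local-lym k X r F 1≤k h = *-cancelˡ-≤ (r + k) {{>-nonZero (≤-trans 1≤k (m≤n+m k r))}} (begin
  (r + k) * (T⁺ * φ)        ≡⟨ e₁ (r + k) T⁺ φ ⟩
  T⁺ * ((r + k) * φ)        ≤⟨ shadow-expansion k X r F 1≤k h ⟩
  φ⁺ * (k * T + r * φ)      ≤⟨ *-monoʳ-≤ φ⁺ (+-monoʳ-≤ (k * T) (*-monoʳ-≤ r (≤-trans (m≤m+n φ _) (≤-reflexive (cnt-co k X F h))))) ⟩
  φ⁺ * (k * T + r * T)      ≡⟨ e₂ φ⁺ k T r ⟩
  (r + k) * (T * φ⁺)        ∎)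
  where
  open ≤-Reasoning
  T⁺ = ∣ ∁ X ∣ C (r + k)
  T = ∣ ∁ X ∣ C k
  φ = cnt F
  φ⁺ = cnt (ushI k X r F)
  e₁ : ∀ a T φ → a * (T * φ) ≡ T * (a * φ)
  e₁ = solve-∀
  e₂ : ∀ p k T r → p * (k * T + r * T) ≡ (r + k) * (T * p)
  e₂ = solve-∀

-- Counting members by their trace on X

-- For `i` in `X`: the members that meet `X` in `i` alone, with `i` removed.
trace : ∀ {n} → Subset n → Fin n → Family n → Family n
trace X i F B = disj B X ∧ F (B [ i ]≔ true)

-- The sum is the indicator of meeting `X` in at most one point.
few-hits : ∀ {n} (A X : Subset n) →
  ⟦ disj A X ⟧ + ⨁ (λ i → ⟦ lookup X i ⟧ * (⟦ lookup A i ⟧ * ⟦ disj (A [ i ]≔ false) X ⟧)) ≤ 1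
few-hits []          []          = ≤-refl
few-hits (false ∷ A) (false ∷ X) = few-hits A X
few-hits (false ∷ A) (true ∷ X)  = few-hits A X
few-hits (true ∷ A)  (false ∷ X) = few-hits A X
few-hits {suc n} (true ∷ A) (true ∷ X) = ≤-trans (≤-reflexive (cong₂ _+_ (trans (+-identityʳ _) (+-identityʳ ⟦ disj A X ⟧))
  (trans (⨁-cong (λ i → trans (cong (⟦ lookup X i ⟧ *_) (*-zeroʳ ⟦ lookup A i ⟧)) (*-zeroʳ ⟦ lookup X i ⟧))) (⨁-zero {n}))))
  (≤-trans (≤-reflexive (+-identityʳ ⟦ disj A X ⟧)) (⟦⟧≤1 (disj A X)))

module _ {n} (X : Subset n) where

  small-trace : Subset n → ℕ
  small-trace A = ⟦ disj A X ⟧ + ⨁ (λ i → ⟦ lookup X i ⟧ * (⟦ lookup A i ⟧ * ⟦ disj (A [ i ]≔ false) X ⟧))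

  cnt-trace : ∀ i F → lookup X i ≡ true →
    ∑ (λ A → ⟦ lookup A i ⟧ * (⟦ disj (A [ i ]≔ false) X ⟧ * ⟦ F A ⟧)) ≡ cnt (trace X i F)
  cnt-trace i F x = trans (∑-split i (λ A → ⟦ disj (A [ i ]≔ false) X ⟧ * ⟦ F A ⟧)) (∑-cong (λ B → pw B (lookup B i) refl))
    where
    pw : ∀ B b → lookup B i ≡ b →
      ⟦ not (lookup B i) ⟧ * (⟦ disj ((B [ i ]≔ true) [ i ]≔ false) X ⟧ * ⟦ F (B [ i ]≔ true) ⟧) ≡ ⟦ trace X i F B ⟧
    pw B false e rewrite e | del-add B i e = trans (+-identityʳ _) (sym (⟦∧⟧ (disj B X) (F (B [ i ]≔ true))))
    pw B true  e rewrite e with disj B X in d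
    ... | false = refl
    ... | true  = true≢false x (disj-elim B X d i e)

  ∑-small-trace : ∀ F → ∑ (λ A → ⟦ F A ⟧ * small-trace A) ≡
    cnt (λ A → F A ∧ disj A X) + ⨁ (λ i → ⟦ lookup X i ⟧ * cnt (trace X i F))
  ∑-small-trace F = begin
    ∑ (λ A → ⟦ F A ⟧ * small-trace A)
      ≡⟨ ∑-cong (λ A → trans (*-distribˡ-+ ⟦ F A ⟧ ⟦ disj A X ⟧ _) (cong₂ _+_ (sym (⟦∧⟧ (F A) (disj A X)))
           (trans (sym (⨁-*ˡ ⟦ F A ⟧ (λ i → ⟦ lookup X i ⟧ * (⟦ lookup A i ⟧ * ⟦ disj (A [ i ]≔ false) X ⟧))))
             (⨁-cong (λ i → e ⟦ F A ⟧ ⟦ lookup X i ⟧ ⟦ lookup A i ⟧ ⟦ disj (A [ i ]≔ false) X ⟧))))) ⟩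
    ∑ (λ A → ⟦ F A ∧ disj A X ⟧ + ⨁ (λ i → h A i))
      ≡⟨ ∑-+ (λ A → ⟦ F A ∧ disj A X ⟧) (λ A → ⨁ (λ i → h A i)) ⟩
    cnt (λ A → F A ∧ disj A X) + ∑ (λ A → ⨁ (λ i → h A i))
      ≡⟨ cong (cnt (λ A → F A ∧ disj A X) +_) (trans (∑-⨁-swap h) (⨁-cong (λ i →
           trans (∑-*ˡ ⟦ lookup X i ⟧ (λ A → ⟦ lookup A i ⟧ * (⟦ disj (A [ i ]≔ false) X ⟧ * ⟦ F A ⟧)))
             (⟦⟧*-cong (lookup X i) (cnt-trace i F))))) ⟩
    cnt (λ A → F A ∧ disj A X) + ⨁ (λ i → ⟦ lookup X i ⟧ * cnt (trace X i F)) ∎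
    where
    open ≡-Reasoning
    h : Subset n → Fin n → ℕ
    h A i = ⟦ lookup X i ⟧ * (⟦ lookup A i ⟧ * (⟦ disj (A [ i ]≔ false) X ⟧ * ⟦ F A ⟧))
    e : ∀ f x a d → f * (x * (a * d)) ≡ x * (a * (d * f))
    e = solve-∀

  trace-slice : ∀ {k F} i → IsKUniform (suc k) F → lookup X i ≡ true → trace X i F ⊑ slice k X
  trace-slice i u x B p =
    let d , f = ∧-true {disj B X} p
        i∉ = disj-elim X B (trans (disj-sym X B) d) i x
    in slice-intro {X = X} {B} (suc-injective (trans (sym (∣add∣ B i i∉)) (u _ f))) d

size : ∀ {n} → ℕ → Family n
size k A = ∣ A ∣ ≡ᵇ k

cnt-size : ∀ n k → cnt (size {n} k) ≡ n C k
cnt-size n k = trans (cnt-cong {n} {size k} {slice k ⊥} (λ A → trans (sym (∧-identityʳ (∣ A ∣ ≡ᵇ k))) (cong ((∣ A ∣ ≡ᵇ k) ∧_) (sym (disj-⊥ A)))))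
  (trans (cnt-slice {n} k ⊥) (cong (_C k) (trans (∣∁p∣≡n∸∣p∣ (⊥ {n})) (cong (n ∸_) (∣⊥∣≡0 n)))))

-- The members of `F` meeting `X` in two or more points are among all (l+1)-sets that do. Both
-- counts are written as a total minus the sets with at most one point in `X`.
trace-bound : ∀ {n} l (X : Subset n) F → IsKUniform (suc l) F →
  cnt F + ((∣ ∁ X ∣ C suc l) + ∣ X ∣ * (∣ ∁ X ∣ C l)) ≤
  (n C suc l) + (cnt (λ A → F A ∧ disj A X) + ⨁ (λ i → ⟦ lookup X i ⟧ * cnt (trace X i F)))
trace-bound {n} l X F u = subst₂ _≤_ (cong (cnt F +_) full) (cong₂ _+_ (cnt-size n (suc l)) (∑-small-trace X F))
  (subst₂ _≤_ (∑-+ (λ A → ⟦ F A ⟧) (λ A → ⟦ G A ⟧ * small-trace X A)) (∑-+ (λ A → ⟦ G A ⟧) (λ A → ⟦ F A ⟧ * small-trace X A))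
    (∑-mono (λ A → pw A (F A) (small-trace X A) refl (few-hits A X))))
  where
  open ≡-Reasoning
  G = size (suc l)
  pw : ∀ A b e → F A ≡ b → e ≤ 1 → ⟦ F A ⟧ + ⟦ G A ⟧ * e ≤ ⟦ G A ⟧ + ⟦ F A ⟧ * e
  pw A true  e f l rewrite f | ≡ᵇ-refl (u A f) = ≤-refl
  pw A false e f l rewrite f = ≤-trans (≤-trans (*-monoʳ-≤ ⟦ G A ⟧ l) (≤-reflexive (*-identityʳ ⟦ G A ⟧))) (m≤m+n ⟦ G A ⟧ 0)
  full : ∑ (λ A → ⟦ G A ⟧ * small-trace X A) ≡ (∣ ∁ X ∣ C suc l) + ∣ X ∣ * (∣ ∁ X ∣ C l)
  full = begin
    ∑ (λ A → ⟦ G A ⟧ * small-trace X A)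
      ≡⟨ ∑-small-trace X G ⟩
    cnt (λ A → G A ∧ disj A X) + ⨁ (λ i → ⟦ lookup X i ⟧ * cnt (trace X i G))
      ≡⟨ cong₂ _+_ (cnt-slice (suc l) X) (⨁-cong (λ i → ⟦⟧*-cong (lookup X i) (λ x →
           trans (cnt-cong (λ B → bool-ext (trace-slice X {F = G} i (λ A → ≡ᵇ-true ∣ A ∣ (suc l)) x B) (back i x B))) (cnt-slice l X)))) ⟩
    (∣ ∁ X ∣ C suc l) + ⨁ (λ i → ⟦ lookup X i ⟧ * (∣ ∁ X ∣ C l))
      ≡⟨ cong ((∣ ∁ X ∣ C suc l) +_) (trans (⨁-*ʳ (∣ ∁ X ∣ C l) (λ i → ⟦ lookup X i ⟧)) (cong (_* (∣ ∁ X ∣ C l)) (⨁-∣∣ X))) ⟩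
    (∣ ∁ X ∣ C suc l) + ∣ X ∣ * (∣ ∁ X ∣ C l) ∎
    where
    back : ∀ i → lookup X i ≡ true → slice l X ⊑ trace X i G
    back i x B s =
      let e , d = slice-elim {X = X} {B} s
      in ∧-intro d (≡ᵇ-refl (trans (∣add∣ B i (disj-elim X B (trans (disj-sym X B) d) i x)) (cong suc e)))

-- The most favoured points

top : ∀ q {s} → Subset s → Subset (q + s)
top zero    B = B
top (suc q) B = false ∷ top q B

lookup-top : ∀ q {s} (B : Subset s) j → lookup (top q B) (q ↑ʳ j) ≡ lookup B j
lookup-top zero    B j = refl
lookup-top (suc q) B j = lookup-top q B j

∣top∣ : ∀ q {s} (B : Subset s) → ∣ top q B ∣ ≡ ∣ B ∣
∣top∣ zero    B = refl
∣top∣ (suc q) B = ∣top∣ q B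

∣∁top∣ : ∀ q {s} (B : Subset s) → ∣ ∁ (top q B) ∣ ≡ q + ∣ ∁ B ∣
∣∁top∣ zero    B = refl
∣∁top∣ (suc q) B = cong suc (∣∁top∣ q B)

lookup-⊤ : ∀ {s} (j : Fin s) → lookup (⊤ {s}) j ≡ true
lookup-⊤ zero    = refl
lookup-⊤ (suc j) = lookup-⊤ j

∣∁⊤∣ : ∀ s → ∣ ∁ (⊤ {s}) ∣ ≡ 0
∣∁⊤∣ zero    = refl
∣∁⊤∣ (suc s) = ∣∁⊤∣ s

below-top : ∀ q {s} (B : Subset s) i → lookup (top q (true ∷ B)) i ≡ false → (∀ j → lookup B j ≡ true) →
  i F.< (q ↑ʳ zero {s})
below-top zero    B (suc i) e h = true≢false (h i) e
below-top (suc q) B zero    e h = s≤s z≤n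
below-top (suc q) B (suc i) e h = s≤s (below-top q B i e h)

⨁-top : ∀ q {s} (B : Subset s) (h : Fin (q + s) → ℕ) →
  ⨁ (λ i → ⟦ lookup (top q B) i ⟧ * h i) ≡ ⨁ (λ j → ⟦ lookup B j ⟧ * h (q ↑ʳ j))
⨁-top zero    B h = refl
⨁-top (suc q) B h = ⨁-top q B (λ i → h (suc i))

module Shifted-family {q t l} (F : Family (q + suc t)) (sh : Shifted F) (u : IsKUniform (suc l) F)
  (nm : ¬ Matching (suc t) F) where

  X : Subset (q + suc t)
  X = top q ⊤

  ∣X∣ : ∣ X ∣ ≡ suc t
  ∣X∣ = trans (∣top∣ q (⊤ {suc t})) (∣⊤∣≡n (suc t))

  ∣∁X∣ : ∣ ∁ X ∣ ≡ q
  ∣∁X∣ = trans (∣∁top∣ q (⊤ {suc t})) (trans (cong (q +_) (∣∁⊤∣ (suc t))) (+-identityʳ q))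

  x : Fin (suc t) → Fin (q + suc t)
  x j = q ↑ʳ j

  x∈X : ∀ j → lookup X (x j) ≡ true
  x∈X j = trans (lookup-top q ⊤ j) (lookup-⊤ j)

  x∉ : ∀ {B} j → disj B X ≡ true → lookup B (x j) ≡ false
  x∉ {B} j d = disj-elim X B (trans (disj-sym X B) d) (x j) (x∈X j)

  T : Fin (suc t) → Family (q + suc t)
  T j = trace X (x j) F

  outside-X : Family (q + suc t)
  outside-X A = F A ∧ disj A X

  T-slice : ∀ j → T j ⊑ slice l X
  T-slice j = trace-slice X {F = F} (x j) u (x∈X j)

  -- Points of `X` with larger index are more favoured, so `T zero` is the smallest trace.
  T-nested : Nested T
  T-nested i j i≤j B p with i Fin.≟ j
  ... | yes refl = p
  ... | no ne = ∧-intro d (subst (λ A → F (A [ x j ]≔ true) ≡ true) (del-add B (x i) (x∉ {B} i d))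
      (shifted-move sh (B [ x i ]≔ true) (x i) (x j) x<x (add∈ B (x i)) (trans (≔-other B (x i) (x j) xi≢xj) (x∉ {B} j d)) (proj₂ pp)))
    where
    pp = ∧-true {disj B X} p
    d = proj₁ pp
    xi≢xj : x i ≢ x j
    xi≢xj e = ne (Fin.↑ʳ-injective q i j e)
    x<x : x i F.< x j
    x<x = subst₂ _<_ (sym (Fin.toℕ-↑ʳ q i)) (sym (Fin.toℕ-↑ʳ q j)) (+-monoʳ-< q (≤∧≢⇒< i≤j (λ e → ne (Fin.toℕ-injective e))))

  -- Adding `x j` to the j-th representative would give a matching of `F`.
  T-sdr : ¬ SDR T
  T-sdr (sdr B b∈ dis) = nm (sdr (λ j → B j [ x j ]≔ true) (λ j → proj₂ (∧-true {disj (B j) X} (b∈ j))) dis′)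
    where
    d : ∀ j → disj (B j) X ≡ true
    d j = proj₁ (∧-true {disj (B j) X} (b∈ j))
    dis′ : ∀ i j → i ≢ j → disj (B i [ x i ]≔ true) (B j [ x j ]≔ true) ≡ true
    dis′ i j ne = disj-add (B i [ x i ]≔ true) (B j) (x j)
      (trans (disj-sym (B i [ x i ]≔ true) (B j)) (disj-add (B j) (B i) (x i) (trans (disj-sym (B j) (B i)) (dis i j ne)) (x∉ {B j} i (d j))))
      (trans (≔-other (B i) (x i) (x j) (λ e → ne (Fin.↑ʳ-injective q i j e))) (x∉ {B i} j (d i)))

  -- Replacing any point of a member off `X` by `x zero` stays in `F`, so `T zero` contains the
  -- shadow of `outside-X` and `shadow-bound` applies.
  outside-bound : cnt outside-X ≤ t * cnt (T zero)
  outside-bound = shadow-bound (suc l) t X outside-X (T zero)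
    (λ A p → u A (proj₁ (∧-true p))) (λ A p → proj₂ (∧-true {F A} p)) move down
    (λ { (sdr B b∈ dis) → nm (sdr B (λ j → proj₁ (∧-true (b∈ j))) dis) })
    where
    move : MovableOff X outside-X
    move A i j i<j a∈ a∉ x∉′ p = ∧-intro (shifted-move sh A i j i<j a∈ a∉ (proj₁ (∧-true p)))
      (trans (disj-sym ((A [ i ]≔ false) [ j ]≔ true) X) (disj-add X (A [ i ]≔ false) j
        (trans (disj-sym X (A [ i ]≔ false)) (disj-del A X i (proj₂ (∧-true {F A} p)))) x∉′))
    down : ∀ A i → lookup A i ≡ true → outside-X A ≡ true → T zero (A [ i ]≔ false) ≡ true
    down A i a∈ p = ∧-intro (disj-del A X i d)
      (shifted-move sh A i (x zero) (below-top q (⊤ {t}) i (disj-elim A X d i a∈) lookup-⊤) a∈ (x∉ {A} zero d) (proj₁ (∧-true p)))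
      where
      d = proj₂ (∧-true {F A} p)

  trace-sum : cnt F + ((q C suc l) + suc t * (q C l)) ≤
    ((q + suc t) C suc l) + (cnt outside-X + ⨁ (λ j → cnt (T j)))
  trace-sum = subst₂ _≤_
    (cong (cnt F +_) (cong₂ (λ y s → (y C suc l) + s * (y C l)) ∣∁X∣ ∣X∣))
    (cong (λ z → ((q + suc t) C suc l) + (cnt outside-X + z)) (trans (⨁-top q ⊤ (λ i → cnt (trace X i F)))
      (⨁-cong (λ j → trans (cong (λ b → ⟦ b ⟧ * cnt (T j)) (lookup-⊤ j)) (+-identityʳ (cnt (T j)))))))
    (trace-bound l X F u)

  -- The members off `X` cost at most t |T zero|, and the traces add their sizes. `cross-dependent`
  -- bounds precisely this combination by t C(q,l), out of the (t + 1) C(q,l) that all traces could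
  -- have.
  emc-shifted : (2 * t + 1) * l ≤ q → cnt F + (suc q C suc l) ≤ (q + suc t) C suc l
  emc-shifted room = +-cancelʳ-≤ (t * D) _ _ (begin
    cnt F + (suc q C suc l) + t * D                   ≡⟨ cong (λ z → cnt F + z + t * D) (sym (nCk+nC[k+1]≡[n+1]C[k+1] q l)) ⟩
    cnt F + (D + (q C suc l)) + t * D                 ≡⟨ e₁ (cnt F) D (q C suc l) t ⟩
    cnt F + ((q C suc l) + suc t * D)                 ≤⟨ trace-sum ⟩
    M + (cnt outside-X + Σφ)                          ≤⟨ +-monoʳ-≤ M (+-monoˡ-≤ Σφ outside-bound) ⟩
    M + (t * cnt (T zero) + Σφ)                       ≡⟨ cong (M +_) (+-comm _ Σφ) ⟩
    M + (Σφ + t * cnt (T zero))                       ≤⟨ +-monoʳ-≤ M cross ⟩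
    M + t * D                                         ∎)
    where
    open ≤-Reasoning
    D = q C l
    M = (q + suc t) C suc l
    Σφ = ⨁ (λ j → cnt (T j))
    e₁ : ∀ f D c t → f + (D + c) + t * D ≡ f + (c + (1 + t) * D)
    e₁ = solve-∀
    cross : Σφ + t * cnt (T zero) ≤ t * D
    cross = subst (λ y → Σφ + t * cnt (T zero) ≤ t * (y C l)) ∣∁X∣
      (cross-dependent t l X T T-slice T-nested T-sdr (subst ((2 * t + 1) * l ≤_) (sym ∣∁X∣) room))

-- Frankl's theorem on the Erdős matching conjecture.  From here on n is q + suc t and k is suc l, so
-- that C(n-t,k) is suc q C suc l and C(n-t-1,k-1) is q C l.
emc : ∀ q t l (F : Family (q + suc t)) → IsKUniform (suc l) F → ¬ Matching (suc t) F → (2 * t + 1) * l ≤ q →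
  cnt F + (suc q C suc l) ≤ (q + suc t) C suc l
emc q t l F u nm room = shift-induction
  (λ F → IsKUniform (suc l) F → ¬ Matching (suc t) F → cnt F + (suc q C suc l) ≤ (q + suc t) C suc l)
  (λ F sh u nm → Shifted-family.emc-shifted {q} {t} {l} F sh u nm room)
  (λ F i ih u nm → subst (λ z → z + (suc q C suc l) ≤ (q + suc t) C suc l) (cnt-shift i F)
    (ih (shift-uniform (suc l) i F u) (λ m → nm (shift-matching (suc t) i F m))))
  F u nm

-- Local stability

missing : ∀ {n} → ℕ → Family n → Subset n → Family n
missing k F T A = not (disj A T) ∧ co k ⊥ F A

∣∁⊥∣ : ∀ n → ∣ ∁ (⊥ {n}) ∣ ≡ n
∣∁⊥∣ n = trans (∣∁p∣≡n∸∣p∣ (⊥ {n})) (cong (n ∸_) (∣⊥∣≡0 n))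

uniform-slice : ∀ {n k} {F : Family n} → IsKUniform k F → F ⊑ slice k ⊥
uniform-slice u A p = slice-intro {X = ⊥} {A} (u A p) (disj-⊥ A)

avoid-slice : ∀ {n k} {F : Family n} T → IsKUniform k F → (λ A → F A ∧ disj A T) ⊑ slice k T
avoid-slice {F = F} T u A p = slice-intro {X = T} {A} (u A (proj₁ (∧-true p))) (proj₂ (∧-true {F A} p))

co-split : ∀ {n} k (F : Family n) T →
  cnt (co k ⊥ F) ≡ cnt (co k T (λ A → F A ∧ disj A T)) + cnt (missing k F T)
co-split k F T = trans (∑-cong pw) (∑-+ (λ A → ⟦ co k T (λ A → F A ∧ disj A T) A ⟧) (λ A → ⟦ missing k F T A ⟧))
  where
  pw : ∀ A → ⟦ co k ⊥ F A ⟧ ≡ ⟦ co k T (λ A → F A ∧ disj A T) A ⟧ + ⟦ missing k F T A ⟧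
  pw A rewrite disj-⊥ A with ∣ A ∣ ≡ᵇ k | disj A T | F A
  ... | true  | true  | true  = refl
  ... | true  | true  | false = refl
  ... | true  | false | true  = refl
  ... | true  | false | false = refl
  ... | false | true  | true  = refl
  ... | false | true  | false = refl
  ... | false | false | true  = refl
  ... | false | false | false = refl

-- The star on `T` has C(n,k) - C(|∁ T|,k) members, `x` more than `F`. So what `F` lacks inside the
-- star exceeds what it has outside by `x`.
balance : ∀ {n} k (F : Family n) T x → IsKUniform k F → cnt F + (∣ ∁ T ∣ C k) + x ≡ n C k →
  cnt (missing k F T) ≡ cnt (λ A → F A ∧ disj A T) + x
balance {n} k F T x u e = +-cancelˡ-≡ (cnt F + h) _ _ (begin
  cnt F + h + cnt (missing k F T)     ≡⟨ +-assoc (cnt F) h _ ⟩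
  cnt F + (h + cnt (missing k F T))   ≡⟨ cong (cnt F +_) (sym (co-split k F T)) ⟩
  cnt F + cnt (co k ⊥ F)              ≡⟨ trans (cnt-co k ⊥ F (uniform-slice u)) (cong (_C k) (∣∁⊥∣ n)) ⟩
  n C k                               ≡⟨ sym e ⟩
  cnt F + (∣ ∁ T ∣ C k) + x           ≡⟨ cong (λ z → cnt F + z + x) (sym (cnt-co k T (λ A → F A ∧ disj A T) (avoid-slice T u))) ⟩
  cnt F + (g + h) + x                 ≡⟨ e₁ (cnt F) g h x ⟩
  cnt F + h + (g + x)                 ∎)
  where
  open ≡-Reasoning
  h = cnt (co k T (λ A → F A ∧ disj A T))
  g = cnt (λ A → F A ∧ disj A T)
  e₁ : ∀ f g h x → f + (g + h) + x ≡ f + h + (g + x)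
  e₁ = solve-∀

-- Cliques of the complement, sorted by their first point in T

first : ∀ {n} → Fin n → Subset n → Subset n → Bool
first zero    (a ∷ A) (x ∷ T) = a ∧ x
first (suc i) (a ∷ A) (x ∷ T) = not (a ∧ x) ∧ first i A T

⨁-first : ∀ {n} (A T : Subset n) → ⨁ (λ i → ⟦ first i A T ⟧) ≡ ⟦ not (disj A T) ⟧
⨁-first []      []      = refl
⨁-first {suc n} (a ∷ A) (x ∷ T) with a ∧ x
... | true  = cong suc (⨁-zero {n})
... | false = ⨁-first A T

first∈ : ∀ {n} i (A T : Subset n) → first i A T ≡ true → lookup A i ≡ true
first∈ zero    (a ∷ A) (x ∷ T) e = proj₁ (∧-true e)
first∈ (suc i) (a ∷ A) (x ∷ T) e = first∈ i A T (proj₂ (∧-true {not (a ∧ x)} e))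

-- Deleting another point creates no earlier common point with `T`. This makes "first point `i`" an
-- admissible side condition for `link-upI`.
first-del : ∀ {n} i (T A : Subset n) j → lookup (A [ j ]≔ false) i ≡ true → first i A T ≡ true →
  first i (A [ j ]≔ false) T ≡ true
first-del zero    (x ∷ T) (a ∷ A) (suc j) l e = e
first-del (suc i) (x ∷ T) (a ∷ A) zero    l e = proj₂ (∧-true {not (a ∧ x)} e)
first-del (suc i) (x ∷ T) (a ∷ A) (suc j) l e =
  ∧-intro (proj₁ (∧-true e)) (first-del i T A j l (proj₂ (∧-true {not (a ∧ x)} e)))

link-upI : ∀ {n} l (X : Subset n) r v (Z F : Family n) →
  (∀ A i → lookup (A [ i ]≔ false) v ≡ true → Z A ≡ true → Z (A [ i ]≔ false) ≡ true) →
  link v (λ B → Z B ∧ upI (suc l) X r F B) ⊑ upI l X r (link v (λ B → Z B ∧ F B))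
link-upI l X zero    v Z F cl A p = p
link-upI l X (suc r) v Z F cl A p = up-mono (r + l) X (link-upI l X r v Z F cl) A
  (link-up (r + l) X v Z (upI (suc l) X r F) cl A
    (subst (λ κ → link v (λ B → Z B ∧ up κ X (upI (suc l) X r F) B) A ≡ true) (+-suc r l) p))

module _ {n} (T : Subset n) where

  firsts : Fin n → Family n → Family n
  firsts i F A = first i A T ∧ F A

  ⨁-firsts : ∀ F → ⨁ (λ i → cnt (link i (firsts i F))) ≡ cnt (λ A → not (disj A T) ∧ F A)
  ⨁-firsts F = begin
    ⨁ (λ i → cnt (link i (firsts i F)))
      ≡⟨ ⨁-cong (λ i → sym (cnt-link i (firsts i F))) ⟩
    ⨁ (λ i → ∑ (λ A → ⟦ lookup A i ⟧ * ⟦ firsts i F A ⟧))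
      ≡⟨ ⨁-cong (λ i → ∑-cong (λ A → pw i A)) ⟩
    ⨁ (λ i → ∑ (λ A → ⟦ first i A T ⟧ * ⟦ F A ⟧))
      ≡⟨ sym (∑-⨁-swap (λ A i → ⟦ first i A T ⟧ * ⟦ F A ⟧)) ⟩
    ∑ (λ A → ⨁ (λ i → ⟦ first i A T ⟧ * ⟦ F A ⟧))
      ≡⟨ ∑-cong (λ A → trans (⨁-*ʳ ⟦ F A ⟧ (λ i → ⟦ first i A T ⟧)) (trans (cong (_* ⟦ F A ⟧) (⨁-first A T)) (sym (⟦∧⟧ (not (disj A T)) (F A))))) ⟩
    cnt (λ A → not (disj A T) ∧ F A) ∎
    where
    open ≡-Reasoning
    pw : ∀ i A → ⟦ lookup A i ⟧ * ⟦ first i A T ∧ F A ⟧ ≡ ⟦ first i A T ⟧ * ⟦ F A ⟧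
    pw i A with first i A T in e
    ... | false = *-zeroʳ ⟦ lookup A i ⟧
    ... | true rewrite first∈ i A T e = refl

  -- Without its first point i in `T`, a clique becomes a clique of a link with at most b members.
  -- Using the deficit D - b for every i keeps the estimate of `cliques` linear in the size of the
  -- link, so the links sum to b.
  cliques-meeting : ∀ l q r (G : Family n) → 1 ≤ l → IsKUniform (suc l) G →
    let b = cnt (λ A → not (disj A T) ∧ G A)
        D = q C l
    in b ≤ D →
    cnt (λ A → not (disj A T) ∧ upI (suc l) ⊥ r G A) * (l * D + r * (D ∸ b)) ≤ (q C (r + l)) * (b * l)
  cliques-meeting l q r G 1≤l u b≤D = begin
    cnt (λ A → not (disj A T) ∧ upI (suc l) ⊥ r G A) * W
      ≡⟨ cong (_* W) (sym (⨁-firsts (upI (suc l) ⊥ r G))) ⟩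
    ⨁ (λ i → cnt (link i (firsts i (upI (suc l) ⊥ r G)))) * W
      ≡⟨ sym (⨁-*ʳ W (λ i → cnt (link i (firsts i (upI (suc l) ⊥ r G))))) ⟩
    ⨁ (λ i → cnt (link i (firsts i (upI (suc l) ⊥ r G))) * W)
      ≤⟨ ⨁-mono point ⟩
    ⨁ (λ i → (q C (r + l)) * (N i * l))
      ≡⟨ trans (⨁-*ˡ (q C (r + l)) (λ i → N i * l)) (cong ((q C (r + l)) *_) (trans (⨁-*ʳ l N) (cong (_* l) (⨁-firsts G)))) ⟩
    (q C (r + l)) * (b * l) ∎
    where
    open ≤-Reasoning
    b = cnt (λ A → not (disj A T) ∧ G A)
    D = q C l
    W = l * D + r * (D ∸ b)
    N : Fin n → ℕ
    N i = cnt (link i (firsts i G))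
    N≤b : ∀ i → N i ≤ b
    N≤b i = ≤-trans (term i N) (≤-reflexive (⨁-firsts G))
      where
      term : ∀ {m} (i : Fin m) f → f i ≤ ⨁ f
      term zero    f = m≤m+n (f zero) _
      term (suc i) f = ≤-trans (term i (λ j → f (suc j))) (m≤n+m _ (f zero))
    point : ∀ i → cnt (link i (firsts i (upI (suc l) ⊥ r G))) * W ≤ (q C (r + l)) * (N i * l)
    point i = ≤-trans
      (*-monoˡ-≤ W (cnt-mono (link-upI l ⊥ r i (λ A → first i A T) G (λ A j → first-del i T A j))))
      (cliques l q (D ∸ b) r ⊥ (link i (firsts i G)) 1≤l
        (link-uniform i (firsts i G) (λ A p → u A (proj₂ (∧-true {first i A T} p))))
        (≤-trans (+-monoˡ-≤ (D ∸ b) (N≤b i)) (≤-reflexive (m+[n∸m]≡n b≤D))))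

  cliques-avoiding : ∀ k r F → (λ A → disj A T ∧ upI k ⊥ r (co k ⊥ F) A) ⊑ upI k T r (co k T (λ A → F A ∧ disj A T))
  cliques-avoiding k zero F A p =
    let d , c = ∧-true {disj A T} p
        s , nf = ∧-true {slice k ⊥ A} c
    in ∧-intro (slice-intro {X = T} {A} (proj₁ (slice-elim {X = ⊥} {A} s)) d) (subst (λ b → not (b ∧ disj A T) ≡ true) (sym (not-true nf)) refl)
  cliques-avoiding k (suc r) F A p =
    up-intro {X = T} {upI k T r (co k T (λ A → F A ∧ disj A T))} {A} (slice-intro {X = T} {A} (proj₁ (slice-elim {X = ⊥} {A} (up-slice {X = ⊥} {U} {A} uA))) d)
      (λ i a → cliques-avoiding k r F (A [ i ]≔ false) (∧-intro (disj-del A T i d) (up-del {X = ⊥} {U} {A} uA i a)))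
    where
    U = upI k ⊥ r (co k ⊥ F)
    d = proj₁ (∧-true {disj A T} p)
    uA : up (r + k) ⊥ U A ≡ true
    uA = proj₂ (∧-true {disj A T} p)

-- Here D = C(q,l), D′ = C(q,r+l), c = C(q+1,k), c′ = C(q+1,k+r) and m = q + 1. The family has `g`
-- members off T, misses `h` sets off T and `b` sets that meet T; `Ki` and `Kg` count the cliques
-- off T and across T.
stability-arithmetic : ∀ l m r g x h D a c c′ D′ Ki Kg → let k = suc l ; b = g + x in
  D ≡ a + b → m * D ≡ k * c → m * D′ ≡ (r + k) * c′ → c ≡ g + h →
  Ki * (k * c + r * g) ≤ c′ * (h * k) → Kg * (l * D + r * a) ≤ D′ * (b * l) → c′ ≤ Ki + Kg →
  1 ≤ c′ → 1 ≤ D → 1 ≤ m → 5 * b ≤ 3 * D → 3 * l ≤ m → r ≤ k →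
  r * b ≤ 10 * (k * x)
stability-arithmetic l m r g x h D a c c′ D′ Ki Kg D≡ mD mD′ c≡ hi hg hc 1≤c′ 1≤D 1≤m 5b 3l r≤k = final
  where
  open ≤-Reasoning
  k = suc l
  b = g + x
  V = k * c + r * g
  W = l * D + r * a
  -- This is 1 ≤ Ki / c′ + Kg / c′ with denominators cleared. Off T the fraction is at most h k / V
  -- = 1 - (r + k) g / V.
  s₁ : m * (h * k) * W + m * ((r + k) * g) * W ≤ m * (h * k) * W + (r + k) * (b * l) * V
  s₁ = *-cancelˡ-≤ c′ {{>-nonZero 1≤c′}} (begin
    c′ * (m * (h * k) * W + m * ((r + k) * g) * W)   ≡⟨ cong (c′ *_) (trans (p₁ m h k W r g) (cong (λ z → m * (k * z + r * g) * W) (sym c≡))) ⟩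
    c′ * (m * V * W)                                 ≡⟨ p₂ c′ m V W ⟩
    m * (c′ * (V * W))                               ≤⟨ *-monoʳ-≤ m (*-monoˡ-≤ (V * W) hc) ⟩
    m * ((Ki + Kg) * (V * W))                        ≡⟨ p₃ m Ki Kg V W ⟩
    m * (Ki * V * W) + m * (Kg * W * V)              ≤⟨ +-mono-≤ (*-monoʳ-≤ m (*-monoˡ-≤ W hi)) (*-monoʳ-≤ m (*-monoˡ-≤ V hg)) ⟩
    m * (c′ * (h * k) * W) + m * (D′ * (b * l) * V)  ≡⟨ p₄ m c′ (h * k) W D′ (b * l) V ⟩
    c′ * (m * (h * k) * W) + m * D′ * ((b * l) * V)  ≡⟨ cong (λ z → c′ * (m * (h * k) * W) + z * ((b * l) * V)) mD′ ⟩
    c′ * (m * (h * k) * W) + (r + k) * c′ * ((b * l) * V) ≡⟨ p₅ c′ (m * (h * k) * W) (r + k) (b * l) V ⟩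
    c′ * (m * (h * k) * W + (r + k) * (b * l) * V)   ∎)
    where
    p₁ : ∀ m h k W r g → m * (h * k) * W + m * ((r + k) * g) * W ≡ m * (k * (g + h) + r * g) * W
    p₁ = solve-∀
    p₂ : ∀ c m V W → c * (m * V * W) ≡ m * (c * (V * W))
    p₂ = solve-∀
    p₃ : ∀ m i j V W → m * ((i + j) * (V * W)) ≡ m * (i * V * W) + m * (j * W * V)
    p₃ = solve-∀
    p₄ : ∀ m c y W D z V → m * (c * y * W) + m * (D * z * V) ≡ c * (m * y * W) + m * D * (z * V)
    p₄ = solve-∀
    p₅ : ∀ c y s z V → c * y + s * c * (z * V) ≡ c * (y + s * z * V)
    p₅ = solve-∀
  s₂ : m * g * W ≤ b * l * V
  s₂ = *-cancelˡ-≤ (r + k) {{>-nonZero (≤-trans (s≤s z≤n) (m≤n+m k r))}} (begin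
    (r + k) * (m * g * W)       ≡⟨ p (r + k) m g W ⟩
    m * ((r + k) * g) * W       ≤⟨ +-cancelˡ-≤ (m * (h * k) * W) _ _ s₁ ⟩
    (r + k) * (b * l) * V       ≡⟨ *-assoc (r + k) (b * l) V ⟩
    (r + k) * (b * l * V)       ∎)
    where
    p : ∀ s m g W → s * (m * g * W) ≡ m * (s * g) * W
    p = solve-∀
  -- After inserting b = g + x the leading term b l m D occurs on both sides and cancels.
  s₃ : m * b * (r * a) ≤ b * l * (r * g) + m * x * W
  s₃ = +-cancelˡ-≤ (b * l * (m * D)) _ _ (begin
    b * l * (m * D) + m * b * (r * a)               ≡⟨ p₁ g x l m D r a ⟩
    m * g * W + m * x * W                           ≤⟨ +-monoˡ-≤ (m * x * W) s₂ ⟩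
    b * l * (k * c + r * g) + m * x * W             ≡⟨ cong (λ z → b * l * (z + r * g) + m * x * W) (sym mD) ⟩
    b * l * (m * D + r * g) + m * x * W             ≡⟨ p₂ (b * l) (m * D) (r * g) (m * x * W) ⟩
    b * l * (m * D) + (b * l * (r * g) + m * x * W) ∎)
    where
    p₁ : ∀ g x l m D r a → (g + x) * l * (m * D) + m * (g + x) * (r * a) ≡ m * g * (l * D + r * a) + m * x * (l * D + r * a)
    p₁ = solve-∀
    p₂ : ∀ y M z w → y * (M + z) + w ≡ y * M + (y * z + w)
    p₂ = solve-∀
  a≤D : a ≤ D
  a≤D = ≤-trans (m≤m+n a b) (≤-reflexive (sym D≡))
  W≤ : W ≤ 2 * (k * D)
  W≤ = ≤-trans (+-mono-≤ (*-monoˡ-≤ D (n≤1+n l)) (*-mono-≤ r≤k a≤D)) (≤-reflexive (cong (k * D +_) (sym (+-identityʳ (k * D)))))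
  2b≤3a : 2 * b ≤ 3 * a
  2b≤3a = +-cancelʳ-≤ (3 * b) _ _ (≤-trans (≤-reflexive (p₁ b)) (≤-trans 5b (≤-reflexive (trans (cong (3 *_) D≡) (*-distribˡ-+ 3 a b)))))
    where
    p₁ : ∀ b → 2 * b + 3 * b ≡ 5 * b
    p₁ = solve-∀
  -- Here 3/5 and 3 l ≤ m combine: half of m b r a now absorbs the quadratic term b l r b.
  2lb≤ma : 2 * (l * b) ≤ m * a
  2lb≤ma = *-cancelˡ-≤ 3 (begin
    3 * (2 * (l * b))   ≡⟨ p₁ l b ⟩
    3 * l * (2 * b)     ≤⟨ *-mono-≤ 3l 2b≤3a ⟩
    m * (3 * a)         ≡⟨ p₂ m a ⟩
    3 * (m * a)         ∎)
    where
    p₁ : ∀ l b → 3 * (2 * (l * b)) ≡ 3 * l * (2 * b)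
    p₁ = solve-∀
    p₂ : ∀ m a → m * (3 * a) ≡ 3 * (m * a)
    p₂ = solve-∀
  2D≤5a : 2 * D ≤ 5 * a
  2D≤5a = ≤-trans (≤-reflexive (trans (cong (2 *_) D≡) (*-distribˡ-+ 2 a b))) (≤-trans (+-monoʳ-≤ (2 * a) 2b≤3a) (≤-reflexive (p₁ a)))
    where
    p₁ : ∀ a → 2 * a + 3 * a ≡ 5 * a
    p₁ = solve-∀
  s₄ : r * b * a ≤ 4 * (k * x * D)
  s₄ = *-cancelˡ-≤ m {{>-nonZero 1≤m}} (+-cancelˡ-≤ (r * b * (m * a)) _ _ (begin
    r * b * (m * a) + m * (r * b * a)                      ≡⟨ p₁ r b m a ⟩
    2 * (m * b * (r * a))                                  ≤⟨ *-monoʳ-≤ 2 s₃ ⟩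
    2 * (b * l * (r * g) + m * x * W)                      ≤⟨ *-monoʳ-≤ 2 (+-mono-≤ (*-monoʳ-≤ (b * l) (*-monoʳ-≤ r (m≤m+n g x))) (*-monoʳ-≤ (m * x) W≤)) ⟩
    2 * (b * l * (r * b) + m * x * (2 * (k * D)))          ≡⟨ p₂ b l r m x k D ⟩
    r * b * (2 * (l * b)) + m * (4 * (k * x * D))          ≤⟨ +-monoˡ-≤ _ (*-monoʳ-≤ (r * b) 2lb≤ma) ⟩
    r * b * (m * a) + m * (4 * (k * x * D))                ∎))
    where
    p₁ : ∀ r b m a → r * b * (m * a) + m * (r * b * a) ≡ 2 * (m * b * (r * a))
    p₁ = solve-∀
    p₂ : ∀ b l r m x k D → 2 * (b * l * (r * b) + m * x * (2 * (k * D))) ≡ r * b * (2 * (l * b)) + m * (4 * (k * x * D))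
    p₂ = solve-∀
  1≤a : 1 ≤ a
  1≤a = pos a (≤-trans 1≤D (≤-trans (m≤m+n D (D + 0)) 2D≤5a))
    where
    pos : ∀ a → 1 ≤ 5 * a → 1 ≤ a
    pos (suc a) _ = s≤s z≤n
  final : r * b ≤ 10 * (k * x)
  final = *-cancelʳ-≤ (r * b) (10 * (k * x)) a {{>-nonZero 1≤a}} (begin
    r * b * a                ≤⟨ s₄ ⟩
    4 * (k * x * D)          ≡⟨ p₁ (k * x) D ⟩
    2 * (k * x) * (2 * D)    ≤⟨ *-monoʳ-≤ (2 * (k * x)) 2D≤5a ⟩
    2 * (k * x) * (5 * a)    ≡⟨ p₂ (k * x) a ⟩
    10 * (k * x) * a         ∎)
    where
    p₁ : ∀ y D → 4 * (y * D) ≡ 2 * y * (2 * D)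
    p₁ = solve-∀
    p₂ : ∀ y a → 2 * y * (5 * a) ≡ 10 * y * a
    p₂ = solve-∀

-- Here x is the amount by which F falls short of the extremal size.  The (k+r)-cliques of the
-- complement of F are the (k+r)-sets without a member of F.  By emc there are at least as many of
-- them as in the complement of a star, which forces F towards the star once it is close enough.
local-stability : ∀ q t l r (F : Family (q + suc t)) T x → 1 ≤ t → 1 ≤ l → r ≤ suc l → (2 * t + 1) * (r + l) ≤ q →
  IsKUniform (suc l) F → ¬ Matching (suc t) F → ∣ ∁ T ∣ ≡ suc q →
  cnt F + (suc q C suc l) + x ≡ (q + suc t) C suc l →
  5 * cnt (missing (suc l) F T) ≤ 3 * (q C l) →
  r * cnt (missing (suc l) F T) ≤ 10 * (suc l * x)
local-stability q t l r F T x 1≤t 1≤l r≤k room u nm ∣T∣ excess small =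
  subst (λ z → r * z ≤ 10 * (k * x)) (sym b≡)
    (stability-arithmetic l (suc q) r g x h D (D ∸ b) (suc q C k) (suc q C (r + k)) (q C (r + l)) Ki Kg
      (trans (sym (m∸n+n≡m b≤D)) (cong (D ∸ b +_) b≡))
      (sym (absorb q l))
      (trans (sym (absorb q (r + l))) (cong (λ z → z * (suc q C z)) (sym (+-suc r l))))
      (trans (cong (_C k) (sym ∣T∣)) (sym (cnt-co k T inner (avoid-slice T u))))
      inside outside total
      (C-pos (suc q) (r + k) (≤-trans (≤-reflexive (+-suc r l)) (s≤s r+l≤q)))
      (C-pos q l (≤-trans (m≤n+m l r) r+l≤q)) (s≤s z≤n)
      (subst (λ z → 5 * z ≤ 3 * D) b≡ small)
      3l≤m r≤k)
  where
  open ≤-Reasoning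
  k = suc l
  D = q C l
  inner = λ A → F A ∧ disj A T
  g = cnt inner
  H = co k T inner
  h = cnt H
  G = co k ⊥ F
  b = cnt (missing k F T)
  K = upI k ⊥ r G
  Ki = cnt (λ A → disj A T ∧ K A)
  Kg = cnt (λ A → not (disj A T) ∧ K A)
  b≡ : b ≡ g + x
  b≡ = balance k F T x u (subst (λ z → cnt F + (z C k) + x ≡ (q + suc t) C k) (sym ∣T∣) excess)
  b≤D : b ≤ D
  b≤D = *-cancelˡ-≤ 5 (≤-trans small (*-monoˡ-≤ D (m≤m+n 3 2)))
  r+l≤q : r + l ≤ q
  r+l≤q = ≤-trans (≤-trans (≤-reflexive (sym (*-identityˡ (r + l)))) (*-monoˡ-≤ (r + l) (m≤n+m 1 (2 * t)))) room
  -- Since t ≥ 1, the factor 2 t + 1 is at least 3.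
  3l≤m : 3 * l ≤ suc q
  3l≤m = begin
    3 * l                  ≤⟨ *-mono-≤ (+-monoˡ-≤ 1 (*-monoʳ-≤ 2 1≤t)) (m≤n+m l r) ⟩
    (2 * t + 1) * (r + l)  ≤⟨ room ⟩
    q                      ≤⟨ n≤1+n q ⟩
    suc q                  ∎
  inside : Ki * (k * (suc q C k) + r * g) ≤ (suc q C (r + k)) * (h * k)
  inside = ≤-trans (*-monoˡ-≤ (k * (suc q C k) + r * g) (cnt-mono (cliques-avoiding T k r F)))
    (cliques k (suc q) g r T H (s≤s z≤n) (slice-uniform {X = T} (co-slice k T inner))
      (≤-reflexive (trans (+-comm h g) (trans (cnt-co k T inner (avoid-slice T u)) (cong (_C k) ∣T∣)))))
  outside : Kg * (l * D + r * (D ∸ b)) ≤ (q C (r + l)) * ((g + x) * l)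
  outside = subst (λ z → Kg * (l * D + r * (D ∸ b)) ≤ (q C (r + l)) * (z * l)) b≡
    (cliques-meeting T l q r G 1≤l (slice-uniform {X = ⊥} (co-slice k ⊥ F)) b≤D)
  split : cnt K ≡ Ki + Kg
  split = trans (∑-cong pw) (∑-+ (λ A → ⟦ disj A T ∧ K A ⟧) (λ A → ⟦ not (disj A T) ∧ K A ⟧))
    where
    pw : ∀ A → ⟦ K A ⟧ ≡ ⟦ disj A T ∧ K A ⟧ + ⟦ not (disj A T) ∧ K A ⟧
    pw A with disj A T
    ... | true  = sym (+-identityʳ ⟦ K A ⟧)
    ... | false = refl
  total : suc q C (r + k) ≤ Ki + Kg
  total = +-cancelˡ-≤ (cnt (ushI k ⊥ r F)) _ _ (begin
    cnt (ushI k ⊥ r F) + (suc q C (r + k))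
      ≤⟨ emc′ (r + k) (+-suc r l) (slice-uniform {X = ⊥} (ushI-slice k ⊥ r F (uniform-slice u))) ⟩
    (q + suc t) C (r + k)
      ≤⟨ subst (λ y → y C (r + k) ≤ cnt (ushI k ⊥ r F) + cnt K) (∣∁⊥∣ (q + suc t)) (ushI-upI k ⊥ r F (uniform-slice u)) ⟩
    cnt (ushI k ⊥ r F) + cnt K
      ≡⟨ cong (cnt (ushI k ⊥ r F) +_) split ⟩
    cnt (ushI k ⊥ r F) + (Ki + Kg) ∎)
    where
    emc′ : ∀ κ → κ ≡ suc (r + l) → IsKUniform κ (ushI k ⊥ r F) →
      cnt (ushI k ⊥ r F) + (suc q C κ) ≤ (q + suc t) C κ
    emc′ κ refl u′ = emc q t (r + l) (ushI k ⊥ r F) u′ (λ m → nm (ushI-sdr k ⊥ r (λ _ → F) m)) room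

-- `φ` and `φ⁺` are the sizes of the smallest trace and of its upper shadow, `S` and `S⁺` the totals
-- for the other traces. The average at level l is tight up to x, and the one at level r + l still
-- holds. As the other traces do not lose density, that of the smallest grows by at most x / ((t +
-- 1) D), and the expansion bound makes `φ` small.
base-arithmetic : ∀ t l r x D D⁺ φ φ⁺ S S⁺ →
  t * D ≤ x + (t * φ + (φ + S)) → φ⁺ + S⁺ + t * φ⁺ ≤ t * D⁺ → D⁺ * S ≤ D * S⁺ →
  D⁺ * ((r + l) * φ) ≤ φ⁺ * (l * D + r * φ) → 2 * φ ≤ D → 1 ≤ D⁺ → 1 ≤ D → 1 ≤ r → r ≤ suc l →
  1000 * (suc l * x) ≤ r * D → 250 * (suc t * φ) ≤ D
base-arithmetic t l r x D D⁺ φ φ⁺ S S⁺ deficit cross lym expand 2φ≤D 1≤D⁺ 1≤D 1≤r r≤k small = final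
  where
  open ≤-Reasoning
  P = suc t * φ
  V = l * D + r * φ
  s₁ : suc t * (D * φ⁺) ≤ D⁺ * (x + P)
  s₁ = +-cancelʳ-≤ (D⁺ * S) _ _ (begin
    suc t * (D * φ⁺) + D⁺ * S        ≤⟨ +-monoʳ-≤ (suc t * (D * φ⁺)) lym ⟩
    suc t * (D * φ⁺) + D * S⁺        ≡⟨ p₁ t D φ⁺ S⁺ ⟩
    D * (φ⁺ + S⁺ + t * φ⁺)           ≤⟨ *-monoʳ-≤ D cross ⟩
    D * (t * D⁺)                     ≡⟨ p₂ D t D⁺ ⟩
    D⁺ * (t * D)                     ≤⟨ *-monoʳ-≤ D⁺ deficit ⟩
    D⁺ * (x + (t * φ + (φ + S)))     ≡⟨ p₃ D⁺ x t φ S ⟩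
    D⁺ * (x + suc t * φ) + D⁺ * S    ∎)
    where
    p₁ : ∀ t D φ S → (1 + t) * (D * φ) + D * S ≡ D * (φ + S + t * φ)
    p₁ = solve-∀
    p₂ : ∀ D t E → D * (t * E) ≡ E * (t * D)
    p₂ = solve-∀
    p₃ : ∀ D x t φ S → D * (x + (t * φ + (φ + S))) ≡ D * (x + (1 + t) * φ) + D * S
    p₃ = solve-∀
  s₂ : P * ((r + l) * D) ≤ (x + P) * V
  s₂ = *-cancelˡ-≤ D⁺ {{>-nonZero 1≤D⁺}} (begin
    D⁺ * (P * ((r + l) * D))                ≡⟨ p₁ D⁺ t φ (r + l) D ⟩
    suc t * D * (D⁺ * ((r + l) * φ))        ≤⟨ *-monoʳ-≤ (suc t * D) expand ⟩
    suc t * D * (φ⁺ * V)                    ≡⟨ p₂ t D φ⁺ V ⟩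
    suc t * (D * φ⁺) * V                    ≤⟨ *-monoˡ-≤ V s₁ ⟩
    D⁺ * (x + P) * V                        ≡⟨ *-assoc D⁺ (x + P) V ⟩
    D⁺ * ((x + P) * V)                      ∎)
    where
    p₁ : ∀ E t φ s D → E * ((1 + t) * φ * (s * D)) ≡ (1 + t) * D * (E * (s * φ))
    p₁ = solve-∀
    p₂ : ∀ t D φ V → (1 + t) * D * (φ * V) ≡ (1 + t) * (D * φ) * V
    p₂ = solve-∀
  s₃ : P * (r * D) ≤ x * V + P * (r * φ)
  s₃ = +-cancelˡ-≤ (P * (l * D)) _ _ (begin
    P * (l * D) + P * (r * D)                  ≡⟨ p₁ P l D r ⟩
    P * ((r + l) * D)                          ≤⟨ s₂ ⟩
    (x + P) * V                                ≡⟨ p₂ x P (l * D) (r * φ) ⟩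
    P * (l * D) + (x * V + P * (r * φ))        ∎)
    where
    p₁ : ∀ P l D r → P * (l * D) + P * (r * D) ≡ P * ((r + l) * D)
    p₁ = solve-∀
    p₂ : ∀ x P a b → (x + P) * (a + b) ≡ P * a + (x * (a + b) + P * b)
    p₂ = solve-∀
  V≤ : V ≤ 2 * (suc l * D)
  V≤ = ≤-trans (+-mono-≤ (*-monoˡ-≤ D (n≤1+n l)) (*-mono-≤ r≤k (≤-trans (m≤m+n φ (φ + 0)) 2φ≤D)))
    (≤-reflexive (cong (suc l * D +_) (sym (+-identityʳ (suc l * D)))))
  -- Because 2 φ ≤ D, half of P r D absorbs P r φ.
  s₄ : P * r ≤ 4 * (suc l * x)
  s₄ = *-cancelʳ-≤ (P * r) (4 * (suc l * x)) D {{>-nonZero 1≤D}} (+-cancelʳ-≤ (P * (r * D)) _ _ (begin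
    P * r * D + P * (r * D)                    ≡⟨ p₁ P r D ⟩
    2 * (P * (r * D))                          ≤⟨ *-monoʳ-≤ 2 s₃ ⟩
    2 * (x * V + P * (r * φ))                  ≡⟨ p₂ x V P r φ ⟩
    2 * (x * V) + P * (r * (2 * φ))            ≤⟨ +-mono-≤ (*-monoʳ-≤ 2 (*-monoʳ-≤ x V≤)) (*-monoʳ-≤ P (*-monoʳ-≤ r 2φ≤D)) ⟩
    2 * (x * (2 * (suc l * D))) + P * (r * D)  ≡⟨ cong (_+ P * (r * D)) (p₃ x (suc l) D) ⟩
    4 * (suc l * x) * D + P * (r * D)          ∎))
    where
    p₁ : ∀ P r D → P * r * D + P * (r * D) ≡ 2 * (P * (r * D))
    p₁ = solve-∀
    p₂ : ∀ x V P r φ → 2 * (x * V + P * (r * φ)) ≡ 2 * (x * V) + P * (r * (2 * φ))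
    p₂ = solve-∀
    p₃ : ∀ x k D → 2 * (x * (2 * (k * D))) ≡ 4 * (k * x) * D
    p₃ = solve-∀
  final : 250 * P ≤ D
  final = *-cancelˡ-≤ r {{>-nonZero 1≤r}} (begin
    r * (250 * P)          ≡⟨ p₁ r P ⟩
    250 * (P * r)          ≤⟨ *-monoʳ-≤ 250 s₄ ⟩
    250 * (4 * (suc l * x)) ≡⟨ p₂ (suc l * x) ⟩
    1000 * (suc l * x)     ≤⟨ small ⟩
    r * D                  ∎)
    where
    p₁ : ∀ r P → r * (250 * P) ≡ 250 * (P * r)
    p₁ = solve-∀
    p₂ : ∀ y → 250 * (4 * y) ≡ 1000 * y
    p₂ = solve-∀

module Shifted-close {q t l} (F : Family (q + suc t)) (sh : Shifted F) (u : IsKUniform (suc l) F)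
  (nm : ¬ Matching (suc t) F) where

  open Shifted-family {q} {t} {l} F sh u nm

  T₀ : Subset (q + suc t)
  T₀ = top q (false ∷ ⊤ {t})

  ∣∁T₀∣ : ∣ ∁ T₀ ∣ ≡ suc q
  ∣∁T₀∣ = trans (∣∁top∣ q (false ∷ ⊤ {t})) (trans (+-suc q _) (cong suc (trans (cong (q +_) (∣∁⊤∣ t)) (+-identityʳ q))))

  -- A member that avoids `T₀` either avoids `X` or meets it in `x zero` alone.
  avoid-T₀ : cnt (λ A → F A ∧ disj A T₀) ≤ suc t * cnt (T zero)
  avoid-T₀ = begin
    cnt (λ A → F A ∧ disj A T₀)
      ≤⟨ ∑-mono (λ A → pw A (F A)) ⟩
    ∑ (λ A → ⟦ lookup A (x zero) ⟧ * (⟦ disj (A [ x zero ]≔ false) X ⟧ * ⟦ F A ⟧) + ⟦ F A ∧ disj A X ⟧)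
      ≡⟨ ∑-+ (λ A → ⟦ lookup A (x zero) ⟧ * (⟦ disj (A [ x zero ]≔ false) X ⟧ * ⟦ F A ⟧)) (λ A → ⟦ F A ∧ disj A X ⟧) ⟩
    ∑ (λ A → ⟦ lookup A (x zero) ⟧ * (⟦ disj (A [ x zero ]≔ false) X ⟧ * ⟦ F A ⟧)) + cnt outside-X
      ≡⟨ cong (_+ cnt outside-X) (cnt-trace X (x zero) F (x∈X zero)) ⟩
    cnt (T zero) + cnt outside-X
      ≤⟨ +-monoʳ-≤ (cnt (T zero)) outside-bound ⟩
    suc t * cnt (T zero) ∎
    where
    open ≤-Reasoning
    cover : ∀ {s} q (A : Subset (q + suc s)) → disj A (top q (false ∷ ⊤ {s})) ≡ true →
      ⟦ true ⟧ ≤ ⟦ lookup A (q ↑ʳ zero) ⟧ * ⟦ disj (A [ q ↑ʳ zero ]≔ false) (top q ⊤) ⟧ + ⟦ disj A (top q ⊤) ⟧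
    cover zero    (true ∷ A)  d rewrite d = ≤-refl
    cover zero    (false ∷ A) d rewrite d = ≤-refl
    cover (suc q) (true ∷ A)  d = cover q A d
    cover (suc q) (false ∷ A) d = cover q A d
    pw : ∀ A b → ⟦ b ∧ disj A T₀ ⟧ ≤ ⟦ lookup A (x zero) ⟧ * (⟦ disj (A [ x zero ]≔ false) X ⟧ * ⟦ b ⟧) + ⟦ b ∧ disj A X ⟧
    pw A false = z≤n
    pw A true with disj A T₀ in d
    ... | false = z≤n
    ... | true  = ≤-trans (cover q A d) (≤-reflexive (cong (λ z → ⟦ lookup A (x zero) ⟧ * z + ⟦ disj A X ⟧) (sym (*-identityʳ _))))

  base-close : ∀ r x → 1 ≤ t → 1 ≤ l → 1 ≤ r → r ≤ suc l → (2 * t + 1) * (r + l) ≤ q →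
    cnt F + (suc q C suc l) + x ≡ (q + suc t) C suc l → 1000 * (suc l * x) ≤ r * (q C l) →
    250 * cnt (λ A → F A ∧ disj A T₀) ≤ q C l
  base-close r z 1≤t 1≤l 1≤r r≤k room excess small = ≤-trans (*-monoʳ-≤ 250 avoid-T₀)
    (base-arithmetic t l r z D D⁺ φ φ⁺ S S⁺ deficit cross⁺ lym expand 2φ≤D (C-pos q (r + l) r+l≤q) (C-pos q l (≤-trans (m≤n+m l r) r+l≤q)) 1≤r r≤k small)
    where
    open ≤-Reasoning
    D = q C l
    D⁺ = q C (r + l)
    T⁺ : Fin (suc t) → Family (q + suc t)
    T⁺ j = ushI l X r (T j)
    φ = cnt (T zero)
    φ⁺ = cnt (T⁺ zero)
    S = ⨁ (λ j → cnt (T (suc j)))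
    S⁺ = ⨁ (λ j → cnt (T⁺ (suc j)))
    r+l≤q : r + l ≤ q
    r+l≤q = ≤-trans (≤-trans (≤-reflexive (sym (*-identityˡ (r + l)))) (*-monoˡ-≤ (r + l) (m≤n+m 1 (2 * t)))) room
    deficit : t * D ≤ z + (t * φ + (φ + S))
    deficit = +-cancelˡ-≤ (cnt F + (D + (q C suc l))) _ _ (begin
      cnt F + (D + (q C suc l)) + t * D                 ≡⟨ e₁ (cnt F) D (q C suc l) t ⟩
      cnt F + ((q C suc l) + suc t * D)                 ≤⟨ trace-sum ⟩
      ((q + suc t) C suc l) + (cnt outside-X + (φ + S)) ≤⟨ +-mono-≤ (≤-reflexive (sym excess)) (+-monoˡ-≤ (φ + S) outside-bound) ⟩
      cnt F + (suc q C suc l) + z + (t * φ + (φ + S))   ≡⟨ cong (λ y → cnt F + y + z + (t * φ + (φ + S))) (sym (nCk+nC[k+1]≡[n+1]C[k+1] q l)) ⟩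
      cnt F + (D + (q C suc l)) + z + (t * φ + (φ + S)) ≡⟨ +-assoc (cnt F + (D + (q C suc l))) z _ ⟩
      cnt F + (D + (q C suc l)) + (z + (t * φ + (φ + S))) ∎)
      where
      e₁ : ∀ f D c t → f + (D + c) + t * D ≡ f + (c + (1 + t) * D)
      e₁ = solve-∀
    cross⁺ : φ⁺ + S⁺ + t * φ⁺ ≤ t * D⁺
    cross⁺ = subst (λ y → φ⁺ + S⁺ + t * φ⁺ ≤ t * (y C (r + l))) ∣∁X∣
      (cross-dependent t (r + l) X T⁺ (λ j → ushI-slice l X r (T j) (T-slice j))
        (λ i j le → ushI-mono l X r (T-nested i j le)) (λ R → T-sdr (ushI-sdr l X r T R))
        (subst ((2 * t + 1) * (r + l) ≤_) (sym ∣∁X∣) room))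
    cross : φ + S + t * φ ≤ t * D
    cross = subst (λ y → φ + S + t * φ ≤ t * (y C l)) ∣∁X∣
      (cross-dependent t l X T T-slice T-nested T-sdr
        (subst ((2 * t + 1) * l ≤_) (sym ∣∁X∣) (≤-trans (*-monoʳ-≤ (2 * t + 1) (m≤n+m l r)) room)))
    lym : D⁺ * S ≤ D * S⁺
    lym = subst₂ _≤_ (⨁-*ˡ D⁺ (λ j → cnt (T (suc j)))) (⨁-*ˡ D (λ j → cnt (T⁺ (suc j))))
      (⨁-mono (λ j → subst (λ y → (y C (r + l)) * cnt (T (suc j)) ≤ (y C l) * cnt (T⁺ (suc j))) ∣∁X∣
        (local-lym l X r (T (suc j)) 1≤l (T-slice (suc j)))))
    expand : D⁺ * ((r + l) * φ) ≤ φ⁺ * (l * D + r * φ)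
    expand = subst (λ y → (y C (r + l)) * ((r + l) * φ) ≤ φ⁺ * (l * (y C l) + r * φ)) ∣∁X∣
      (shadow-expansion l X r (T zero) 1≤l (T-slice zero))
    -- The other t traces contain the smallest one, so the average at level l counts it at least 2 t
    -- times.
    2φ≤D : 2 * φ ≤ D
    2φ≤D = *-cancelˡ-≤ t {{>-nonZero 1≤t}} (begin
      t * (2 * φ)       ≡⟨ e₂ t φ ⟩
      t * φ + t * φ     ≤⟨ +-monoˡ-≤ (t * φ) (≤-trans (≤-reflexive (sym (⨁-const {t} φ)))
                             (≤-trans (⨁-mono (λ j → cnt-mono (T-nested zero (suc j) z≤n))) (m≤n+m S φ))) ⟩
      φ + S + t * φ     ≤⟨ cross ⟩
      t * D             ∎)
      where
      e₂ : ∀ t φ → t * (2 * φ) ≡ t * φ + t * φ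
      e₂ = solve-∀

-- Undoing a shift

moved : ∀ {n} → ℕ → ℕ → Subset n → Family n
moved k i T A = size k A ∧ (not (disj A T) ∧ disj (τ i A) T)

disj-full : ∀ {n} (A T : Subset n) → ∣ ∁ T ∣ ≡ 0 → disj A T ≡ true → ∣ A ∣ ≡ 0
disj-full []          []         e d = refl
disj-full (true ∷ A)  (true ∷ T) e ()
disj-full (false ∷ A) (true ∷ T) e d = disj-full A T e d

disj-empty : ∀ {n} (A T : Subset n) → ∣ A ∣ ≡ 0 → disj A T ≡ true
disj-empty A T e = disj-intro A T (λ i a → true≢false a (∣∣≡0⇒∉ A e i))

moved-elim : ∀ {n} k i (T A : Subset n) → moved k i T A ≡ true →
  ∣ A ∣ ≡ k × disj A T ≡ false × disj (τ i A) T ≡ true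
moved-elim k i T A p =
  let a , b = ∧-true {size k A} p
      c , d = ∧-true {not (disj A T)} b
  in ≡ᵇ-true ∣ A ∣ k a , not-true c , d

cnt-none : ∀ {n} (F : Family n) → (∀ A → F A ≡ true → F A ≡ false) → cnt F ≡ 0
cnt-none F h = ∉⇒cnt≡0 F λ A → out A (F A) refl
  where
  out : ∀ A b → F A ≡ b → b ≡ false
  out A false e = refl
  out A true  e = trans (sym e) (h A e)

moved-0 : ∀ {n} i (T : Subset n) → cnt (moved 0 i T) ≡ 0
moved-0 i T = cnt-none (moved 0 i T) λ A p → let e , d , _ = moved-elim 0 i T A p in true≢false (disj-empty A T e) d

moved-full : ∀ {n} k i (T : Subset n) → ∣ ∁ T ∣ ≡ 0 → cnt (moved k i T) ≡ 0
moved-full k i T f = cnt-none (moved k i T) λ A p →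
  let _ , d , d′ = moved-elim k i T A p
  in true≢false (disj-empty A T (trans (sym (∣τ∣ i A)) (disj-full (τ i A) T f d′))) d

-- Such sets exist only if `T` contains exactly one of the points i and i + 1. They contain that
-- point and avoid the other and the rest of `T`, which leaves l points to choose from q.
cnt-moved : ∀ {n} l i (T : Subset n) q → ∣ ∁ T ∣ ≡ suc q → cnt (moved (suc l) i T) ≤ q C l
cnt-moved {suc zero} l zero (a ∷ []) q e = ≤-trans (≤-reflexive (cnt-none (moved (suc l) 0 (a ∷ [])) λ { (b ∷ []) p →
  let _ , d , d′ = moved-elim (suc l) 0 (a ∷ []) (b ∷ []) p in true≢false d′ d })) z≤n
cnt-moved {suc (suc n)} l zero (a ∷ b ∷ T) q e = go a b e
  where
  ∧-false : ∀ x {y} → x ∧ (not y ∧ y) ≡ false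
  ∧-false true  {true}  = refl
  ∧-false true  {false} = refl
  ∧-false false = refl
  ∧-false′ : ∀ x → x ∧ false ≡ false
  ∧-false′ true  = refl
  ∧-false′ false = refl
  ∧-false″ : ∀ x {y} → x ∧ (y ∧ false) ≡ false
  ∧-false″ true  {true}  = refl
  ∧-false″ true  {false} = refl
  ∧-false″ false = refl
  nil : ∀ (F : Family n) → (∀ A → F A ≡ false) → cnt F ≡ 0
  nil = ∉⇒cnt≡0
  go : ∀ a b → ∣ ∁ (a ∷ b ∷ T) ∣ ≡ suc q → cnt (moved (suc l) 0 (a ∷ b ∷ T)) ≤ q C l
  go true true e = ≤-reflexive′ (cong₂ _+_
      (cong₂ _+_ (nil (λ A → moved (suc l) 0 (true ∷ true ∷ T) (true ∷ true ∷ A)) (λ A → ∧-false″ (size (suc l) (true ∷ true ∷ A)) {true}))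
                 (nil (λ A → moved (suc l) 0 (true ∷ true ∷ T) (true ∷ false ∷ A)) (λ A → ∧-false″ (size (suc l) (true ∷ false ∷ A)) {true})))
      (cong₂ _+_ (nil (λ A → moved (suc l) 0 (true ∷ true ∷ T) (false ∷ true ∷ A)) (λ A → ∧-false″ (size (suc l) (false ∷ true ∷ A)) {true}))
                 (nil (λ A → moved (suc l) 0 (true ∷ true ∷ T) (false ∷ false ∷ A)) (λ A → ∧-false (size (suc l) A) {disj A T}))))
    where
    ≤-reflexive′ : ∀ {x} → x ≡ 0 → x ≤ q C l
    ≤-reflexive′ refl = z≤n
  go false false e = ≤-reflexive′ (cong₂ _+_
      (cong₂ _+_ (nil (λ A → moved (suc l) 0 (false ∷ false ∷ T) (true ∷ true ∷ A)) (λ A → ∧-false (size (suc l) (true ∷ true ∷ A)) {disj A T}))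
                 (nil (λ A → moved (suc l) 0 (false ∷ false ∷ T) (true ∷ false ∷ A)) (λ A → ∧-false (size (suc l) (true ∷ false ∷ A)) {disj A T})))
      (cong₂ _+_ (nil (λ A → moved (suc l) 0 (false ∷ false ∷ T) (false ∷ true ∷ A)) (λ A → ∧-false (size (suc l) (false ∷ true ∷ A)) {disj A T}))
                 (nil (λ A → moved (suc l) 0 (false ∷ false ∷ T) (false ∷ false ∷ A)) (λ A → ∧-false (size (suc l) A) {disj A T}))))
    where
    ≤-reflexive′ : ∀ {x} → x ≡ 0 → x ≤ q C l
    ≤-reflexive′ refl = z≤n
  go true false e = ≤-reflexive (trans (cong₂ _+_
      (cong₂ _+_ (nil (λ A → moved (suc l) 0 (true ∷ false ∷ T) (true ∷ true ∷ A)) (λ A → ∧-false′ (size (suc l) (true ∷ true ∷ A))))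
                 (trans (cnt-slice l T) (cong (_C l) (suc-injective e))))
      (cong₂ _+_ (nil (λ A → moved (suc l) 0 (true ∷ false ∷ T) (false ∷ true ∷ A)) (λ A → ∧-false″ (size (suc l) (false ∷ true ∷ A)) {not (disj A T)}))
                 (nil (λ A → moved (suc l) 0 (true ∷ false ∷ T) (false ∷ false ∷ A)) (λ A → ∧-false (size (suc l) A) {disj A T}))))
    (+-identityʳ (q C l)))
  go false true e = ≤-reflexive (trans (cong₂ _+_
      (cong₂ _+_ (nil (λ A → moved (suc l) 0 (false ∷ true ∷ T) (true ∷ true ∷ A)) (λ A → ∧-false′ (size (suc l) (true ∷ true ∷ A))))
                 (nil (λ A → moved (suc l) 0 (false ∷ true ∷ T) (true ∷ false ∷ A)) (λ A → ∧-false″ (size (suc l) (true ∷ false ∷ A)) {not (disj A T)})))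
      (cong₂ _+_ (trans (cnt-slice l T) (cong (_C l) (suc-injective e)))
                 (nil (λ A → moved (suc l) 0 (false ∷ true ∷ T) (false ∷ false ∷ A)) (λ A → ∧-false (size (suc l) A) {disj A T}))))
    (+-identityʳ (q C l)))
cnt-moved {suc n} l (suc i) (true ∷ T) q e = ≤-trans
  (≤-reflexive (cong (_+ cnt (moved (suc l) i T)) (cnt-none (λ A → moved (suc l) (suc i) (true ∷ T) (true ∷ A))
    (λ A p → true≢false (proj₂ (proj₂ (moved-elim (suc l) (suc i) (true ∷ T) (true ∷ A) p))) refl))))
  (cnt-moved l i T q e)
cnt-moved {suc n} l (suc i) (false ∷ T) zero e = ≤-trans
  (≤-reflexive (cong₂ _+_ (moved-full l i T (suc-injective e)) (moved-full (suc l) i T (suc-injective e)))) z≤n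
cnt-moved {suc n} zero (suc i) (false ∷ T) (suc q) e =
  ≤-trans (≤-reflexive (cong (_+ cnt (moved 1 i T)) (moved-0 i T))) (cnt-moved 0 i T q (suc-injective e))
cnt-moved {suc n} (suc l) (suc i) (false ∷ T) (suc q) e = ≤-trans
  (+-mono-≤ (cnt-moved l i T q (suc-injective e)) (cnt-moved (suc l) i T q (suc-injective e)))
  (≤-reflexive (nCk+nC[k+1]≡[n+1]C[k+1] q l))

-- The shift preserves the number of members in each pair {A , τ A}, so the two sides differ only on
-- the pairs in which A meets T and τ A does not.
unshift : ∀ {n} k i (F : Family n) T →
  cnt (missing k F T) + cnt (missing k F (τ i T)) ≤ 2 * cnt (missing k (shift i F) T) + cnt (moved k i T)
unshift k i F T = begin
  cnt (missing k F T) + cnt (missing k F (τ i T))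
    ≡⟨ cong (cnt (missing k F T) +_) (sym (∑-τ i (λ A → ⟦ missing k F (τ i T) A ⟧))) ⟩
  cnt (missing k F T) + ∑ (λ A → ⟦ missing k F (τ i T) (τ i A) ⟧)
    ≡⟨ sym (∑-+ (λ A → ⟦ missing k F T A ⟧) (λ A → ⟦ missing k F (τ i T) (τ i A) ⟧)) ⟩
  ∑ (λ A → ⟦ missing k F T A ⟧ + ⟦ missing k F (τ i T) (τ i A) ⟧)
    ≤⟨ ∑-mono pw ⟩
  ∑ (λ A → (⟦ missing k S T A ⟧ + ⟦ missing k S T (τ i A) ⟧) + ⟦ moved k i T A ⟧)
    ≡⟨ ∑-+ (λ A → ⟦ missing k S T A ⟧ + ⟦ missing k S T (τ i A) ⟧) (λ A → ⟦ moved k i T A ⟧) ⟩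
  ∑ (λ A → ⟦ missing k S T A ⟧ + ⟦ missing k S T (τ i A) ⟧) + cnt (moved k i T)
    ≡⟨ cong (_+ cnt (moved k i T)) (∑-pair i (λ A → ⟦ missing k S T A ⟧)) ⟩
  2 * cnt (missing k S T) + cnt (moved k i T) ∎
  where
  open ≤-Reasoning
  S = shift i F
  both : ∀ A → ⟦ not (F A) ⟧ + ⟦ not (F (τ i A)) ⟧ ≡ ⟦ not (S A) ⟧ + ⟦ not (S (τ i A)) ⟧
  both A = +-cancelˡ-≡ (⟦ F A ⟧ + ⟦ F (τ i A) ⟧) _ _ (trans (flip (F A) (F (τ i A)))
    (trans (sym (flip (S A) (S (τ i A)))) (cong (_+ (⟦ not (S A) ⟧ + ⟦ not (S (τ i A)) ⟧)) (shift-pair i F A))))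
    where
    flip : ∀ a b → ⟦ a ⟧ + ⟦ b ⟧ + (⟦ not a ⟧ + ⟦ not b ⟧) ≡ 2
    flip a b = trans (+-interchange ⟦ a ⟧ ⟦ b ⟧ ⟦ not a ⟧ ⟦ not b ⟧) (cong₂ _+_ (⟦⟧+⟦not⟧ a) (⟦⟧+⟦not⟧ b))
  -- If `F` lacks both sets of a pair, so does its shift. This serves the pairs of which only `A`
  -- meets `T`; `moved` pays for the extra 1.
  one : ∀ A → ⟦ not (F A) ⟧ + ⟦ not (F (τ i A)) ⟧ ≤ ⟦ not (S A) ⟧ + 1
  one A with src i A | F A | F (τ i A)
  ... | true  | true  | true  = z≤n
  ... | true  | true  | false = s≤s z≤n
  ... | true  | false | true  = s≤s z≤n
  ... | true  | false | false = ≤-refl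
  ... | false | true  | true  = z≤n
  ... | false | true  | false = ≤-refl
  ... | false | false | true  = ≤-refl
  ... | false | false | false = ≤-refl
  core : ∀ s d d′ f f′ g g′ → ⟦ f ⟧ + ⟦ f′ ⟧ ≡ ⟦ g ⟧ + ⟦ g′ ⟧ → ⟦ f ⟧ + ⟦ f′ ⟧ ≤ ⟦ g ⟧ + 1 →
    ⟦ not d ∧ (s ∧ f) ⟧ + ⟦ not d ∧ (s ∧ f′) ⟧ ≤ (⟦ not d ∧ (s ∧ g) ⟧ + ⟦ not d′ ∧ (s ∧ g′) ⟧) + ⟦ s ∧ (not d ∧ d′) ⟧
  core false true  d′    f f′ g g′ e o = z≤n
  core false false d′    f f′ g g′ e o = z≤n
  core true  true  d′    f f′ g g′ e o = z≤n
  core true  false true  f f′ g g′ e o = ≤-trans o (≤-reflexive (cong (_+ 1) (sym (+-identityʳ ⟦ g ⟧))))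
  core true  false false f f′ g g′ e o = ≤-reflexive (trans e (sym (+-identityʳ _)))
  norm : ∀ G A B → ∣ A ∣ ≡ ∣ B ∣ → co k ⊥ G A ≡ size k B ∧ not (G A)
  norm G A B e rewrite disj-⊥ A | e with ∣ B ∣ ≡ᵇ k
  ... | true  = refl
  ... | false = refl
  pw : ∀ A → ⟦ missing k F T A ⟧ + ⟦ missing k F (τ i T) (τ i A) ⟧ ≤
    (⟦ missing k S T A ⟧ + ⟦ missing k S T (τ i A) ⟧) + ⟦ moved k i T A ⟧
  pw A rewrite norm F A A refl | norm S A A refl | norm F (τ i A) A (∣τ∣ i A) | norm S (τ i A) A (∣τ∣ i A) | disj-τ i A T =
    core (size k A) (disj A T) (disj (τ i A) T) (not (F A)) (not (F (τ i A))) (not (S A)) (not (S (τ i A))) (both A) (one A)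

-- Stability by induction along shifts

∣∁∣-τ : ∀ {n} i (T : Subset n) → ∣ ∁ (τ i T) ∣ ≡ ∣ ∁ T ∣
∣∁∣-τ {n} i T = trans (∣∁p∣≡n∸∣p∣ (τ i T)) (trans (cong (n ∸_) (∣τ∣ i T)) (sym (∣∁p∣≡n∸∣p∣ T)))

-- The claim passes from `shift i F` to `F` undamaged: undoing the shift leaves at most 3/5 of
-- C(q,l) missing, and `local-stability` restores the original bound.
closeness : ∀ q t l r x → 1 ≤ t → 1 ≤ l → 1 ≤ r → r ≤ suc l → (2 * t + 1) * (r + l) ≤ q →
  1000 * (suc l * x) ≤ r * (q C l) →
  (F : Family (q + suc t)) → IsKUniform (suc l) F → ¬ Matching (suc t) F →
  cnt F + (suc q C suc l) + x ≡ (q + suc t) C suc l →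
  Σ (Subset (q + suc t)) λ T → ∣ ∁ T ∣ ≡ suc q × r * cnt (missing (suc l) F T) ≤ 10 * (suc l * x)
closeness q t l r x 1≤t 1≤l 1≤r r≤k room small = shift-induction Claim base step
  where
  open ≤-Reasoning
  k = suc l
  D = q C l
  Claim : Family (q + suc t) → Set
  Claim F = IsKUniform k F → ¬ Matching (suc t) F → cnt F + (suc q C k) + x ≡ (q + suc t) C k →
    Σ (Subset (q + suc t)) λ T → ∣ ∁ T ∣ ≡ suc q × r * cnt (missing k F T) ≤ 10 * (k * x)
  from-half : ∀ F T → IsKUniform k F → ¬ Matching (suc t) F → cnt F + (suc q C k) + x ≡ (q + suc t) C k →
    ∣ ∁ T ∣ ≡ suc q → 5 * cnt (missing k F T) ≤ 3 * D →
    Σ (Subset (q + suc t)) λ T → ∣ ∁ T ∣ ≡ suc q × r * cnt (missing k F T) ≤ 10 * (k * x)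
  from-half F T u nm ex ∣T∣ h = T , ∣T∣ , local-stability q t l r F T x 1≤t 1≤l r≤k room u nm ∣T∣ ex h

  1000x≤D : 1000 * x ≤ D
  1000x≤D = *-cancelˡ-≤ k (begin
    k * (1000 * x)     ≡⟨ e k x ⟩
    1000 * (k * x)     ≤⟨ small ⟩
    r * D              ≤⟨ *-monoˡ-≤ D r≤k ⟩
    k * D              ∎)
    where
    e : ∀ k x → k * (1000 * x) ≡ 1000 * (k * x)
    e = solve-∀

  base : ∀ F → Shifted F → Claim F
  base F sh u nm ex = from-half F T₀ u nm ex ∣∁T₀∣ (*-cancelˡ-≤ 1000 (begin
    1000 * (5 * cnt (missing k F T₀))       ≡⟨ cong (λ z → 1000 * (5 * z)) (balance k F T₀ x u
                                                 (subst (λ z → cnt F + (z C k) + x ≡ (q + suc t) C k) (sym ∣∁T₀∣) ex)) ⟩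
    1000 * (5 * (g + x))                    ≡⟨ e₁ g x ⟩
    20 * (250 * g) + 5 * (1000 * x)         ≤⟨ +-mono-≤ (*-monoʳ-≤ 20 (base-close r x 1≤t 1≤l 1≤r r≤k room ex small)) (*-monoʳ-≤ 5 1000x≤D) ⟩
    20 * D + 5 * D                          ≤⟨ m≤m+n _ (2975 * D) ⟩
    20 * D + 5 * D + 2975 * D               ≡⟨ e₂ D ⟩
    1000 * (3 * D)                          ∎))
    where
    open Shifted-close {q} {t} {l} F sh u nm
    g = cnt (λ A → F A ∧ disj A T₀)
    e₁ : ∀ g x → 1000 * (5 * (g + x)) ≡ 20 * (250 * g) + 5 * (1000 * x)
    e₁ = solve-∀
    e₂ : ∀ D → 20 * D + 5 * D + 2975 * D ≡ 1000 * (3 * D)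
    e₂ = solve-∀

  step : ∀ F i → Claim (shift i F) → Claim F
  step F i ih u nm ex = choose (≤-total b b′)
    where
    IH = ih (shift-uniform k i F u) (λ m → nm (shift-matching (suc t) i F m))
      (trans (cong (λ z → z + (suc q C k) + x) (cnt-shift i F)) ex)
    T = proj₁ IH
    ∣T∣ = proj₁ (proj₂ IH)
    s = cnt (missing k (shift i F) T)
    b = cnt (missing k F T)
    b′ = cnt (missing k F (τ i T))
    -- The claim for the shift, at most 10 k x / r missing sets, is combined with 1000 k x ≤ r D.
    100s≤D : 100 * s ≤ D
    100s≤D = *-cancelˡ-≤ r {{>-nonZero 1≤r}} (begin
      r * (100 * s)          ≡⟨ e₁ r s ⟩
      100 * (r * s)          ≤⟨ *-monoʳ-≤ 100 (proj₂ (proj₂ IH)) ⟩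
      100 * (10 * (k * x))   ≡⟨ e₂ (k * x) ⟩
      1000 * (k * x)         ≤⟨ small ⟩
      r * D                  ∎)
      where
      e₁ : ∀ r s → r * (100 * s) ≡ 100 * (r * s)
      e₁ = solve-∀
      e₂ : ∀ y → 100 * (10 * y) ≡ 1000 * y
      e₂ = solve-∀
    both : b + b′ ≤ 2 * s + D
    both = ≤-trans (unshift k i F T) (+-monoʳ-≤ (2 * s) (cnt-moved l i T q ∣T∣))
    -- The better one of T and τ T misses at most 1/2 + 1/100 of D, which is below 3/5.
    half : ∀ c → 2 * c ≤ 2 * s + D → 5 * c ≤ 3 * D
    half c h = *-cancelˡ-≤ 40 (begin
      40 * (5 * c)                ≡⟨ e₁ c ⟩
      100 * (2 * c)               ≤⟨ *-monoʳ-≤ 100 h ⟩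
      100 * (2 * s + D)           ≡⟨ e₂ s D ⟩
      2 * (100 * s) + 100 * D     ≤⟨ +-monoˡ-≤ (100 * D) (*-monoʳ-≤ 2 100s≤D) ⟩
      2 * D + 100 * D             ≤⟨ m≤m+n _ (18 * D) ⟩
      2 * D + 100 * D + 18 * D    ≡⟨ e₃ D ⟩
      40 * (3 * D)                ∎)
      where
      e₁ : ∀ c → 40 * (5 * c) ≡ 100 * (2 * c)
      e₁ = solve-∀
      e₂ : ∀ s D → 100 * (2 * s + D) ≡ 2 * (100 * s) + 100 * D
      e₂ = solve-∀
      e₃ : ∀ D → 2 * D + 100 * D + 18 * D ≡ 40 * (3 * D)
      e₃ = solve-∀
    double : ∀ {c c′} → c ≤ c′ → 2 * c ≤ c + c′
    double {c} {c′} h = +-monoʳ-≤ c (≤-trans (≤-reflexive (+-identityʳ c)) h)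
    choose : b ≤ b′ ⊎ b′ ≤ b → Σ (Subset (q + suc t)) λ T → ∣ ∁ T ∣ ≡ suc q × r * cnt (missing k F T) ≤ 10 * (k * x)
    choose (inj₁ h) = from-half F T u nm ex ∣T∣ (half b (≤-trans (double h) both))
    choose (inj₂ h) = from-half F (τ i T) u nm ex (trans (∣∁∣-τ i T) ∣T∣)
      (half b′ (≤-trans (double h) (≤-trans (≤-reflexive (+-comm b′ b)) both)))

-- Comparison with the definitions in the statement

countᵇ-++ : ∀ {A : Set} (p : A → Bool) xs ys → countᵇ p (xs List.++ ys) ≡ countᵇ p xs + countᵇ p ys
countᵇ-++ p List.[]       ys = refl
countᵇ-++ p (x List.∷ xs) ys with p x
... | true  = cong suc (countᵇ-++ p xs ys)
... | false = countᵇ-++ p xs ys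

countᵇ-map : ∀ {A B : Set} (p : B → Bool) (f : A → B) xs → countᵇ p (List.map f xs) ≡ countᵇ (λ a → p (f a)) xs
countᵇ-map p f List.[]       = refl
countᵇ-map p f (x List.∷ xs) with p (f x)
... | true  = cong suc (countᵇ-map p f xs)
... | false = countᵇ-map p f xs

card≡cnt : ∀ {n} (F : Family n) → card F ≡ cnt F
card≡cnt {zero} F with F []
... | true  = refl
... | false = refl
card≡cnt {suc n} F = trans (countᵇ-++ F (List.map (true ∷_) (allSubsets n)) (List.map (false ∷_) (allSubsets n)))
  (cong₂ _+_ (trans (countᵇ-map F (true ∷_) (allSubsets n)) (card≡cnt (λ A → F (true ∷ A))))
             (trans (countᵇ-map F (false ∷_) (allSubsets n)) (card≡cnt (λ A → F (false ∷ A)))))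

meets≡ : ∀ {n} (A T : Subset n) → meets A T ≡ not (disj A T)
meets≡ A T with disj A T in e
... | true  = dec-false (nonempty? (A ∩ T)) λ { (i , p) →
  let a , b = x∈p∩q⁻ A T p in true≢false ([]=⇒lookup b) (disj-elim A T e i ([]=⇒lookup a)) }
... | false = dec-true (nonempty? (A ∩ T)) (common A T e)
  where
  common : ∀ {n} (A T : Subset n) → disj A T ≡ false → Nonempty (A ∩ T)
  common []          []          ()
  common (true ∷ A)  (true ∷ T)  _ = zero , here
  common (true ∷ A)  (false ∷ T) e = let i , p = common A T e in suc i , there p
  common (false ∷ A) (t ∷ T)     e = let i , p = common A T e in suc i , there p

matching⇒hasMatching : ∀ {n} s (F : Family n) → Matching s F → HasMatching F s
matching⇒hasMatching s F (sdr B b∈ dis) =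
  List.tabulate B , List.length-tabulate B , All.tabulate⁺ b∈ ,
  AllPairs.tabulate⁺ λ {i} {j} i≢j (x , p) →
    let a , b = x∈p∩q⁻ (B i) (B j) p
    in true≢false ([]=⇒lookup b) (disj-elim (B i) (B j) (dis i j i≢j) x ([]=⇒lookup a))

symDiff≡ : ∀ {n} k (F : Family n) T → IsKUniform k F →
  symDiffCard F S[ k , T ] ≡ cnt (missing k F T) + cnt (λ A → F A ∧ disj A T)
symDiff≡ k F T u = trans (card≡cnt (λ A → F A xor S[ k , T ] A))
  (trans (∑-cong (λ A → pw A (F A) refl)) (∑-+ (λ A → ⟦ missing k F T A ⟧) (λ A → ⟦ F A ∧ disj A T ⟧)))
  where
  pw : ∀ A b → F A ≡ b → ⟦ F A xor S[ k , T ] A ⟧ ≡ ⟦ missing k F T A ⟧ + ⟦ F A ∧ disj A T ⟧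
  pw A true e rewrite meets≡ A T | e | ≡ᵇ-refl (u A e) | disj-⊥ A with disj A T
  ... | true  = refl
  ... | false = refl
  pw A false e rewrite meets≡ A T | e | disj-⊥ A with ∣ A ∣ ≡ᵇ k | disj A T
  ... | true  | true  = refl
  ... | true  | false = refl
  ... | false | true  = refl
  ... | false | false = refl

-- Families of singletons

cnt-0-uniform : ∀ {n} (F : Family n) → IsKUniform 0 F → cnt F ≡ ⟦ F ⊥ ⟧
cnt-0-uniform {zero}  F u = refl
cnt-0-uniform {suc n} F u = cong₂ _+_
  (cnt-none (λ A → F (true ∷ A)) (λ A e → ⊥-elim (1+n≢0 (u (true ∷ A) e))))
  (cnt-0-uniform (λ A → F (false ∷ A)) (λ A → u (false ∷ A)))

support : ∀ {n} → Family n → Subset n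
support F = tabulate (λ i → F (⊥ [ i ]≔ true))

∣support∣ : ∀ {n} (F : Family n) → IsKUniform 1 F → ∣ support F ∣ ≡ cnt F
∣support∣ {zero} F u with F [] in e
... | false = refl
... | true  = ⊥-elim (1+n≢0 (sym (u [] e)))
∣support∣ {suc n} F u = trans (head (F (true ∷ ⊥)) (support (λ A → F (false ∷ A))))
  (cong₂ _+_ (sym (cnt-0-uniform (λ A → F (true ∷ A)) (λ A e → suc-injective (u (true ∷ A) e))))
             (∣support∣ (λ A → F (false ∷ A)) (λ A → u (false ∷ A))))
  where
  head : ∀ b (A : Subset n) → ∣ b ∷ A ∣ ≡ ⟦ b ⟧ + ∣ A ∣
  head true  A = refl
  head false A = refl

singleton : ∀ {n} (A : Subset n) → ∣ A ∣ ≡ 1 → Σ (Fin n) λ i → A ≡ ⊥ [ i ]≔ true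
singleton (true ∷ A) e = zero , cong (true ∷_) (empty A (suc-injective e))
  where
  empty : ∀ {n} (A : Subset n) → ∣ A ∣ ≡ 0 → A ≡ ⊥
  empty []          e = refl
  empty (false ∷ A) e = cong (false ∷_) (empty A e)
singleton (false ∷ A) e = let i , p = singleton A e in suc i , cong (false ∷_) p

disj-singleton : ∀ {n} i (T : Subset n) → disj (⊥ [ i ]≔ true) T ≡ not (lookup T i)
disj-singleton zero    (true ∷ T)  = refl
disj-singleton zero    (false ∷ T) = trans (disj-sym ⊥ T) (disj-⊥ T)
disj-singleton (suc i) (t ∷ T)     = disj-singleton i T

-- A singleton meets the support exactly when it is a member, so `F` is the star on its support.
symDiff-support : ∀ {n} (F : Family n) → IsKUniform 1 F → symDiffCard F S[ 1 , support F ] ≡ 0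
symDiff-support {n} F u = trans (card≡cnt (λ A → F A xor S[ 1 , support F ] A)) (∉⇒cnt≡0 _ pw)
  where
  xor-self : ∀ b → b xor b ≡ false
  xor-self true  = refl
  xor-self false = refl
  not-not : ∀ b → not (not b) ≡ b
  not-not true  = refl
  not-not false = refl
  pw : ∀ A → F A xor S[ 1 , support F ] A ≡ false
  pw A with ∣ A ∣ ≡ᵇ 1 in s
  ... | false = out (F A) refl
    where
    out : ∀ b → F A ≡ b → b xor false ≡ false
    out false e = refl
    out true  e = true≢false (≡ᵇ-refl (u A e)) s
  ... | true with singleton A (≡ᵇ-true ∣ A ∣ 1 s)
  ...   | i , refl = trans (cong (F (⊥ [ i ]≔ true) xor_) (trans (meets≡ (⊥ [ i ]≔ true) (support F))
            (trans (cong not (disj-singleton i (support F))) (trans (not-not (lookup (support F) i))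
              (lookup∘tabulate (λ j → F (⊥ [ j ]≔ true)) i)))))
          (xor-self (F (⊥ [ i ]≔ true)))

-- Clearing denominators

import Data.Integer as ℤ
import Data.Integer.Properties as ℤ
open import Data.Integer using (+_)
open import Data.Rational using (ℚ; 0ℚ; 1ℚ; _/_; mkℚ; toℚᵘ) renaming (_+_ to _+ℚ_; _*_ to _*ℚ_; _-_ to _-ℚ_; -_ to -ℚ_; _<_ to _<ℚ_)
import Data.Rational.Properties as ℚ
import Data.Rational.Unnormalised as ℚᵘ
import Data.Rational.Unnormalised.Properties as ℚᵘ

ℕtoℚ-homo : ∀ m → toℚᵘ (ℕtoℚ m) ℚᵘ.≃ ℚᵘ.mkℚᵘ (+ m) 0
ℕtoℚ-homo m = ℚ.toℚᵘ-fromℚᵘ (ℚᵘ.mkℚᵘ (+ m) 0)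

ℕtoℚ-+ : ∀ a b → ℕtoℚ (a + b) ≡ ℕtoℚ a +ℚ ℕtoℚ b
ℕtoℚ-+ a b = ℚ.toℚᵘ-injective (ℚᵘ.≃-trans (ℕtoℚ-homo (a + b)) (ℚᵘ.≃-trans (ℚᵘ.*≡* (cong (ℤ._* + 1) e))
  (ℚᵘ.≃-sym (ℚᵘ.≃-trans (ℚ.toℚᵘ-homo-+ (ℕtoℚ a) (ℕtoℚ b)) (ℚᵘ.+-cong (ℕtoℚ-homo a) (ℕtoℚ-homo b))))))
  where
  e : + (a + b) ≡ + a ℤ.* + 1 ℤ.+ + b ℤ.* + 1
  e = trans (ℤ.pos-+ a b) (sym (cong₂ ℤ._+_ (ℤ.*-identityʳ (+ a)) (ℤ.*-identityʳ (+ b))))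

pos-*₄ : ∀ i j k l → + (i * j * k * l) ≡ + i ℤ.* + j ℤ.* + k ℤ.* + l
pos-*₄ i j k l = trans (ℤ.pos-* (i * j * k) l) (cong (λ z → z ℤ.* + l)
  (trans (ℤ.pos-* (i * j) k) (cong (λ z → z ℤ.* + k) (ℤ.pos-* i j))))

-- With δ = a / d and c = δ / E, both sides are multiplied by n d E.
excess<⇒ : ∀ r n E M x a d-1 .(cop : Coprime a (suc d-1)) .{{_ : NonZero n}} .{{_ : NonZero E}} →
  ℕtoℚ x <ℚ (((+ r) / n) *ℚ (mkℚ (+ a) d-1 cop *ℚ ((+ 1) / E))) *ℚ ℕtoℚ M →
  x * (n * (suc d-1 * E)) < r * a * M
excess<⇒ r n@(suc n′) E@(suc E′) M x a d-1 cop h =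
  subst₂ _<_ (cong (x *_) (*-identityʳ (n * (suc d-1 * E)))) (e r a M)
    (ℤ.drop‿+<+ (subst₂ ℤ._<_ (sym (ℤ.pos-* x (n * (suc d-1 * E) * 1))) num (ℚᵘ.drop-*<* h′)))
  where
  δ = mkℚ (+ a) d-1 cop
  h′ : ℚᵘ.mkℚᵘ (+ x) 0 ℚᵘ.< (ℚᵘ.mkℚᵘ (+ r) n′ ℚᵘ.* (ℚᵘ.mkℚᵘ (+ a) d-1 ℚᵘ.* ℚᵘ.mkℚᵘ (+ 1) E′)) ℚᵘ.* ℚᵘ.mkℚᵘ (+ M) 0
  h′ = ℚᵘ.<-respˡ-≃ (ℕtoℚ-homo x) (ℚᵘ.<-respʳ-≃
    (ℚᵘ.≃-trans (ℚ.toℚᵘ-homo-* (((+ r) / n) *ℚ (δ *ℚ ((+ 1) / E))) (ℕtoℚ M)) (ℚᵘ.*-cong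
      (ℚᵘ.≃-trans (ℚ.toℚᵘ-homo-* ((+ r) / n) (δ *ℚ ((+ 1) / E))) (ℚᵘ.*-cong (ℚ.toℚᵘ-fromℚᵘ (ℚᵘ.mkℚᵘ (+ r) n′))
        (ℚᵘ.≃-trans (ℚ.toℚᵘ-homo-* δ ((+ 1) / E)) (ℚᵘ.*-cong ℚᵘ.≃-refl (ℚ.toℚᵘ-fromℚᵘ (ℚᵘ.mkℚᵘ (+ 1) E′))))))
      (ℕtoℚ-homo M)))
    (ℚ.toℚᵘ-mono-< h))
  num : + r ℤ.* (+ a ℤ.* + 1) ℤ.* + M ℤ.* + 1 ≡ + (r * (a * 1) * M * 1)
  num = trans (cong (λ z → + r ℤ.* z ℤ.* + M ℤ.* + 1) (sym (ℤ.pos-* a 1))) (sym (pos-*₄ r (a * 1) M 1))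
  e : ∀ r a M → r * (a * 1) * M * 1 ≡ r * a * M
  e = solve-∀

<⇒close : ∀ s D a d-1 .(cop : Coprime a (suc d-1)) → s * suc d-1 < 3 * a * D → ℕtoℚ s <ℚ (((+ 3) / 1) *ℚ mkℚ (+ a) d-1 cop) *ℚ ℕtoℚ D
<⇒close s D a d-1 cop h = ℚ.toℚᵘ-cancel-< (ℚᵘ.<-respˡ-≃ (ℚᵘ.≃-sym (ℕtoℚ-homo s)) (ℚᵘ.<-respʳ-≃ (ℚᵘ.≃-sym
  (ℚᵘ.≃-trans (ℚ.toℚᵘ-homo-* (((+ 3) / 1) *ℚ δ) (ℕtoℚ D)) (ℚᵘ.*-cong
    (ℚᵘ.≃-trans (ℚ.toℚᵘ-homo-* ((+ 3) / 1) δ) (ℚᵘ.*-cong (ℚ.toℚᵘ-fromℚᵘ (ℚᵘ.mkℚᵘ (+ 3) 0)) (ℚᵘ.≃-refl {ℚᵘ.mkℚᵘ (+ a) d-1}))) (ℕtoℚ-homo D)))) h′))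
  where
  δ = mkℚ (+ a) d-1 cop
  h′ : ℚᵘ.mkℚᵘ (+ s) 0 ℚᵘ.< (ℚᵘ.mkℚᵘ (+ 3) 0 ℚᵘ.* ℚᵘ.mkℚᵘ (+ a) d-1) ℚᵘ.* ℚᵘ.mkℚᵘ (+ D) 0
  h′ = ℚᵘ.*<* (subst₂ ℤ._<_ (ℤ.pos-* s (1 * suc d-1 * 1)) num
    (ℤ.+<+ (subst₂ _<_ (cong (s *_) (sym (e₁ d-1))) (sym (*-identityʳ (3 * a * D))) h)))
    where
    e₁ : ∀ d → 1 * suc d * 1 ≡ suc d
    e₁ = solve-∀
    num : + (3 * a * D * 1) ≡ + 3 ℤ.* + a ℤ.* + D ℤ.* + 1
    num = pos-*₄ 3 a D 1

-- Adding (1 + y) M on both sides and cancelling c + M turns the lower bound on c into an upper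
-- bound on the shortfall.
isolate-excess : ∀ N M c x y → N ≡ c + M + x →
  ℕtoℚ N -ℚ (1ℚ +ℚ y) *ℚ ℕtoℚ M <ℚ ℕtoℚ c → ℕtoℚ x <ℚ y *ℚ ℕtoℚ M
isolate-excess N M c x y refl h = subst₂ _<ℚ_ (cancel s (ℕtoℚ x)) (cancel s (y *ℚ ℕtoℚ M)) (ℚ.+-monoʳ-< (-ℚ s) (subst₂ _<ℚ_ lhs rhs (ℚ.+-monoˡ-< B h)))
  where
  B = (1ℚ +ℚ y) *ℚ ℕtoℚ M
  s = ℕtoℚ c +ℚ ℕtoℚ M
  cancel : ∀ s z → -ℚ s +ℚ (s +ℚ z) ≡ z
  cancel s z = trans (sym (ℚ.+-assoc (-ℚ s) s z)) (trans (cong (_+ℚ z) (ℚ.+-inverseˡ s)) (ℚ.+-identityˡ z))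
  lhs : ℕtoℚ (c + M + x) -ℚ B +ℚ B ≡ s +ℚ ℕtoℚ x
  lhs = trans (ℚ.+-assoc (ℕtoℚ (c + M + x)) (-ℚ B) B) (trans (cong (ℕtoℚ (c + M + x) +ℚ_) (ℚ.+-inverseˡ B))
    (trans (ℚ.+-identityʳ _) (trans (ℕtoℚ-+ (c + M) x) (cong (_+ℚ ℕtoℚ x) (ℕtoℚ-+ c M)))))
  rhs : ℕtoℚ c +ℚ B ≡ s +ℚ y *ℚ ℕtoℚ M
  rhs = trans (cong (ℕtoℚ c +ℚ_) (trans (ℚ.*-distribʳ-+ (ℕtoℚ M) 1ℚ y) (cong (_+ℚ y *ℚ ℕtoℚ M) (ℚ.*-identityˡ (ℕtoℚ M)))))
    (sym (ℚ.+-assoc (ℕtoℚ c) (ℕtoℚ M) (y *ℚ ℕtoℚ M)))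

-- By k C(n-t,k) = (n-t) C(n-t-1,k-1) and n - t ≤ n, where δ = a / d and c = δ / E.
excess-bound : ∀ q t l r a d E x → 1000 ≤ E → x * ((q + suc t) * (d * E)) < r * a * (suc q C suc l) →
  1000 * (suc l * x) * d ≤ r * a * (q C l)
excess-bound q t l r a d E x 1000≤E h = *-cancelˡ-≤ n {{>-nonZero (≤-trans (s≤s z≤n) (m≤n+m (suc t) q))}} (begin
  n * (1000 * (suc l * x) * d)            ≡⟨ e₁ n (suc l) x d ⟩
  suc l * (x * (n * d)) * 1000            ≤⟨ *-monoʳ-≤ (suc l * (x * (n * d))) 1000≤E ⟩
  suc l * (x * (n * d)) * E               ≡⟨ e₂ (suc l) x n d E ⟩
  suc l * (x * (n * (d * E)))             ≤⟨ *-monoʳ-≤ (suc l) (<⇒≤ h) ⟩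
  suc l * (r * a * (suc q C suc l))       ≡⟨ e₃ (suc l) (r * a) (suc q C suc l) ⟩
  r * a * (suc l * (suc q C suc l))       ≡⟨ cong (r * a *_) (absorb q l) ⟩
  r * a * (suc q * (q C l))               ≤⟨ *-monoʳ-≤ (r * a) (*-monoˡ-≤ (q C l) (≤-trans (m≤m+n (suc q) t) (≤-reflexive (sym (+-suc q t))))) ⟩
  r * a * (n * (q C l))                   ≡⟨ sym (e₃ n (r * a) (q C l)) ⟩
  n * (r * a * (q C l))                   ∎)
  where
  open ≤-Reasoning
  n = q + suc t
  e₁ : ∀ n k x d → n * (1000 * (k * x) * d) ≡ k * (x * (n * d)) * 1000
  e₁ = solve-∀
  e₂ : ∀ k x n d E → k * (x * (n * d)) * E ≡ k * (x * (n * (d * E)))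
  e₂ = solve-∀
  e₃ : ∀ k y z → k * (y * z) ≡ y * (k * z)
  e₃ = solve-∀

-- Assembling the stability theorem

final-arithmetic : ∀ l r a d D x b s → 1 ≤ r → 1 ≤ a → 1 ≤ D → 1000 * (suc l * x) * d ≤ r * a * D →
  r * b ≤ 10 * (suc l * x) → s ≤ 2 * b → s * d < 3 * a * D
final-arithmetic l r a d D x b s 1≤r 1≤a 1≤D small close s≤ = *-cancelˡ-< 50 (s * d) (3 * a * D) (begin-strict
  50 * (s * d)           ≤⟨ *-monoʳ-≤ 50 (*-monoˡ-≤ d s≤) ⟩
  50 * (2 * b * d)       ≡⟨ e₁ b d ⟩
  100 * (b * d)          ≤⟨ 100bd ⟩
  a * D                  <⟨ m<m+n (a * D) (≤-trans (*-mono-≤ 1≤a 1≤D) (m≤m+n (a * D) (148 * (a * D)))) ⟩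
  a * D + 149 * (a * D)  ≡⟨ e₂ a D ⟩
  50 * (3 * a * D)       ∎)
  where
  open ≤-Reasoning
  e₁ : ∀ b d → 50 * (2 * b * d) ≡ 100 * (b * d)
  e₁ = solve-∀
  e₂ : ∀ a D → a * D + 149 * (a * D) ≡ 50 * (3 * a * D)
  e₂ = solve-∀
  100bd : 100 * (b * d) ≤ a * D
  100bd = *-cancelˡ-≤ r {{>-nonZero 1≤r}} (begin
    r * (100 * (b * d))          ≡⟨ e₃ r b d ⟩
    100 * d * (r * b)            ≤⟨ *-monoʳ-≤ (100 * d) close ⟩
    100 * d * (10 * (suc l * x)) ≡⟨ e₄ d (suc l * x) ⟩
    1000 * (suc l * x) * d       ≤⟨ small ⟩
    r * a * D                    ≡⟨ *-assoc r a D ⟩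
    r * (a * D)                  ∎)
    where
    e₃ : ∀ r b d → r * (100 * (b * d)) ≡ 100 * d * (r * b)
    e₃ = solve-∀
    e₄ : ∀ d y → 100 * d * (10 * y) ≡ 1000 * y * d
    e₄ = solve-∀

stability : ∀ q t l r a d E (F : Family (q + suc t)) x → 1 ≤ t → 1 ≤ r → r ≤ suc l → (2 * t + 1) * (r + l) ≤ q →
  1 ≤ a → 4 * a ≤ d → 1000 ≤ E → IsKUniform (suc l) F → ¬ Matching (suc t) F →
  cnt F + (suc q C suc l) + x ≡ (q + suc t) C suc l →
  x * ((q + suc t) * (d * E)) < r * a * (suc q C suc l) →
  Σ (Subset (q + suc t)) λ T → ∣ T ∣ ≡ t × symDiffCard F S[ suc l , T ] * d < 3 * a * (q C l)
-- For singletons the links have uniformity 0, to which `cliques` does not apply. Here r = 1, so the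
-- hypothesis gives 1000 x ≤ 1. Hence x = 0, |F| = t, and `F` is a star.
stability q t zero r a d E F x 1≤t 1≤r r≤k room 1≤a 4a≤d 1000≤E u nm excess small =
  support F , trans (∣support∣ F u) cnt≡t , subst (λ z → z * d < 3 * a * (q C 0)) (sym (symDiff-support F u))
    (≤-trans 1≤a (≤-trans (m≤m+n a _) (≤-reflexive (sym (*-identityʳ (3 * a))))))
  where
  n = q + suc t
  x≡0 : x ≡ 0
  x≡0 = zero-excess x (*-cancelʳ-≤ (1000 * x) 1 (d * suc q) {{m*n≢0 d (suc q) {{>-nonZero 1≤d}}}} (begin
    1000 * x * (d * suc q)              ≡⟨ e₁ x d (suc q) ⟩
    1000 * (1 * x) * d * suc q          ≤⟨ *-monoˡ-≤ (suc q) (excess-bound q t 0 r a d E x 1000≤E small) ⟩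
    r * a * 1 * suc q                   ≤⟨ *-monoˡ-≤ (suc q) (≤-trans (≤-reflexive (*-identityʳ (r * a))) (≤-trans (*-monoˡ-≤ a r≤k) (≤-trans (≤-reflexive (*-identityˡ a)) a≤d))) ⟩
    d * suc q                           ≡⟨ sym (*-identityˡ (d * suc q)) ⟩
    1 * (d * suc q)                     ∎))
    where
    open ≤-Reasoning
    a≤d : a ≤ d
    a≤d = ≤-trans (m≤m+n a (3 * a)) 4a≤d
    1≤d : 1 ≤ d
    1≤d = ≤-trans 1≤a a≤d
    e₁ : ∀ x d q → 1000 * x * (d * q) ≡ 1000 * (1 * x) * d * q
    e₁ = solve-∀
    zero-excess : ∀ x → 1000 * x ≤ 1 → x ≡ 0
    zero-excess zero    _ = refl
    zero-excess (suc x) h = ⊥-elim (<⇒≱ (s≤s (s≤s z≤n)) (≤-trans (*-monoʳ-≤ 1000 (s≤s {0} {x} z≤n)) h))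
  cnt≡t : cnt F ≡ t
  cnt≡t = +-cancelʳ-≡ (suc q) (cnt F) t (begin
    cnt F + suc q              ≡⟨ cong (λ z → cnt F + z) (sym (nC1≡n (suc q))) ⟩
    cnt F + (suc q C 1)        ≡⟨ trans (sym (+-identityʳ _)) (cong (λ z → cnt F + (suc q C 1) + z) (sym x≡0)) ⟩
    cnt F + (suc q C 1) + x    ≡⟨ excess ⟩
    n C 1                      ≡⟨ nC1≡n n ⟩
    q + suc t                  ≡⟨ trans (+-suc q t) (trans (cong suc (+-comm q t)) (sym (+-suc t q))) ⟩
    t + suc q                  ∎)
    where open ≡-Reasoning
stability q t l@(suc _) r a d E F x 1≤t 1≤r r≤k room 1≤a 4a≤d 1000≤E u nm excess small = T , ∣T∣≡t ,
  final-arithmetic l r a d D x b (symDiffCard F S[ suc l , T ]) 1≤r 1≤a (C-pos q l l≤q) raD (proj₂ (proj₂ close)) sd≤2b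
  where
  open ≤-Reasoning
  n = q + suc t
  D = q C l
  l≤q : l ≤ q
  l≤q = ≤-trans (≤-trans (m≤n+m l r) (≤-trans (≤-reflexive (sym (*-identityˡ (r + l)))) (*-monoˡ-≤ (r + l) (m≤n+m 1 (2 * t))))) room
  raD : 1000 * (suc l * x) * d ≤ r * a * D
  raD = excess-bound q t l r a d E x 1000≤E small
  a≤d : a ≤ d
  a≤d = ≤-trans (m≤m+n a (3 * a)) 4a≤d
  close = closeness q t l r x 1≤t (s≤s z≤n) 1≤r r≤k room
    (*-cancelʳ-≤ (1000 * (suc l * x)) (r * D) d {{>-nonZero (≤-trans 1≤a a≤d)}} (begin
      1000 * (suc l * x) * d  ≤⟨ raD ⟩
      r * a * D               ≡⟨ e r a D ⟩
      r * D * a               ≤⟨ *-monoʳ-≤ (r * D) a≤d ⟩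
      r * D * d               ∎))
    F u nm excess
    where
    e : ∀ r a D → r * a * D ≡ r * D * a
    e = solve-∀
  T = proj₁ close
  ∣∁T∣ = proj₁ (proj₂ close)
  b = cnt (missing (suc l) F T)
  ∣T∣≡t : ∣ T ∣ ≡ t
  ∣T∣≡t = +-cancelʳ-≡ (suc q) ∣ T ∣ t (begin-equality
    ∣ T ∣ + suc q          ≡⟨ cong (λ z → ∣ T ∣ + z) (trans (sym ∣∁T∣) (∣∁p∣≡n∸∣p∣ T)) ⟩
    ∣ T ∣ + (n ∸ ∣ T ∣)    ≡⟨ m+[n∸m]≡n (∣p∣≤n T) ⟩
    q + suc t              ≡⟨ trans (+-suc q t) (trans (cong suc (+-comm q t)) (sym (+-suc t q))) ⟩
    t + suc q              ∎)
  sd≤2b : symDiffCard F S[ suc l , T ] ≤ 2 * b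
  sd≤2b = begin
    symDiffCard F S[ suc l , T ]             ≡⟨ symDiff≡ (suc l) F T u ⟩
    b + cnt (λ A → F A ∧ disj A T)           ≤⟨ +-monoʳ-≤ b (m≤m+n _ x) ⟩
    b + (cnt (λ A → F A ∧ disj A T) + x)     ≡⟨ cong (λ z → b + z) (trans (sym (balance (suc l) F T x u
                                                  (subst (λ z → cnt F + (z C suc l) + x ≡ n C suc l) (sym ∣∁T∣) excess))) (sym (+-identityʳ b))) ⟩
    2 * b                                    ∎

stability-ℚ : ∀ q t l r a d-1 .(cop : Coprime a (suc d-1)) E (c : ℚ) .{{_ : NonZero E}} → let δ = mkℚ (+ a) d-1 cop ; n = q + suc t in
  .{{_ : NonZero n}} → c ≡ δ *ℚ ((+ 1) / E) → 1000 ≤ E → 1 ≤ a → 4 * a ≤ suc d-1 →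
  1 ≤ t → 1 ≤ r → r ≤ suc l → (2 * t + 1) * (r + l) ≤ q →
  (F : Family n) → IsKUniform (suc l) F → ¬ Matching (suc t) F →
  (ℕtoℚ (n C suc l) -ℚ ((1ℚ +ℚ (((+ r) / n) *ℚ c)) *ℚ ℕtoℚ ((n ∸ t) C suc l))) <ℚ ℕtoℚ (card F) →
  Σ (Subset n) λ T → ∣ T ∣ ≡ t ×
    ℕtoℚ (symDiffCard F S[ suc l , T ]) <ℚ (((+ 3) / 1) *ℚ δ *ℚ ℕtoℚ ((n ∸ t ∸ 1) C l))
stability-ℚ q t l r a d-1 cop E c c≡ 1000≤E 1≤a 4a≤d 1≤t 1≤r r≤k room F u nm large =
  let T , ∣T∣ , close = stability q t l r a d E F x 1≤t 1≤r r≤k room 1≤a 4a≤d 1000≤E u nm excess small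
  in T , ∣T∣ , subst (λ z → ℕtoℚ (symDiffCard F S[ suc l , T ]) <ℚ (((+ 3) / 1) *ℚ δ *ℚ ℕtoℚ (z C l)))
       (sym (cong (_∸ 1) n∸t)) (<⇒close (symDiffCard F S[ suc l , T ]) (q C l) a d-1 cop close)
  where
  n = q + suc t
  d = suc d-1
  δ = mkℚ (+ a) d-1 cop
  M = suc q C suc l
  x = (n C suc l) ∸ (cnt F + M)
  n∸t : n ∸ t ≡ suc q
  n∸t = trans (cong (_∸ t) (+-suc q t)) (m+n∸n≡m (suc q) t)
  -- The truncated difference defining `x` is exact by Frankl's bound at level k.
  excess : cnt F + M + x ≡ n C suc l
  excess = m+[n∸m]≡n (emc q t l F u nm (≤-trans (*-monoʳ-≤ (2 * t + 1) (m≤n+m l r)) room))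
  small : x * (n * (d * E)) < r * a * M
  small = excess<⇒ r n E M x a d-1 cop (subst (λ z → ℕtoℚ x <ℚ (((+ r) / n) *ℚ z) *ℚ ℕtoℚ M) c≡
    (isolate-excess (n C suc l) M (cnt F) x (((+ r) / n) *ℚ c) (sym excess)
      (subst₂ (λ y z → (ℕtoℚ (n C suc l) -ℚ ((1ℚ +ℚ (((+ r) / n) *ℚ c)) *ℚ ℕtoℚ (y C suc l))) <ℚ ℕtoℚ z)
        n∸t (card≡cnt F) large)))

cOf-≡ : ∀ δ → cOf δ ≡ δ *ℚ ((+ 1) / 10000000000)
cOf-≡ δ = refl

¬0<negative : ∀ {m d-1} .{cop : Coprime (suc m) (suc d-1)} → ¬ (0ℚ <ℚ mkℚ ℤ.-[1+ m ] d-1 cop)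
¬0<negative p with ℚ.drop-*<* p
... | ()

-- `E` is the denominator in c = δ / E, and 1000 ≤ E is the form in which its size enters.
stability-of-stars : ∀ δ c E .{{_ : NonZero E}} → 0ℚ <ℚ δ → δ <ℚ ((+ 1) / 4) → c ≡ δ *ℚ ((+ 1) / E) → 1000 ≤ E →
  ∀ r t k n .{{_ : NonZero n}} → 1 ≤ r → 1 ≤ t → 1 ≤ k → r ≤ k → (2 * t + 1) * (k + r) ∸ t < n →
  (𝒜 : Family n) → IsKUniform k 𝒜 → ¬ HasMatching 𝒜 (suc t) →
  (ℕtoℚ (n C k) -ℚ ((1ℚ +ℚ (((+ r) / n) *ℚ c)) *ℚ ℕtoℚ ((n ∸ t) C k))) <ℚ ℕtoℚ (card 𝒜) →
  Σ (Subset n) λ T → ∣ T ∣ ≡ t ×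
    ℕtoℚ (symDiffCard 𝒜 S[ k , T ]) <ℚ (((+ 3) / 1) *ℚ δ *ℚ ℕtoℚ ((n ∸ t ∸ 1) C (k ∸ 1)))
stability-of-stars (mkℚ ℤ.-[1+ _ ] _ _) _ _ 0<δ = ⊥-elim (¬0<negative 0<δ)
stability-of-stars δ@(mkℚ (+ a) d-1 cop) c E 0<δ δ<¼ c≡ 1000≤E r t (suc l) n 1≤r 1≤t _ r≤k n> 𝒜 u nm large =
  main (n ∸ suc t) (sym (m∸n+n≡m t<n)) room 𝒜 u (λ m → nm (matching⇒hasMatching (suc t) 𝒜 m)) large
  where
  d = suc d-1
  1≤a : 1 ≤ a
  1≤a = subst (1 ≤_) (*-identityʳ a) (ℤ.drop‿+<+ (subst (+ 0 ℤ.<_) (sym (ℤ.pos-* a 1)) (ℚ.drop-*<* 0<δ)))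
  4a≤d : 4 * a ≤ d
  4a≤d = <⇒≤ (subst₂ _<_ (*-comm a 4) (*-identityˡ d)
    (ℤ.drop‿+<+ (subst₂ ℤ._<_ (sym (ℤ.pos-* a 4)) (sym (ℤ.pos-* 1 d)) (ℚ.drop-*<* δ<¼))))
  -- As k = l + 1, the product (2 t + 1)(k + r) is (2 t + 1)(r + l) + 2 t + 1. So q = n - t - 1
  -- leaves room for 2 t + 1 disjoint (r + l)-sets, which explains the form of the bound on n.
  wide : (2 * t + 1) * (r + l) + suc t < n
  wide = +-cancelʳ-≤ t _ n (begin
    suc ((2 * t + 1) * (r + l) + suc t) + t          ≡⟨ e t r l ⟩
    suc ((2 * t + 1) * (suc l + r))                  ≤⟨ s≤s (m≤n+m∸n ((2 * t + 1) * (suc l + r)) t) ⟩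
    suc (t + ((2 * t + 1) * (suc l + r) ∸ t))        ≡⟨ sym (+-suc t _) ⟩
    t + suc ((2 * t + 1) * (suc l + r) ∸ t)          ≤⟨ +-monoʳ-≤ t n> ⟩
    t + n                                            ≡⟨ +-comm t n ⟩
    n + t                                            ∎)
    where
    open ≤-Reasoning
    e : ∀ t r l → suc ((2 * t + 1) * (r + l) + suc t) + t ≡ suc ((2 * t + 1) * (suc l + r))
    e = solve-∀
  t<n : suc t ≤ n
  t<n = ≤-trans (m≤n+m (suc t) ((2 * t + 1) * (r + l))) (<⇒≤ wide)
  room : (2 * t + 1) * (r + l) ≤ n ∸ suc t
  room = m+n≤o⇒m≤o∸n ((2 * t + 1) * (r + l)) (<⇒≤ wide)
  -- The size of the ground set is generalised so that q + suc t can replace it in the types.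
  main : ∀ {n} .{{_ : NonZero n}} q → n ≡ q + suc t → (2 * t + 1) * (r + l) ≤ q →
    (𝒜 : Family n) → IsKUniform (suc l) 𝒜 → ¬ Matching (suc t) 𝒜 →
    (ℕtoℚ (n C suc l) -ℚ ((1ℚ +ℚ (((+ r) / n) *ℚ c)) *ℚ ℕtoℚ ((n ∸ t) C suc l))) <ℚ ℕtoℚ (card 𝒜) →
    Σ (Subset n) λ T → ∣ T ∣ ≡ t ×
      ℕtoℚ (symDiffCard 𝒜 S[ suc l , T ]) <ℚ (((+ 3) / 1) *ℚ δ *ℚ ℕtoℚ ((n ∸ t ∸ 1) C l))
  main q refl room 𝒜 u nm large = stability-ℚ q t l r a d-1 cop E c c≡ 1000≤E
    1≤a 4a≤d 1≤t 1≤r r≤k room 𝒜 u nm large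

theorem1p6 : (δ : ℚ) → 0ℚ <ℚ δ → δ <ℚ ((+ 1) / 4) →
    (r t k n : ℕ) → .{{_ : NonZero n}} →
    1 ≤ r → 1 ≤ t → 1 ≤ k → 1 ≤ n → r ≤ k →
    (2 * t + 1) * (k + r) ∸ t < n →
    (𝒜 : Family n) → IsKUniform k 𝒜 →
    ¬ HasMatching 𝒜 (suc t) →
    (ℕtoℚ (n C k) -ℚ ((1ℚ +ℚ (((+ r) / n) *ℚ cOf δ)) *ℚ ℕtoℚ ((n ∸ t) C k))) <ℚ ℕtoℚ (card 𝒜) →
    Σ (Subset n) λ T →
    ∣ T ∣ ≡ t ×
    ℕtoℚ (symDiffCard 𝒜 S[ k , T ]) <ℚ (((+ 3) / 1) *ℚ δ *ℚ ℕtoℚ ((n ∸ t ∸ 1) C (k ∸ 1)))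
theorem1p6 δ 0<δ δ<¼ r t k n 1≤r 1≤t 1≤k _ =
  stability-of-stars δ (cOf δ) 10000000000 0<δ δ<¼ (cOf-≡ δ) (m≤m+n 1000 9999999000) r t k n 1≤r 1≤t 1≤k
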